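{- Let $G=(P,B)$ be an irreducible braced triangulation with $|B|=2$. Then $G$ is isomorphic to one of the following five braced triangulations (an isomorphism being a bijection of vertex sets mapping edges of the triangulation onto edges of the triangulation and braces onto braces): (I) vertices $1,\dots,6$; $P$ is the octahedron, whose edges are all pairs except $\{1,4\},\{2,5\},\{3,6\}$; $B=\{14,25\}$. (II) vertices $a,t,c,m,h,k$; $P$ has edges $at,tc,ca,am,mc,ha,hm,hc,th,mk,kh,kc$; $B=\{tm,ka\}$. (III) the same $P$ as in (II), with $B=\{tm,tk\}$. (IV) vertices $s_1,s_2,s_3,s_4,v_1,v_2,v_3$; $P$ has edges $s_1s_3,s_3v_2,v_2s_1,s_4v_1,v_1s_2,s_2v_2,s_4s_1,v_1s_1,s_2s_1,s_2s_3,v_1s_3,s_4s_3,s_4v_3,v_3s_1,v_3s_3$; $B=\{v_1v_2,v_1v_3\}$. (V) vertices $s_1,s_2,s_3,s_4,v_1,v_2,v_3$; $P$ has edges $s_1s_3,s_3v_2,v_2s_1,s_4v_1,v_1s_2,s_2v_2,s_4s_1,v_1s_1,s_2s_1,s_2s_3,v_1s_3,s_4v_3,v_3s_1,v_3s_3,v_1v_3$; $B=\{v_1v_2,s_4s_3\}$.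
   Context: A sphere graph is a simple graph with a fixed embedding in the 2-sphere without edge crossings. A (sphere) triangulation $P$ is a maximal sphere graph with at least 3 vertices (each of the graphs $P$ listed in the claim is planar and maximal planar, hence has an essentially unique such embedding). An edge $e$ of $P$ is contractible in $P$ if it belongs to precisely two 3-cycles of $P$. A braced triangulation $G=(P,B)$ is the simple graph obtained from a triangulation $P$ by adjoining a set $B$ of additional edges (braces) joining pairs of vertices non-adjacent in $P$. An edge $e$ of $P$ is contractible in $G$ if $e$ is contractible in $P$ and $e$ does not belong to any 3-cycle of $G$ containing a brace. $G$ is irreducible if no edge of $P$ is contractible in $G$. -}

module Defs where

open import Data.Nat using (ℕ; zero; suc; _+_; _*_; _≤_; _≡ᵇ_; _<ᵇ_)
open import Data.Nat.DivMod using (_/_)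
open import Data.Fin using (Fin; toℕ)
open import Data.Bool using (Bool; true; false; _∧_; _∨_; not; T; if_then_else_)
open import Data.List using (List; []; _∷_; _++_; [_]; allFin; concatMap; map)
open import Data.Bool.ListAction using (any)
open import Data.List.Membership.Propositional using (_∈_)
open import Data.List.Relation.Unary.Unique.Propositional using (Unique)
open import Data.Product using (Σ; ∃; ∃-syntax; _×_; _,_; proj₁; proj₂)
open import Data.Sum using (_⊎_)
open import Relation.Binary.PropositionalEquality using (_≡_)
open import Relation.Nullary using (¬_)
open import Function.Bundles using (_↔_; Inverse)

Adj : ℕ → Set
Adj n = Fin n → Fin n → Bool

IsSimple : ∀ {n} → Adj n → Set
IsSimple {n} a = (∀ (u v : Fin n) → a u v ≡ a v u) × (∀ (u : Fin n) → a u u ≡ false)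

count : {A : Set} → (A → Bool) → List A → ℕ
count p []       = 0
count p (x ∷ xs) = if p x then suc (count p xs) else count p xs

orderedPairs : ∀ n → List (Fin n × Fin n)
orderedPairs n = concatMap (λ i → map (λ j → (i , j)) (allFin n)) (allFin n)

numEdges : ∀ {n} → Adj n → ℕ
numEdges {n} a = count (λ p → (toℕ (proj₁ p) <ᵇ toℕ (proj₂ p)) ∧ a (proj₁ p) (proj₂ p)) (orderedPairs n)

data Reach {n : ℕ} (a : Adj n) : Fin n → Fin n → Set where
  here : ∀ {u} → Reach a u u
  step : ∀ {u v w} → T (a u v) → Reach a v w → Reach a u w

Connected : ∀ {n} → Adj n → Set
Connected {n} a = ∀ (u v : Fin n) → Reach a u v

-- Combinatorial (oriented) embeddings in a surface: rotation systems.
-- rot v is the cyclic order of the neighbours of v around v.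

CycNext : {A : Set} → List A → A → A → Set
CycNext {A} xs x y =
  (Σ (List A) λ ys → Σ (List A) λ zs → xs ≡ ys ++ (x ∷ y ∷ zs))
  ⊎ (Σ (List A) λ ys → xs ≡ y ∷ (ys ++ [ x ]))

record RotationSystem {n : ℕ} (a : Adj n) : Set where
  field
    rot        : Fin n → List (Fin n)
    rot-unique : ∀ v → Unique (rot v)
    rot-sound  : ∀ v u → u ∈ rot v → T (a v u)
    rot-compl  : ∀ v u → T (a v u) → u ∈ rot v

-- Face tracing: the dart (u,v) is followed by (v,w) where w is the successor
-- of u in rot v.  All faces are triangles: for each dart (u,v) the face is
-- (u,v),(v,w),(w,u) and then back to (u,v).
AllFacesTriangles : ∀ {n} {a : Adj n} → RotationSystem a → Set
AllFacesTriangles {n} {a} R =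
  ∀ (u v : Fin n) → T (a u v) →
    ∃[ w ] (CycNext (rot v) u w × CycNext (rot w) v u × CycNext (rot u) w v)
  where open RotationSystem R

numFacesTriangular : ∀ {n} → Adj n → ℕ
numFacesTriangular a = (2 * numEdges a) / 3

-- A sphere triangulation: a simple connected graph with at least 3 vertices
-- having an embedding (rotation system) in which every face is a triangle and
-- whose Euler characteristic V - E + F equals 2 (so the surface is the sphere).
IsSphereTriangulation : ∀ n → Adj n → Set
IsSphereTriangulation n a =
  3 ≤ n × IsSimple a × Connected a ×
  (Σ (RotationSystem a) λ R →
     AllFacesTriangles R × (n + numFacesTriangular a ≡ numEdges a + 2))

record BracedTriangulation (n : ℕ) : Set where
  field
    P        : Adj n
    B        : Adj n
    P-tri    : IsSphereTriangulation n P
    B-simple : IsSimple B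
    B-nonP   : ∀ (u v : Fin n) → T (B u v) → P u v ≡ false

  G : Adj n
  G u v = P u v ∨ B u v

open BracedTriangulation public

num3CyclesThrough : ∀ {n} → Adj n → Fin n → Fin n → ℕ
num3CyclesThrough {n} a u v = count (λ w → a u w ∧ a v w) (allFin n)

ContractibleInP : ∀ {n} → Adj n → Fin n → Fin n → Set
ContractibleInP a u v = T (a u v) × num3CyclesThrough a u v ≡ 2

-- e = uv is contractible in G: contractible in P and no 3-cycle u v w of G
-- uses a brace (uv itself is an edge of P, so a brace must be uw or vw).
ContractibleInG : ∀ {n} → BracedTriangulation n → Fin n → Fin n → Set
ContractibleInG {n} Γ u v =
  ContractibleInP (P Γ) u v ×
  (∀ (w : Fin n) → ¬ (T (G Γ u w) × T (G Γ v w) × T (B Γ u w ∨ B Γ v w)))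

Irreducible : ∀ {n} → BracedTriangulation n → Set
Irreducible {n} Γ = ∀ (u v : Fin n) → T (P Γ u v) → ¬ ContractibleInG Γ u v

numBraces : ∀ {n} → BracedTriangulation n → ℕ
numBraces Γ = numEdges (B Γ)

IsoTo : ∀ {n} → BracedTriangulation n → (m : ℕ) → Adj m → Adj m → Set
IsoTo {n} Γ m P' B' =
  Σ (Fin n ↔ Fin m) λ f →
    ∀ (u v : Fin n) →
      (P Γ u v ≡ P' (Inverse.to f u) (Inverse.to f v)) ×
      (B Γ u v ≡ B' (Inverse.to f u) (Inverse.to f v))

fromEdges : ∀ {m} → List (ℕ × ℕ) → Adj m
fromEdges es u v =
  any (λ e → ((toℕ u ≡ᵇ proj₁ e) ∧ (toℕ v ≡ᵇ proj₂ e)) ∨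
             ((toℕ u ≡ᵇ proj₂ e) ∧ (toℕ v ≡ᵇ proj₁ e))) es

-- (I) vertices 1..6 ↦ 0..5; octahedron: all pairs except 14, 25, 36.
P-I : Adj 6
P-I = fromEdges ((0 , 1) ∷ (0 , 2) ∷ (0 , 4) ∷ (0 , 5) ∷
                 (1 , 2) ∷ (1 , 3) ∷ (1 , 5) ∷
                 (2 , 3) ∷ (2 , 4) ∷
                 (3 , 4) ∷ (3 , 5) ∷
                 (4 , 5) ∷ [])
B-I : Adj 6
B-I = fromEdges ((0 , 3) ∷ (1 , 4) ∷ [])

-- (II),(III) vertices a,t,c,m,h,k ↦ 0,1,2,3,4,5
P-II : Adj 6
P-II = fromEdges ((0 , 1) ∷ (1 , 2) ∷ (2 , 0) ∷ (0 , 3) ∷ (3 , 2) ∷ (4 , 0) ∷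
                  (4 , 3) ∷ (4 , 2) ∷ (1 , 4) ∷ (3 , 5) ∷ (5 , 4) ∷ (5 , 2) ∷ [])
B-II : Adj 6
B-II = fromEdges ((1 , 3) ∷ (5 , 0) ∷ [])
B-III : Adj 6
B-III = fromEdges ((1 , 3) ∷ (1 , 5) ∷ [])

-- (IV),(V) vertices s1,s2,s3,s4,v1,v2,v3 ↦ 0,1,2,3,4,5,6
P-IV : Adj 7
P-IV = fromEdges ((0 , 2) ∷ (2 , 5) ∷ (5 , 0) ∷ (3 , 4) ∷ (4 , 1) ∷ (1 , 5) ∷
                  (3 , 0) ∷ (4 , 0) ∷ (1 , 0) ∷ (1 , 2) ∷ (4 , 2) ∷ (3 , 2) ∷
                  (3 , 6) ∷ (6 , 0) ∷ (6 , 2) ∷ [])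
B-IV : Adj 7
B-IV = fromEdges ((4 , 5) ∷ (4 , 6) ∷ [])

P-V : Adj 7
P-V = fromEdges ((0 , 2) ∷ (2 , 5) ∷ (5 , 0) ∷ (3 , 4) ∷ (4 , 1) ∷ (1 , 5) ∷
                 (3 , 0) ∷ (4 , 0) ∷ (1 , 0) ∷ (1 , 2) ∷ (4 , 2) ∷ (3 , 6) ∷
                 (6 , 0) ∷ (6 , 2) ∷ (4 , 6) ∷ [])
B-V : Adj 7
B-V = fromEdges ((4 , 5) ∷ (3 , 2) ∷ [])

module Submission where

-- Homology over 𝔽₂ replaces the Jordan curve theorem: by Euler's formula a 3-cycle is the boundary of a
-- set of faces, so a 3-cycle which is not a face separates the triangulation.  Call an edge good if it lies
-- in no such 3-cycle; in an irreducible braced triangulation every good edge lies in a 3-cycle with a brace.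
-- Every vertex has a good edge, hence a vertex which is not an end of a brace is adjacent to both ends of one
-- of the braces pq, rs.  A side of a separating 3-cycle that is minimal under inclusion has only good edges,
-- and turns out to be a single end of degree 3.  If no 3-cycle separates, the graph is the octahedron.
-- Otherwise both sides of a separating 3-cycle contain an end of degree 3; apart from one small case these
-- are p and r.  The neighbours of p are adjacent to q, those of r to s, and all but one of the triangles on q
-- and two neighbours of p are faces, which leaves only a few ways in which N(p) and N(r) can overlap.

-- No homology group is computed. A single homogeneous system over 𝔽₂ has one unknown per ordered
-- pair of vertices, the value of the face at that dart (zero if the pair is not adjacent), and one
-- more unknown `t`, the coefficient of the 3-cycle. Taking `t` as an unknown keeps the system
-- homogeneous, so fewer equations than unknowns suffice. The boundary condition is imposed only at
-- edges outside a spanning tree. This saves `n - 1` equations, and Euler characteristic 2 then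
-- leaves room for one more, which fixes the value at one dart and so excludes constant solutions.
-- At tree edges the condition follows, since the boundary of a 2-chain and the 3-cycle are both
-- cycles and a tree carries no nonzero cycle. After that the sphere enters only through `Planar`.
-- Its basic consequence is that the two ends of an edge never separate the graph (`no-edge-cut`);
-- this is what nests the sides of separating 3-cycles and makes minimal sides available. The braces
-- may share an end. They are named so that the shared end can only be `q = s`, which lets most
-- arguments treat both situations at once.

open import Defs
open import Data.Nat using (ℕ; zero; suc; _+_; _*_; _≤_; _<_; _<ᵇ_; z≤n; s≤s)
import Data.Nat.Properties as ℕ
open import Data.Nat.DivMod using (_/_; /-monoˡ-≤; m*n/n≡m)
open import Data.Nat.Induction using (<-wellFounded)
open import Data.Nat.Tactic.RingSolver using (solve-∀)
open import Induction.WellFounded using (Acc; acc)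
open import Data.Bool using (Bool; true; false; T; _∧_; _∨_; not; _xor_; if_then_else_)
import Data.Bool.Properties as 𝔹
open import Data.Fin using (Fin; zero; suc; toℕ; combine; remQuot)
open import Data.Fin.Patterns using (0F; 1F; 2F; 3F; 4F; 5F; 6F)
open import Data.Fin.Properties using (_≟_; any?; all?; toℕ-injective; suc-injective; combine-remQuot)
open import Data.List using (List; []; _∷_; _++_; [_]; length; map; foldr; concatMap; allFin; cartesianProduct)
import Data.List.Properties as List
open import Data.List.Membership.Propositional using (_∈_; _∉_)
open import Data.List.Membership.Propositional.Properties
  using (∈-map⁺; ∈-map⁻; ∈-++⁺ˡ; ∈-++⁺ʳ; ∈-++⁻; ∈-allFin; ∈-∃++; ∈-cartesianProduct⁺; ∈-concat⁺′)
import Data.List.Membership.DecPropositional as DecMembership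
open import Data.List.Relation.Unary.Any as Any using (here; there)
open import Data.List.Relation.Unary.All as All using (All; []; _∷_)
import Data.List.Relation.Unary.All.Properties as All
open import Data.List.Relation.Unary.AllPairs using ([]; _∷_)
open import Data.List.Relation.Unary.Unique.Propositional using (Unique)
import Data.List.Relation.Unary.Unique.Propositional.Properties as Unique
open import Data.Vec using (Vec; []; _∷_; lookup)
open import Data.Product using (Σ; ∃-syntax; _×_; _,_; proj₁; proj₂; swap)
open import Data.Product.Properties using (≡-dec)
open import Data.Sum as Sum using (_⊎_; inj₁; inj₂; [_,_]′)
open import Data.Empty using (⊥; ⊥-elim)
open import Relation.Nullary using (¬_; Dec; yes; no; does)
open import Relation.Nullary.Decidable using (_⊎-dec_; _×-dec_; _→-dec_; ¬?; dec-true; dec-false; from-yes)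
open import Relation.Binary.PropositionalEquality hiding ([_])
open import Relation.Binary.Definitions using (tri<; tri≈; tri>)
open import Function using (_∘_; case_of_)
open import Function.Bundles using (mk↔ₛ′)

-- Lists, counting and cyclic order

T⇒≡ : ∀ {b} → T b → b ≡ true
T⇒≡ {true} _ = refl

≡⇒T : ∀ {b} → b ≡ true → T b
≡⇒T refl = _

false≢true : false ≢ true
false≢true ()

true⊎false : ∀ b → b ≡ true ⊎ b ≡ false
true⊎false true  = inj₁ refl
true⊎false false = inj₂ refl

does⇒ : ∀ {P : Set} (d : Dec P) → does d ≡ true → P
does⇒ (yes p) _ = p

¬does⇒ : ∀ {P : Set} (d : Dec P) → does d ≡ false → ¬ P
¬does⇒ (no ¬p) _ = ¬p

unique⊆⇒length≤ : {A : Set} {xs ys : List A} → Unique xs → (∀ {x} → x ∈ xs → x ∈ ys) →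
                  length xs ≤ length ys
unique⊆⇒length≤ [] sub = z≤n
unique⊆⇒length≤ {xs = x ∷ xs} (x∉ ∷ u) sub with ∈-∃++ (sub (here refl))
... | ps , qs , refl = begin
    suc (length xs)               ≤⟨ s≤s (unique⊆⇒length≤ u sub′) ⟩
    suc (length (ps ++ qs))       ≡⟨ cong suc (List.length-++ ps) ⟩
    suc (length ps + length qs)   ≡⟨ sym (ℕ.+-suc (length ps) (length qs)) ⟩
    length ps + suc (length qs)   ≡⟨ sym (List.length-++ ps) ⟩
    length (ps ++ x ∷ qs)         ∎
  where
  open ℕ.≤-Reasoning
  sub′ : ∀ {y} → y ∈ xs → y ∈ ps ++ qs
  sub′ y∈ with ∈-++⁻ ps (sub (there y∈))
  ... | inj₁ y∈ps          = ∈-++⁺ˡ y∈ps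
  ... | inj₂ (here refl)   = ⊥-elim (All.lookup x∉ y∈ refl)
  ... | inj₂ (there y∈qs)  = ∈-++⁺ʳ ps y∈qs

select : {A : Set} → (A → Bool) → List A → List A
select f []       = []
select f (x ∷ xs) = if f x then x ∷ select f xs else select f xs

module _ {A : Set} (f : A → Bool) where

  length-select : ∀ xs → length (select f xs) ≡ count f xs
  length-select [] = refl
  length-select (x ∷ xs) with f x
  ... | true  = cong suc (length-select xs)
  ... | false = length-select xs

  ∈-select⁺ : ∀ {x xs} → x ∈ xs → f x ≡ true → x ∈ select f xs
  ∈-select⁺ (here refl) fx rewrite fx = here refl
  ∈-select⁺ {xs = y ∷ _} (there x∈) fx with f y
  ... | true  = there (∈-select⁺ x∈ fx)
  ... | false = ∈-select⁺ x∈ fx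

  ∈-select⁻ : ∀ {x} xs → x ∈ select f xs → x ∈ xs × f x ≡ true
  ∈-select⁻ (y ∷ xs) x∈ with f y in eq
  ∈-select⁻ (y ∷ xs) (here refl) | true = here refl , eq
  ∈-select⁻ (y ∷ xs) (there x∈)  | true = let p , q = ∈-select⁻ xs x∈ in there p , q
  ∈-select⁻ (y ∷ xs) x∈          | false = let p , q = ∈-select⁻ xs x∈ in there p , q

  select-unique : ∀ {xs} → Unique xs → Unique (select f xs)
  select-unique [] = []
  select-unique {x ∷ xs} (x∉ ∷ u) with f x
  ... | true  = All.tabulate (λ y∈ → All.lookup x∉ (proj₁ (∈-select⁻ xs y∈))) ∷ select-unique u
  ... | false = select-unique u

  count≡2⁺ : ∀ {xs} x y → Unique xs → x ∈ xs → y ∈ xs → x ≢ y → f x ≡ true → f y ≡ true →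
             (∀ z → f z ≡ true → z ≡ x ⊎ z ≡ y) → count f xs ≡ 2
  count≡2⁺ {xs} x y u x∈ y∈ x≢y fx fy only = trans (sym (length-select xs))
    (ℕ.≤-antisym (unique⊆⇒length≤ {ys = x ∷ y ∷ []} (select-unique u) sub)
                 (unique⊆⇒length≤ ((x≢y ∷ []) ∷ [] ∷ []) sup))
    where
    sub : ∀ {z} → z ∈ select f xs → z ∈ x ∷ y ∷ []
    sub z∈ with only _ (proj₂ (∈-select⁻ xs z∈))
    ... | inj₁ refl = here refl
    ... | inj₂ refl = there (here refl)
    sup : ∀ {z} → z ∈ x ∷ y ∷ [] → z ∈ select f xs
    sup (here refl)         = ∈-select⁺ x∈ fx
    sup (there (here refl)) = ∈-select⁺ y∈ fy

  count≡2⁻ : ∀ {xs} → Unique xs → count f xs ≡ 2 →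
             ∃[ x ] ∃[ y ] (x ≢ y × (f x ≡ true) × (f y ≡ true) ×
                            (∀ z → z ∈ xs → f z ≡ true → z ≡ x ⊎ z ≡ y))
  count≡2⁻ {xs} u c with select f xs in eq | select-unique u | trans (length-select xs) c
  ... | x ∷ y ∷ [] | (x≢y ∷ []) ∷ _ | refl =
    x , y , x≢y ,
    proj₂ (∈-select⁻ xs (subst (x ∈_) (sym eq) (here refl))) ,
    proj₂ (∈-select⁻ xs (subst (y ∈_) (sym eq) (there (here refl)))) ,
    λ z z∈ fz → case subst (z ∈_) eq (∈-select⁺ z∈ fz) of λ where
      (here z≡x)         → inj₁ z≡x
      (there (here z≡y)) → inj₂ z≡y

orderedPairs≡ : ∀ n → orderedPairs n ≡ cartesianProduct (allFin n) (allFin n)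
orderedPairs≡ n = go (allFin n)
  where
  go : ∀ xs → concatMap (λ i → map (λ j → (i , j)) (allFin n)) xs ≡ cartesianProduct xs (allFin n)
  go []       = refl
  go (x ∷ xs) = cong (map (x ,_) (allFin n) ++_) (go xs)

orderedPairs-unique : ∀ n → Unique (orderedPairs n)
orderedPairs-unique n =
  subst Unique (sym (orderedPairs≡ n)) (Unique.cartesianProduct⁺ (Unique.allFin⁺ n) (Unique.allFin⁺ n))

∈-orderedPairs : ∀ {n} (u v : Fin n) → (u , v) ∈ orderedPairs n
∈-orderedPairs {n} u v =
  subst ((u , v) ∈_) (sym (orderedPairs≡ n)) (∈-cartesianProduct⁺ (∈-allFin u) (∈-allFin v))

length-orderedPairs : ∀ n → length (orderedPairs n) ≡ n * n
length-orderedPairs n = trans (cong length (orderedPairs≡ n))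
  (trans (go (allFin n)) (cong₂ _*_ len len))
  where
  len : length (allFin n) ≡ n
  len = List.length-tabulate {n = n} (λ z → z)
  go : ∀ xs → length (cartesianProduct xs (allFin n)) ≡ length xs * length (allFin n)
  go []       = refl
  go (x ∷ xs) = trans (List.length-++ (map (x ,_) (allFin n)))
                      (cong₂ _+_ (List.length-map (x ,_) (allFin n)) (go xs))

module _ {A : Set} where

  -- `CycNext xs` is contained in `Zip xs (rotate xs)`. In this form a successor is unique because
  -- `xs` has no repetition, and a predecessor because `rotate xs` has none.
  data Zip : List A → List A → A → A → Set where
    here  : ∀ {x y xs ys} → Zip (x ∷ xs) (y ∷ ys) x y
    there : ∀ {x y x′ y′ xs ys} → Zip xs ys x y → Zip (x′ ∷ xs) (y′ ∷ ys) x y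

  Zip-∈ˡ : ∀ {xs ys x y} → Zip xs ys x y → x ∈ xs
  Zip-∈ˡ here      = here refl
  Zip-∈ˡ (there z) = there (Zip-∈ˡ z)

  Zip-∈ʳ : ∀ {xs ys x y} → Zip xs ys x y → y ∈ ys
  Zip-∈ʳ here      = here refl
  Zip-∈ʳ (there z) = there (Zip-∈ʳ z)

  Zip-functional : ∀ {xs ys x y y′} → Unique xs → Zip xs ys x y → Zip xs ys x y′ → y ≡ y′
  Zip-functional u here here = refl
  Zip-functional (x∉ ∷ u) here (there z) = ⊥-elim (All.lookup x∉ (Zip-∈ˡ z) refl)
  Zip-functional (x∉ ∷ u) (there z) here = ⊥-elim (All.lookup x∉ (Zip-∈ˡ z) refl)
  Zip-functional (x∉ ∷ u) (there z) (there z′) = Zip-functional u z z′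

  Zip-injective : ∀ {xs ys x x′ y} → Unique ys → Zip xs ys x y → Zip xs ys x′ y → x ≡ x′
  Zip-injective u here here = refl
  Zip-injective (y∉ ∷ u) here (there z) = ⊥-elim (All.lookup y∉ (Zip-∈ʳ z) refl)
  Zip-injective (y∉ ∷ u) (there z) here = ⊥-elim (All.lookup y∉ (Zip-∈ʳ z) refl)
  Zip-injective (y∉ ∷ u) (there z) (there z′) = Zip-injective u z z′

  tail∷ʳ : List A → A → List A
  tail∷ʳ []       r = r ∷ []
  tail∷ʳ (_ ∷ xs) r = xs ++ r ∷ []

  rotate : List A → List A
  rotate []       = []
  rotate (x ∷ xs) = xs ++ x ∷ []

  private
    -- `rotate` appends the head of the whole list, whereas the head changes along the recursion;
    -- hence the free last entry `r`.
    consecutive⇒Zip : ∀ ys {x y zs} r → Zip (ys ++ x ∷ y ∷ zs) (tail∷ʳ (ys ++ x ∷ y ∷ zs) r) x y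
    consecutive⇒Zip []           r = here
    consecutive⇒Zip (_ ∷ [])     r = there here
    consecutive⇒Zip (_ ∷ f ∷ ys) r = there (consecutive⇒Zip (f ∷ ys) r)

    ends⇒Zip : ∀ e ys {x y} → Zip (e ∷ (ys ++ x ∷ [])) ((ys ++ x ∷ []) ++ y ∷ []) x y
    ends⇒Zip e []       = there here
    ends⇒Zip e (f ∷ ys) = there (ends⇒Zip f ys)

  CycNext⇒Zip : ∀ {xs x y} → CycNext xs x y → Zip xs (rotate xs) x y
  CycNext⇒Zip (inj₁ ([] , zs , refl))     = consecutive⇒Zip [] _
  CycNext⇒Zip (inj₁ (e ∷ ys , zs , refl)) = consecutive⇒Zip (e ∷ ys) e
  CycNext⇒Zip {y = y} (inj₂ (ys , refl))  = ends⇒Zip y ys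

  rotate-unique : ∀ {xs} → Unique xs → Unique (rotate xs)
  rotate-unique [] = []
  rotate-unique (x∉ ∷ u) =
    Unique.++⁺ u ([] ∷ []) λ { (y∈ , here refl) → All.lookup x∉ y∈ refl }

  CycNext-functional : ∀ {xs x y y′} → Unique xs → CycNext xs x y → CycNext xs x y′ → y ≡ y′
  CycNext-functional u c c′ = Zip-functional u (CycNext⇒Zip c) (CycNext⇒Zip c′)

  CycNext-injective : ∀ {xs x x′ y} → Unique xs → CycNext xs x y → CycNext xs x′ y → x ≡ x′
  CycNext-injective u c c′ = Zip-injective (rotate-unique u) (CycNext⇒Zip c) (CycNext⇒Zip c′)

  CycNext-∈ˡ : ∀ {xs x y} → CycNext xs x y → x ∈ xs
  CycNext-∈ˡ c = Zip-∈ˡ (CycNext⇒Zip c)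

  Consecutive : List A → A → A → Set
  Consecutive xs x y = Σ (List A) λ ys → Σ (List A) λ zs → xs ≡ ys ++ (x ∷ y ∷ zs)

  Differ : (A → Bool) → A → A → Set
  Differ Q x y = (Q x ≡ true × Q y ≡ false) ⊎ (Q x ≡ false × Q y ≡ true)

  differ : ∀ Q x y → Q x ≢ Q y → Differ Q x y
  differ Q x y ne with Q x | Q y
  ... | true  | true  = ⊥-elim (ne refl)
  ... | true  | false = inj₁ (refl , refl)
  ... | false | true  = inj₂ (refl , refl)
  ... | false | false = ⊥-elim (ne refl)

  private
    Change : (A → Bool) → List A → Set
    Change Q xs = ∃[ x ] ∃[ y ] (Consecutive xs x y × Differ Q x y)

    change-∷ : ∀ {Q e xs} → Change Q xs → Change Q (e ∷ xs)
    change-∷ {e = e} (x , y , (ys , zs , eq) , d) = x , y , (e ∷ ys , zs , cong (e ∷_) eq) , d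

    change-from-head : ∀ Q e xs {t} → t ∈ xs → Q e ≢ Q t → Change Q (e ∷ xs)
    change-from-head Q e (e′ ∷ xs) {t} t∈ ne with Q e 𝔹.≟ Q e′
    ... | no e≢e′ = e , e′ , ([] , xs , refl) , differ Q e e′ e≢e′
    change-from-head Q e (e′ ∷ xs) (here refl) ne | yes e≡e′ = ⊥-elim (ne e≡e′)
    change-from-head Q e (e′ ∷ xs) (there t∈) ne | yes e≡e′ =
      change-∷ (change-from-head Q e′ xs t∈ (λ eq → ne (trans e≡e′ eq)))

    linear-change : ∀ Q xs {s t} → s ∈ xs → t ∈ xs → Q s ≢ Q t → Change Q xs
    linear-change Q (e ∷ xs) (here refl) (here refl) ne = ⊥-elim (ne refl)
    linear-change Q (e ∷ xs) (here refl) (there t∈) ne = change-from-head Q e xs t∈ ne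
    linear-change Q (e ∷ xs) (there s∈) (here refl) ne = change-from-head Q e xs s∈ (ne ∘ sym)
    linear-change Q (e ∷ xs) (there s∈) (there t∈) ne = change-∷ (linear-change Q xs s∈ t∈ ne)

    split-consecutive : ∀ (ks ls ys : List A) {x y zs} → ks ++ ls ≡ ys ++ x ∷ y ∷ zs →
      Consecutive ks x y ⊎ Consecutive ls x y ⊎
      (∃[ ks′ ] ∃[ ls′ ] (ks ≡ ks′ ++ [ x ] × ls ≡ y ∷ ls′))
    split-consecutive [] ls ys eq = inj₂ (inj₁ (ys , _ , eq))
    split-consecutive (k ∷ []) (l ∷ ls) [] refl = inj₂ (inj₂ ([] , _ , refl , refl))
    split-consecutive (k ∷ k′ ∷ ks) ls [] eq with List.∷-injective eq
    ... | refl , eq′ with List.∷-injective eq′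
    ... | refl , _ = inj₁ ([] , ks , refl)
    split-consecutive (k ∷ ks) ls (_ ∷ ys) eq with List.∷-injective eq
    ... | refl , eq′ with split-consecutive ks ls ys eq′
    ... | inj₁ (ys′ , zs′ , refl) = inj₁ (k ∷ ys′ , zs′ , refl)
    ... | inj₂ (inj₁ c) = inj₂ (inj₁ c)
    ... | inj₂ (inj₂ (ks′ , ls′ , refl , e)) = inj₂ (inj₂ (k ∷ ks′ , ls′ , refl , e))

  -- A cycle with one point removed is a path, hence connected.
  cyclic-change : ∀ (_≟_ : (x y : A) → Dec (x ≡ y)) (Q : A → Bool) {xs} y {s t} → Unique xs →
    s ∈ xs → t ∈ xs → s ≢ y → t ≢ y → Q s ≢ Q t →
    ∃[ u ] ∃[ v ] (CycNext xs u v × Differ Q u v × u ≢ y × v ≢ y)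
  cyclic-change _≟_ Q {xs} y u s∈ t∈ s≢y t≢y ne with Any.any? (y ≟_) xs
  ... | no y∉ with linear-change Q xs s∈ t∈ ne
  ...   | a , b , c@(ys , zs , refl) , d =
    a , b , inj₁ c , d ,
    (λ { refl → y∉ (∈-++⁺ʳ ys (here refl)) }) , (λ { refl → y∉ (∈-++⁺ʳ ys (there (here refl))) })
  cyclic-change _≟_ Q {xs} y u s∈ t∈ s≢y t≢y ne | yes y∈ with ∈-∃++ y∈
  -- Cutting the cycle open at `y` leaves the path `ks ++ ls`. Its only consecutive pair that is not
  -- consecutive in the list joins the end of `ks` to the start of `ls`, and this is the wrap-around
  -- case of `CycNext`.
  ... | ls , ks , refl with linear-change Q (ks ++ ls) (move s∈ s≢y) (move t∈ t≢y) ne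
    where
    move : ∀ {z} → z ∈ ls ++ y ∷ ks → z ≢ y → z ∈ ks ++ ls
    move z∈ z≢y with ∈-++⁻ ls z∈
    ... | inj₁ z∈ls          = ∈-++⁺ʳ ks z∈ls
    ... | inj₂ (here z≡y)    = ⊥-elim (z≢y z≡y)
    ... | inj₂ (there z∈ks)  = ∈-++⁺ˡ z∈ks
  ... | a , b , (ys , zs , eq) , d = a , b , cyc (split-consecutive ks ls ys eq) , d ,
      (λ { refl → y∉ (subst (a ∈_) (sym eq) (∈-++⁺ʳ ys (here refl))) }) ,
      (λ { refl → y∉ (subst (b ∈_) (sym eq) (∈-++⁺ʳ ys (there (here refl)))) })
    where
    y∉ : y ∉ ks ++ ls
    y∉ y∈′ with ∈-++⁻ ks y∈′
    ... | inj₁ y∈ks = y∉ks ls u y∈ks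
      where
      y∉ks : ∀ ls → Unique (ls ++ y ∷ ks) → y ∉ ks
      y∉ks []       (y∉ ∷ _) z∈ = All.lookup y∉ z∈ refl
      y∉ks (_ ∷ ls) (_ ∷ u)     = y∉ks ls u
    ... | inj₂ y∈ls = y∉ls ls u y∈ls
      where
      y∉ls : ∀ ls → Unique (ls ++ y ∷ ks) → y ∉ ls
      y∉ls (_ ∷ ls) (y∉ ∷ _) (here refl) = All.lookup y∉ (∈-++⁺ʳ ls (here refl)) refl
      y∉ls (_ ∷ ls) (_ ∷ u)  (there z∈)  = y∉ls ls u z∈
    cyc : Consecutive ks a b ⊎ Consecutive ls a b ⊎
          (∃[ ks′ ] ∃[ ls′ ] (ks ≡ ks′ ++ [ a ] × ls ≡ b ∷ ls′)) → CycNext (ls ++ y ∷ ks) a b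
    cyc (inj₁ (ys , zs , refl)) = inj₁ (ls ++ y ∷ ys , zs , sym (List.++-assoc ls (y ∷ ys) _))
    cyc (inj₂ (inj₁ (ys , zs , refl))) = inj₁ (ys , zs ++ y ∷ ks , List.++-assoc ys (a ∷ b ∷ zs) _)
    cyc (inj₂ (inj₂ (ks′ , ls′ , refl , refl))) =
      inj₂ (ls′ ++ y ∷ ks′ , cong (b ∷_) (sym (List.++-assoc ls′ (y ∷ ks′) _)))

-- Linear algebra over 𝔽₂

xor-interchange : ∀ a b c d → (a xor b) xor (c xor d) ≡ (a xor c) xor (b xor d)
xor-interchange a b c d = trans (𝔹.xor-assoc a b (c xor d)) (trans (cong (a xor_) middle) (sym (𝔹.xor-assoc a c (b xor d))))
  where
  middle : b xor (c xor d) ≡ c xor (b xor d)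
  middle = trans (sym (𝔹.xor-assoc b c d)) (trans (cong (_xor d) (𝔹.xor-comm b c)) (𝔹.xor-assoc c b d))

xor≡false⇒≡ : ∀ a b → a xor b ≡ false → a ≡ b
xor≡false⇒≡ false b eq = sym eq
xor≡false⇒≡ true true eq = refl

Vector : ℕ → Set
Vector N = Fin N → Bool

-- `respects` stands in for function extensionality. Over 𝔽₂ additivity already contains
-- compatibility with scalars.
record Linear {N} (L : Vector N → Bool) : Set where
  field
    respects : ∀ {f g} → (∀ i → f i ≡ g i) → L f ≡ L g
    additive : ∀ f g → L (λ i → f i xor g i) ≡ L f xor L g

  preserves-0 : L (λ _ → false) ≡ false
  preserves-0 = trans (additive (λ _ → false) (λ _ → false)) (𝔹.xor-same (L (λ _ → false)))

open Linear

coordinate-linear : ∀ {N} (i : Fin N) → Linear (λ x → x i)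
coordinate-linear i = record { respects = λ eq → eq i ; additive = λ _ _ → refl }

xor-linear : ∀ {N} {L M : Vector N → Bool} → Linear L → Linear M → Linear (λ x → L x xor M x)
xor-linear {L = L} {M} l m = record
  { respects = λ eq → cong₂ _xor_ (respects l eq) (respects m eq)
  ; additive = λ f g → trans (cong₂ _xor_ (additive l f g) (additive m f g))
                             (xor-interchange (L f) (L g) (M f) (M g)) }

∧-linear : ∀ {N} {L : Vector N → Bool} c → Linear L → Linear (λ x → L x ∧ c)
∧-linear {L = L} c l = record
  { respects = λ eq → cong (_∧ c) (respects l eq)
  ; additive = λ f g → trans (cong (_∧ c) (additive l f g)) (𝔹.∧-distribʳ-xor c (L f) (L g)) }

infixr 5 _◂_
_◂_ : ∀ {N} → Bool → Vector N → Vector (suc N)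
(b ◂ f) zero    = b
(b ◂ f) (suc i) = f i

module Elimination {N} {L₀ : Vector (suc N) → Bool} (lin : Linear L₀)
                   (pivot : L₀ (true ◂ (λ _ → false)) ≡ true) where

  -- Since the first basis vector has value 1 under `L₀`, the kernel of `L₀` is the graph of a
  -- linear map: the first coordinate has to be the value of `L₀` on the remaining ones.
  embed : Vector N → Vector (suc N)
  embed f = L₀ (false ◂ f) ◂ f

  private
    embed-additive : ∀ f g i → embed (λ i → f i xor g i) i ≡ embed f i xor embed g i
    embed-additive f g zero = trans (respects lin λ { zero → refl ; (suc i) → refl })
                                    (additive lin (false ◂ f) (false ◂ g))
    embed-additive f g (suc i) = refl

    embed-respects : ∀ {f g} → (∀ i → f i ≡ g i) → ∀ i → embed f i ≡ embed g i
    embed-respects eq zero    = respects lin λ { zero → refl ; (suc i) → eq i }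
    embed-respects eq (suc i) = eq i

    pivot-multiple : ∀ b → L₀ (b ◂ (λ _ → false)) ≡ b
    pivot-multiple true  = pivot
    pivot-multiple false = trans (respects lin λ { zero → refl ; (suc i) → refl }) (preserves-0 lin)

  L₀-embed : ∀ f → L₀ (embed f) ≡ false
  L₀-embed f = begin
    L₀ (embed f)
      ≡⟨ respects lin (λ { zero → refl ; (suc i) → sym (𝔹.xor-identityʳ (f i)) }) ⟩
    L₀ (λ i → (false ◂ f) i xor (b ◂ (λ _ → false)) i)
      ≡⟨ additive lin _ _ ⟩
    b xor L₀ (b ◂ (λ _ → false))
      ≡⟨ cong (b xor_) (pivot-multiple b) ⟩
    b xor b
      ≡⟨ 𝔹.xor-same b ⟩
    false ∎
    where
    open ≡-Reasoning
    b = L₀ (false ◂ f)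

  embed-linear : ∀ {L} → Linear L → Linear (L ∘ embed)
  embed-linear l = record
    { respects = λ eq → respects l (embed-respects eq)
    ; additive = λ f g → trans (respects l (embed-additive f g)) (additive l (embed f) (embed g)) }

private
  Form : ℕ → Set
  Form N = Vector N → Bool

  find-pivot : ∀ {N} (e : Vector N) (Ls : List (Form N)) → All Linear Ls →
    All (λ L → L e ≡ false) Ls ⊎
    (∃[ L ] ∃[ Ms ] (L e ≡ true × Linear L × All Linear Ms × length Ls ≡ suc (length Ms) ×
       (∀ x → L x ≡ false → All (λ L → L x ≡ false) Ms → All (λ L → L x ≡ false) Ls)))
  find-pivot e [] [] = inj₁ []
  find-pivot e (L ∷ Ls) (l ∷ ls) with L e in eq
  ... | true = inj₂ (L , Ls , eq , l , ls , refl , λ x → _∷_)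
  ... | false with find-pivot e Ls ls
  ...   | inj₁ zs = inj₁ (eq ∷ zs)
  ...   | inj₂ (M , Ms , Me , m , ms , len , back) =
    inj₂ (M , L ∷ Ms , Me , m , l ∷ ms , cong suc len , λ { x Mx (Lx ∷ Msx) → Lx ∷ back x Mx Msx })

-- Gaussian elimination: solve the pivot form for the first coordinate and substitute in the others.
nonzero-solution : ∀ {N} (Ls : List (Vector N → Bool)) → All Linear Ls → length Ls < N →
  ∃[ x ] ((∃[ i ] x i ≡ true) × All (λ L → L x ≡ false) Ls)
nonzero-solution {suc N} Ls ls (s≤s M≤N) with find-pivot (true ◂ (λ _ → false)) Ls ls
... | inj₁ zs = (true ◂ (λ _ → false)) , (zero , refl) , zs
... | inj₂ (L , Ms , Le , l , ms , len , back) =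
  let module E = Elimination l Le
      x , (i , xi) , sol = nonzero-solution (map (_∘ E.embed) Ms)
        (All.map⁺ (All.map E.embed-linear ms))
        (subst (_≤ N) (trans len (cong suc (sym (List.length-map _ Ms)))) M≤N)
  in E.embed x , (suc i , xi) , back (E.embed x) (E.L₀-embed x) (All.map⁻ sol)

module _ {A : Set} where

  ⊕ : (A → Bool) → List A → Bool
  ⊕ f xs = foldr (λ x s → f x xor s) false xs

  ⊕-xor : ∀ f g xs → ⊕ (λ x → f x xor g x) xs ≡ ⊕ f xs xor ⊕ g xs
  ⊕-xor f g []       = refl
  ⊕-xor f g (x ∷ xs) = trans (cong ((f x xor g x) xor_) (⊕-xor f g xs))
                             (xor-interchange (f x) (g x) (⊕ f xs) (⊕ g xs))

  ⊕-false : ∀ {f : A → Bool} xs → (∀ x → x ∈ xs → f x ≡ false) → ⊕ f xs ≡ false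
  ⊕-false []       eq = refl
  ⊕-false (x ∷ xs) eq = cong₂ _xor_ (eq x (here refl)) (⊕-false xs (λ y y∈ → eq y (there y∈)))

  ⊕-single : ∀ {f : A → Bool} {xs y} → Unique xs → y ∈ xs → (∀ x → x ∈ xs → x ≢ y → f x ≡ false) →
             ⊕ f xs ≡ f y
  ⊕-single {f} {x ∷ xs} (x∉ ∷ u) (here refl) eq =
    trans (cong (f x xor_) (⊕-false xs λ y y∈ → eq y (there y∈) λ { refl → All.lookup x∉ y∈ refl }))
          (𝔹.xor-identityʳ (f x))
  ⊕-single {f} {x ∷ xs} (x∉ ∷ u) (there y∈) eq =
    cong₂ _xor_ (eq x (here refl) λ { refl → All.lookup x∉ y∈ refl })
                (⊕-single u y∈ (λ z z∈ → eq z (there z∈)))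

  -- Reindexing by the cyclic successor. The hypothesis `next` excludes a list with one entry, on
  -- which `CycNext` is empty.
  ⊕-cyclic : ∀ (f g : A → Bool) xs → (∀ x → x ∈ xs → ∃[ y ] CycNext xs x y) →
             (∀ x y → CycNext xs x y → f x ≡ g y) → ⊕ f xs ≡ ⊕ g xs
  ⊕-cyclic f g [] next succ = refl
  ⊕-cyclic f g (h ∷ []) next succ with next h (here refl)
  ... | y , inj₁ ([] , zs , ())
  ... | y , inj₁ (_ ∷ [] , zs , ())
  ... | y , inj₁ (_ ∷ _ ∷ ys , zs , ())
  ... | y , inj₂ ([] , ())
  ... | y , inj₂ (_ ∷ ys , ())
  ⊕-cyclic f g (h ∷ k ∷ xs) next succ =
    trans (go h [] k xs refl) (𝔹.xor-comm (⊕ g (k ∷ xs)) (g h))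
    where
    go : ∀ e ys k′ zs → h ∷ k ∷ xs ≡ ys ++ e ∷ k′ ∷ zs →
         ⊕ f (e ∷ k′ ∷ zs) ≡ ⊕ g (k′ ∷ zs) xor g h
    go e ys k′ [] eq = begin
      f e xor (f k′ xor false) ≡⟨ cong₂ (λ a b → a xor (b xor false)) (succ e k′ (inj₁ (ys , [] , eq))) (succ k′ h (last ys eq)) ⟩
      g k′ xor (g h xor false) ≡⟨ cong (g k′ xor_) (𝔹.xor-comm (g h) false) ⟩
      g k′ xor (false xor g h) ≡⟨ sym (𝔹.xor-assoc (g k′) false (g h)) ⟩
      (g k′ xor false) xor g h ∎
      where
      open ≡-Reasoning
      last : ∀ ys → h ∷ k ∷ xs ≡ ys ++ e ∷ k′ ∷ [] → CycNext (h ∷ k ∷ xs) k′ h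
      last [] refl = inj₂ ([] , refl)
      last (y ∷ ys) eq with List.∷-injective eq
      ... | refl , eq′ = inj₂ (ys ++ e ∷ [] , cong (h ∷_) (trans eq′ (sym (List.++-assoc ys (e ∷ []) (k′ ∷ [])))))
    go e ys k′ (z ∷ zs) eq = trans
      (cong₂ _xor_ (succ e k′ (inj₁ (ys , z ∷ zs , eq)))
                   (go k′ (ys ++ e ∷ []) z zs (trans eq (sym (List.++-assoc ys (e ∷ []) _)))))
      (sym (𝔹.xor-assoc (g k′) (⊕ g (z ∷ zs)) (g h)))

-- Faces of a rotation system

module Surface {n} (a : Adj n) (simple : IsSimple a) (connected : Connected a)
               (R : RotationSystem a) (triangular : AllFacesTriangles R) where

  open RotationSystem R public

  infix 4 _~_
  _~_ : Fin n → Fin n → Set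
  u ~ v = a u v ≡ true

  ~-sym : ∀ {u v} → u ~ v → v ~ u
  ~-sym {u} {v} u~v = trans (sym (proj₁ simple u v)) u~v

  ~⇒≢ : ∀ {u v} → u ~ v → u ≢ v
  ~⇒≢ {u} u~v refl = false≢true (trans (sym (proj₂ simple u)) u~v)

  ∈rot⇒~ : ∀ {u v} → v ∈ rot u → u ~ v
  ∈rot⇒~ v∈ = T⇒≡ (rot-sound _ _ v∈)

  ~⇒∈rot : ∀ {u v} → u ~ v → v ∈ rot u
  ~⇒∈rot u~v = rot-compl _ _ (≡⇒T u~v)

  Face : Fin n → Fin n → Fin n → Set
  Face u v w = CycNext (rot v) u w × CycNext (rot w) v u × CycNext (rot u) w v

  Face-rotate : ∀ {u v w} → Face u v w → Face v w u
  Face-rotate (c , d , e) = d , e , c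

  Face-exists : ∀ {u v} → u ~ v → ∃[ w ] Face u v w
  Face-exists u~v = triangular _ _ (≡⇒T u~v)

  Face-functional : ∀ {u v w w′} → Face u v w → Face u v w′ → w ≡ w′
  Face-functional (c , _) (c′ , _) = CycNext-functional (rot-unique _) c c′

  Face-~ : ∀ {u v w} → Face u v w → u ~ v
  Face-~ (c , _) = ~-sym (∈rot⇒~ (CycNext-∈ˡ c))

  CycNext⇒Face : ∀ {u v w} → CycNext (rot v) u w → Face u v w
  CycNext⇒Face {u} {v} c with Face-exists (~-sym (∈rot⇒~ (CycNext-∈ˡ c)))
  ... | w′ , f with CycNext-functional (rot-unique v) (proj₁ f) c
  ... | refl = f

  Facial : Fin n → Fin n → Fin n → Set
  Facial u v w = Face u v w ⊎ Face v u w

  Facial-swap : ∀ {u v w} → Facial u v w → Facial v u w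
  Facial-swap = Sum.swap

  Facial-rotate : ∀ {u v w} → Facial u v w → Facial v w u
  Facial-rotate (inj₁ f) = inj₁ (Face-rotate f)
  Facial-rotate (inj₂ f) = inj₂ (Face-rotate (Face-rotate f))

  Facial-~ : ∀ {u v w} → Facial u v w → u ~ v
  Facial-~ (inj₁ f) = Face-~ f
  Facial-~ (inj₂ f) = ~-sym (Face-~ f)

  reach-closed : (Q : Fin n → Set) → (∀ {u v} → Q u → u ~ v → Q v) → ∀ {u v} → Reach a u v → Q u → Q v
  reach-closed Q closed here       q = q
  reach-closed Q closed (step e r) q = reach-closed Q closed r (closed q (T⇒≡ e))

  -- The neighbours of `x` form a cycle, which stays connected when `y` is removed, so `Q` changes
  -- between two consecutive ones. Choosing `y = x` removes nothing, since `x` is not its own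
  -- neighbour.
  link-connected : ∀ x (Q : Fin n → Bool) y {s t} → x ~ s → x ~ t → s ≢ y → t ≢ y →
    Q s ≡ true → Q t ≡ false →
    ∃[ u ] ∃[ v ] (Facial x u v × Q u ≡ true × Q v ≡ false × u ≢ y × v ≢ y)
  link-connected x Q y x~s x~t s≢y t≢y Qs Qt
    with cyclic-change _≟_ Q y (rot-unique x) (~⇒∈rot x~s) (~⇒∈rot x~t) s≢y t≢y
                       (λ eq → false≢true (trans (sym Qt) (trans (sym eq) Qs)))
  ... | u , v , c , inj₁ (Qu , Qv) , u≢y , v≢y = u , v , inj₂ (CycNext⇒Face c) , Qu , Qv , u≢y , v≢y
  ... | u , v , c , inj₂ (Qu , Qv) , u≢y , v≢y =
    v , u , inj₁ (Face-rotate (CycNext⇒Face c)) , Qv , Qu , v≢y , u≢y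

  private
    -- A cyclic order in which `u` and `w` succeed each other has no room for a third entry.
    pair-closed : ∀ {v u w} → CycNext (rot v) u w → CycNext (rot v) w u → ∀ {g} → v ~ g → g ≡ u ⊎ g ≡ w
    pair-closed {v} {u} {w} c d {g} v~g with g ≟ u ⊎-dec g ≟ w
    ... | yes p = p
    ... | no ¬p = ⊥-elim (absurd change)
      where
      Q? : ∀ x → Dec (x ≡ u ⊎ x ≡ w)
      Q? x = x ≟ u ⊎-dec x ≟ w
      Q : Fin n → Bool
      Q x = does (Q? x)
      change : ∃[ x ] ∃[ y ] (CycNext (rot v) x y × Differ Q x y × x ≢ v × y ≢ v)
      change = cyclic-change _≟_ Q v (rot-unique v) (CycNext-∈ˡ c) (~⇒∈rot v~g)
        (≢-sym (~⇒≢ (∈rot⇒~ (CycNext-∈ˡ c)))) (≢-sym (~⇒≢ v~g))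
        (λ eq → ¬p (does⇒ (Q? g) (trans (sym eq) (dec-true (Q? u) (inj₁ refl)))))
      absurd : ∃[ x ] ∃[ y ] (CycNext (rot v) x y × Differ Q x y × x ≢ v × y ≢ v) → ⊥
      absurd (x , y , e , inj₁ (p , q) , _) with does⇒ (Q? x) p
      ... | inj₁ refl = ¬does⇒ (Q? y) q (inj₂ (CycNext-functional (rot-unique v) e c))
      ... | inj₂ refl = ¬does⇒ (Q? y) q (inj₁ (CycNext-functional (rot-unique v) e d))
      absurd (x , y , e , inj₂ (p , q) , _) with does⇒ (Q? y) q
      ... | inj₁ refl = ¬does⇒ (Q? x) p (inj₂ (CycNext-injective (rot-unique v) e d))
      ... | inj₂ refl = ¬does⇒ (Q? x) p (inj₁ (CycNext-injective (rot-unique v) e c))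

  module _ {p q} (p≢q : p ≢ q) (p≁q : a p q ≡ false) where

    -- If both orientations of a triangle were faces, each of its vertices would have only the other
    -- two as neighbours. By connectedness the graph would be this triangle, which has no
    -- non-adjacent pair `p q`.
    Face-antisym : ∀ {u v w} → Face u v w → Face v u w → ⊥
    Face-antisym {u} {v} {w} f@(c , d , e) f′@(c′ , d′ , e′) = contra (inT p) (inT q)
      where
      InT : Fin n → Set
      InT g = g ≡ u ⊎ g ≡ v ⊎ g ≡ w
      closed : ∀ {g h} → InT g → g ~ h → InT h
      closed (inj₁ refl) r = [ inj₂ ∘ inj₁ , inj₂ ∘ inj₂ ]′ (pair-closed c′ e r)
      closed (inj₂ (inj₁ refl)) r = [ inj₁ , inj₂ ∘ inj₂ ]′ (pair-closed c e′ r)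
      closed (inj₂ (inj₂ refl)) r = [ inj₂ ∘ inj₁ , inj₁ ]′ (pair-closed d d′ r)
      inT : ∀ g → InT g
      inT g = reach-closed InT closed (connected u g) (inj₁ refl)
      uv : u ~ v
      uv = Face-~ f
      vw : v ~ w
      vw = Face-~ (Face-rotate f)
      wu : w ~ u
      wu = Face-~ (Face-rotate (Face-rotate f))
      non : ∀ {g h} → p ≡ g → q ≡ h → g ~ h → ⊥
      non refl refl r = false≢true (trans (sym p≁q) r)
      contra : InT p → InT q → ⊥
      contra (inj₁ e) (inj₁ e′) = p≢q (trans e (sym e′))
      contra (inj₁ e) (inj₂ (inj₁ e′)) = non e e′ uv
      contra (inj₁ e) (inj₂ (inj₂ e′)) = non e e′ (~-sym wu)
      contra (inj₂ (inj₁ e)) (inj₁ e′) = non e e′ (~-sym uv)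
      contra (inj₂ (inj₁ e)) (inj₂ (inj₁ e′)) = p≢q (trans e (sym e′))
      contra (inj₂ (inj₁ e)) (inj₂ (inj₂ e′)) = non e e′ vw
      contra (inj₂ (inj₂ e)) (inj₁ e′) = non e e′ wu
      contra (inj₂ (inj₂ e)) (inj₂ (inj₁ e′)) = non e e′ (~-sym vw)
      contra (inj₂ (inj₂ e)) (inj₂ (inj₂ e′)) = p≢q (trans e (sym e′))

    apexes : ∀ {u v} → u ~ v → ∃[ w ] ∃[ w′ ]
      (w ≢ w′ × Facial u v w × Facial u v w′ × (∀ {g} → Facial u v g → g ≡ w ⊎ g ≡ w′))
    apexes {u} {v} u~v with Face-exists u~v | Face-exists (~-sym u~v)
    ... | w , f | w′ , f′ = w , w′ , (λ { refl → Face-antisym f f′ }) , inj₁ f , inj₂ f′ , λ where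
      (inj₁ h) → inj₁ (Face-functional h f)
      (inj₂ h) → inj₂ (Face-functional h f′)

-- Spanning trees

∧-true : ∀ {a b} → a ≡ true → b ≡ true → a ∧ b ≡ true
∧-true refl refl = refl

∧-true⁻ : ∀ a {b} → a ∧ b ≡ true → a ≡ true × b ≡ true
∧-true⁻ true refl = refl , refl

∨-true⁻ : ∀ a {b} → a ∨ b ≡ true → a ≡ true ⊎ b ≡ true
∨-true⁻ true  _ = inj₁ refl
∨-true⁻ false p = inj₂ p

not-true⁻ : ∀ b → not b ≡ true → b ≡ false
not-true⁻ false _ = refl

<⇒<ᵇ≡true : ∀ {m n} → m < n → (m <ᵇ n) ≡ true
<⇒<ᵇ≡true p = T⇒≡ (ℕ.<⇒<ᵇ p)

<ᵇ≡true⇒< : ∀ {m n} → (m <ᵇ n) ≡ true → m < n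
<ᵇ≡true⇒< {m} {n} p = ℕ.<ᵇ⇒< m n (≡⇒T p)

least : ∀ (f : ℕ → Bool) k → f k ≡ true → ∃[ j ] (f j ≡ true × (∀ i → i < j → f i ≡ false))
least f k fk with f 0 in f0
... | true = 0 , f0 , λ _ ()
least f zero fk | false = ⊥-elim (false≢true (trans (sym f0) fk))
least f (suc k) fk | false with least (f ∘ suc) k fk
... | j , fj , below = suc j , fj , λ { zero _ → f0 ; (suc i) (s≤s i<j) → below i i<j }

bounded : ∀ {n} (f : Fin n → ℕ) → ∃[ D ] (∀ v → f v ≤ D)
bounded {zero}  f = 0 , λ ()
bounded {suc n} f with bounded (f ∘ suc)
... | D , le = f zero + D , λ where
  zero    → ℕ.m≤m+n (f zero) D
  (suc v) → ℕ.≤-trans (le v) (ℕ.m≤n+m D (f zero))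

module _ {n : ℕ} where

  sorted : Fin n → Fin n → Fin n × Fin n
  sorted u v = if toℕ u <ᵇ toℕ v then (u , v) else (v , u)

  sorted-cases : ∀ u v → u ≢ v → (toℕ u < toℕ v × sorted u v ≡ (u , v)) ⊎ (toℕ v < toℕ u × sorted u v ≡ (v , u))
  sorted-cases u v u≢v with toℕ u <ᵇ toℕ v in eq
  ... | true  = inj₁ (<ᵇ≡true⇒< eq , refl)
  ... | false = inj₂ (ℕ.≤∧≢⇒< (ℕ.≮⇒≥ λ lt → false≢true (trans (sym eq) (<⇒<ᵇ≡true lt)))
                              (λ e → u≢v (sym (toℕ-injective e))) , refl)

  sorted-injective : ∀ {u v u′ v′} → sorted u v ≡ sorted u′ v′ →
                     (u ≡ u′ × v ≡ v′) ⊎ (u ≡ v′ × v ≡ u′)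
  sorted-injective {u} {v} {u′} {v′} eq with toℕ u <ᵇ toℕ v | toℕ u′ <ᵇ toℕ v′
  sorted-injective refl | true  | true  = inj₁ (refl , refl)
  sorted-injective refl | true  | false = inj₂ (refl , refl)
  sorted-injective refl | false | true  = inj₂ (refl , refl)
  sorted-injective refl | false | false = inj₁ (refl , refl)

  isEdge : Adj n → Fin n × Fin n → Bool
  isEdge a p = (toℕ (proj₁ p) <ᵇ toℕ (proj₂ p)) ∧ a (proj₁ p) (proj₂ p)

-- Abstract, since over Fin (suc m) the list would unfold whenever a goal is normalised.
module Pairs (n : ℕ) where

  abstract
    pairs : List (Fin n × Fin n)
    pairs = orderedPairs n

    ∈-pairs : ∀ u v → (u , v) ∈ pairs
    ∈-pairs = ∈-orderedPairs

    pairs-unique : Unique pairs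
    pairs-unique = orderedPairs-unique n

    length-pairs : length pairs ≡ n * n
    length-pairs = length-orderedPairs n

    numEdges≡ : (a : Adj n) → numEdges a ≡ count (isEdge a) pairs
    numEdges≡ a = refl

module SpanningTree {m} (a : Adj (suc m)) (simple : IsSimple a) (connected : Connected a) where

  open Pairs (suc m)

  private
    V = Fin (suc m)

  near : ℕ → V → Bool
  near zero    v = does (v ≟ zero)
  near (suc k) v = near k v ∨ does (any? λ u → (a v u 𝔹.≟ true) ×-dec (near k u 𝔹.≟ true))

  private
    reach⇒near : ∀ {v w} → Reach a v w → w ≡ zero → ∃[ k ] near k v ≡ true
    reach⇒near here refl = 0 , refl
    reach⇒near (step {v = u} e r) w≡0 with reach⇒near r w≡0
    ... | k , nu = suc k , trans (cong (near k _ ∨_)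
                                       (dec-true (any? λ u → (a _ u 𝔹.≟ true) ×-dec (near k u 𝔹.≟ true))
                                                 (u , T⇒≡ e , nu)))
                                 (𝔹.∨-zeroʳ _)

    level : ∀ v → ∃[ j ] (near j v ≡ true × (∀ i → i < j → near i v ≡ false))
    level v = let k , nk = reach⇒near (connected v zero) refl in least (λ k → near k v) k nk

  depth : V → ℕ
  depth v = proj₁ (level v)

  private
    near⇒depth≤ : ∀ k v → near k v ≡ true → depth v ≤ k
    near⇒depth≤ k v nk = ℕ.≮⇒≥ λ lt → false≢true (trans (sym (proj₂ (proj₂ (level v)) k lt)) nk)

    -- A vertex first reached at stage `suc k` has a neighbour reached at stage `k`. The root is
    -- `zero`, so the other vertices are the `suc i`, and the tree has one edge for each
    -- `i : Fin m`.
    parent-of : ∀ i → ∃[ u ] (a (suc i) u ≡ true × depth u < depth (suc i))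
    parent-of i with level (suc i)
    ... | suc k , nk , below with ∨-true⁻ (near k (suc i)) nk
    ...   | inj₁ nk′ = ⊥-elim (false≢true (trans (sym (below k ℕ.≤-refl)) nk′))
    ...   | inj₂ some with does⇒ (any? λ u → (a (suc i) u 𝔹.≟ true) ×-dec (near k u 𝔹.≟ true)) some
    ...     | u , adj , nu = u , adj , s≤s (near⇒depth≤ k u nu)

  parent : Fin m → V
  parent i = proj₁ (parent-of i)

  parent-adjacent : ∀ i → a (suc i) (parent i) ≡ true
  parent-adjacent i = proj₁ (proj₂ (parent-of i))

  parent-depth : ∀ i → depth (parent i) < depth (suc i)
  parent-depth i = proj₂ (proj₂ (parent-of i))

  parent-≢ : ∀ i → suc i ≢ parent i
  parent-≢ i eq = ℕ.<-irrefl (cong depth (sym eq)) (parent-depth i)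

  Tree : V → V → Set
  Tree u v = ∃[ i ] ((u ≡ suc i × v ≡ parent i) ⊎ (v ≡ suc i × u ≡ parent i))

  Tree? : ∀ u v → Dec (Tree u v)
  Tree? u v = any? λ i → (u ≟ suc i ×-dec v ≟ parent i) ⊎-dec (v ≟ suc i ×-dec u ≟ parent i)

  isChord : V × V → Bool
  isChord (u , v) = isEdge a (u , v) ∧ not (does (Tree? u v))

  chords : List (V × V)
  chords = select isChord pairs

  private
    treeEdge : Fin m → V × V
    treeEdge i = sorted (suc i) (parent i)

    treeEdge-injective : ∀ {i j} → treeEdge i ≡ treeEdge j → i ≡ j
    treeEdge-injective {i} {j} eq with sorted-injective {u = suc i} {parent i} {suc j} {parent j} eq
    ... | inj₁ (e , _)  = suc-injective e
    -- Each of the two vertices would be the parent of the other, hence less deep than the other.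
    ... | inj₂ (e , e′) = ⊥-elim (ℕ.<-asym (subst (_< depth (suc i)) (cong depth e′) (parent-depth i))
                                           (subst (_< depth (suc j)) (cong depth (sym e)) (parent-depth j)))

    treeEdge-spec : ∀ i → isEdge a (treeEdge i) ≡ true × Tree (proj₁ (treeEdge i)) (proj₂ (treeEdge i))
    treeEdge-spec i with sorted-cases (suc i) (parent i) (parent-≢ i)
    ... | inj₁ (lt , eq) rewrite eq = ∧-true (<⇒<ᵇ≡true lt) (parent-adjacent i) , i , inj₁ (refl , refl)
    ... | inj₂ (lt , eq) rewrite eq =
      ∧-true (<⇒<ᵇ≡true lt) (trans (proj₁ simple _ _) (parent-adjacent i)) , i , inj₂ (refl , refl)

  -- The edges to the parents are pairwise distinct, and none of them is a chord.
  chords+tree≤edges : length chords + m ≤ numEdges a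
  chords+tree≤edges = begin
    length chords + m                                  ≡⟨ cong (length chords +_) (sym len) ⟩
    length chords + length (map treeEdge (allFin m))   ≡⟨ sym (List.length-++ chords) ⟩
    length (chords ++ map treeEdge (allFin m))         ≤⟨ unique⊆⇒length≤ uniq sub ⟩
    length (select (isEdge a) pairs)                   ≡⟨ length-select (isEdge a) pairs ⟩
    count (isEdge a) pairs                             ≡⟨ sym (numEdges≡ a) ⟩
    numEdges a                                         ∎
    where
    open ℕ.≤-Reasoning
    len : length (map treeEdge (allFin m)) ≡ m
    len = trans (List.length-map treeEdge (allFin m)) (List.length-tabulate {n = m} (λ z → z))
    chord-spec : ∀ {e} → e ∈ chords → isEdge a e ≡ true × ¬ Tree (proj₁ e) (proj₂ e)
    chord-spec {u , v} e∈ with ∧-true⁻ (isEdge a (u , v)) (proj₂ (∈-select⁻ isChord pairs e∈))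
    ... | edge , nt = edge , ¬does⇒ (Tree? u v) (not-true⁻ _ nt)
    uniq : Unique (chords ++ map treeEdge (allFin m))
    uniq = Unique.++⁺ (select-unique isChord pairs-unique)
                      (Unique.map⁺ treeEdge-injective (Unique.allFin⁺ m))
                      λ { (e∈ , e∈′) → case ∈-map⁻ treeEdge e∈′ of λ { (i , _ , refl) →
                          proj₂ (chord-spec e∈) (proj₂ (treeEdge-spec i)) } }
    sub : ∀ {e} → e ∈ chords ++ map treeEdge (allFin m) → e ∈ select (isEdge a) pairs
    sub {e} e∈ = ∈-select⁺ (isEdge a) (∈-pairs (proj₁ e) (proj₂ e)) (edge (∈-++⁻ chords e∈))
      where
      edge : e ∈ chords ⊎ e ∈ map treeEdge (allFin m) → isEdge a e ≡ true
      edge (inj₁ e∈) = proj₁ (chord-spec e∈)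
      edge (inj₂ e∈) with ∈-map⁻ treeEdge e∈
      ... | i , _ , refl = proj₁ (treeEdge-spec i)

-- Separating 3-cycles from homology

module SphereHomology {m} (a : Adj (suc m)) (simple : IsSimple a) (connected : Connected a)
         (R : RotationSystem a) (triangular : AllFacesTriangles R)
         (E : ℕ) (numEdges≡E : numEdges a ≡ E) (euler : suc m + (2 * E) / 3 ≡ E + 2) where

  open Surface a simple connected R triangular
  open SpanningTree a simple connected
  open Pairs (suc m)

  private
    n : ℕ
    n = suc m
    V : Set
    V = Fin n

  abstract
    next : V → V → V
    next u v with a u v 𝔹.≟ true
    ... | yes u~v = proj₁ (Face-exists u~v)
    -- Default off the edges; `isLeadingDart` and `dartForms` test adjacency before they consult
    -- `next`.
    ... | no _    = u

    next-Face : ∀ {u v} → u ~ v → Face u v (next u v)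
    next-Face {u} {v} u~v with a u v 𝔹.≟ true
    ... | yes u~v′ = proj₂ (Face-exists u~v′)
    ... | no u≁v   = ⊥-elim (u≁v u~v)

  Face⇒next : ∀ {u v w} → Face u v w → next u v ≡ w
  Face⇒next f = Face-functional (next-Face (Face-~ f)) f

  -- Each face is counted once, at the dart leaving its smallest vertex.
  isLeading : V × V → Bool
  isLeading (u , v) = (toℕ u <ᵇ toℕ v) ∧ (toℕ u <ᵇ toℕ (next u v))

  isLeadingDart : V × V → Bool
  isLeadingDart (u , v) = a u v ∧ isLeading (u , v)

  private
    leading⁺ : ∀ {u v w} → Face u v w → toℕ u < toℕ v → toℕ u < toℕ w → isLeading (u , v) ≡ true
    leading⁺ f lt lt′ rewrite Face⇒next f = ∧-true (<⇒<ᵇ≡true lt) (<⇒<ᵇ≡true lt′)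

    leading⁻ : ∀ {u v w} → Face u v w → isLeading (u , v) ≡ true → toℕ u < toℕ v × toℕ u < toℕ w
    leading⁻ {u} {v} f eq with ∧-true⁻ (toℕ u <ᵇ toℕ v) eq
    ... | p , q = <ᵇ≡true⇒< p , subst (λ w → toℕ u < toℕ w) (Face⇒next f) (<ᵇ≡true⇒< q)

    leadingDarts : List (V × V)
    leadingDarts = select isLeadingDart pairs

    dartsOfFace : V × V → List (V × V)
    dartsOfFace (u , v) = (u , v) ∷ (v , next u v) ∷ (next u v , u) ∷ []

    length-darts : ∀ (es : List (V × V)) → length (concatMap dartsOfFace es) ≡ length es * 3
    length-darts []       = refl
    length-darts (e ∷ es) = cong (3 +_) (length-darts es)

    ∈-darts : ∀ {d u v w} → Face u v w → toℕ u < toℕ v → toℕ u < toℕ w → d ∈ dartsOfFace (u , v) →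
              d ∈ concatMap dartsOfFace leadingDarts
    ∈-darts {u = u} {v} f lt lt′ d∈ = ∈-concat⁺′ d∈ (∈-map⁺ dartsOfFace
      (∈-select⁺ isLeadingDart (∈-pairs u v) (∧-true (Face-~ f) (leading⁺ f lt lt′))))

    -- The smallest vertex of the face at the dart determines which of the three rotations is
    -- leading.
    every-dart : ∀ {u v} → u ~ v → (u , v) ∈ concatMap dartsOfFace leadingDarts
    every-dart {u} {v} u~v with next-Face u~v
    ... | f with ℕ.<-cmp (toℕ u) (toℕ v)
    ...   | tri≈ _ e _ = ⊥-elim (~⇒≢ u~v (toℕ-injective e))
    ...   | tri< u<v _ _ with ℕ.<-cmp (toℕ u) (toℕ (next u v))
    ...     | tri≈ _ e _ = ⊥-elim (~⇒≢ (~-sym (Face-~ (Face-rotate (Face-rotate f)))) (toℕ-injective e))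
    ...     | tri< u<w _ _ = ∈-darts f u<v u<w (here refl)
    ...     | tri> _ _ w<u = ∈-darts (Face-rotate (Face-rotate f)) w<u (ℕ.<-trans w<u u<v)
        (there (here (cong (u ,_) (sym (Face⇒next (Face-rotate (Face-rotate f)))))))
    every-dart {u} {v} u~v | f | tri> _ _ v<u with ℕ.<-cmp (toℕ v) (toℕ (next u v))
    ...     | tri≈ _ e _ = ⊥-elim (~⇒≢ (Face-~ (Face-rotate f)) (toℕ-injective e))
    ...     | tri< v<w _ _ = ∈-darts (Face-rotate f) v<w v<u
        (there (there (here (cong (_, v) (sym (Face⇒next (Face-rotate f)))))))
    ...     | tri> _ _ w<v = ∈-darts (Face-rotate (Face-rotate f)) (ℕ.<-trans w<v v<u) w<v
        (there (here (cong (u ,_) (sym (Face⇒next (Face-rotate (Face-rotate f)))))))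

    edges : List (V × V)
    edges = select (isEdge a) pairs

    edge-spec : ∀ {u v} → (u , v) ∈ edges → toℕ u < toℕ v × u ~ v
    edge-spec {u} {v} e∈ with ∧-true⁻ (toℕ u <ᵇ toℕ v) (proj₂ (∈-select⁻ (isEdge a) pairs e∈))
    ... | lt , adj = <ᵇ≡true⇒< lt , adj

    swap-injective : ∀ {d e : V × V} → swap d ≡ swap e → d ≡ e
    swap-injective refl = refl

    E≡ : E ≡ length edges
    E≡ = trans (sym numEdges≡E) (trans (numEdges≡ a) (sym (length-select (isEdge a) pairs)))

    -- Double counting of darts: an edge has two, and each occurs among the three darts of a face
    -- with a leading dart.
    2E≤3F : 2 * E ≤ length leadingDarts * 3
    2E≤3F = begin
      2 * E                                      ≡⟨ cong (E +_) (ℕ.+-identityʳ E) ⟩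
      E + E                                      ≡⟨ cong₂ _+_ E≡ (trans E≡ (sym (List.length-map swap edges))) ⟩
      length edges + length (map swap edges)     ≡⟨ sym (List.length-++ edges) ⟩
      length (edges ++ map swap edges)           ≤⟨ unique⊆⇒length≤ uniq sub ⟩
      length (concatMap dartsOfFace leadingDarts) ≡⟨ length-darts leadingDarts ⟩
      length leadingDarts * 3                    ∎
      where
      open ℕ.≤-Reasoning
      edges-unique : Unique edges
      edges-unique = select-unique (isEdge a) pairs-unique
      uniq : Unique (edges ++ map swap edges)
      uniq = Unique.++⁺ edges-unique (Unique.map⁺ swap-injective edges-unique)
        λ { (e∈ , e∈′) → case ∈-map⁻ swap e∈′ of λ { ((u , v) , f∈ , refl) →
            ℕ.<-asym (proj₁ (edge-spec e∈)) (proj₁ (edge-spec f∈)) } }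
      sub : ∀ {d} → d ∈ edges ++ map swap edges → d ∈ concatMap dartsOfFace leadingDarts
      sub {d} d∈ with ∈-++⁻ edges d∈
      ... | inj₁ e∈ = every-dart (proj₂ (edge-spec e∈))
      ... | inj₂ e∈ with ∈-map⁻ swap e∈
      ...   | (u , v) , f∈ , refl = every-dart (~-sym (proj₂ (edge-spec f∈)))

    F≤leading : (2 * E) / 3 ≤ count isLeadingDart pairs
    F≤leading = subst ((2 * E) / 3 ≤_) (trans (m*n/n≡m (length leadingDarts) 3) (length-select isLeadingDart pairs))
                      (/-monoˡ-≤ 3 2E≤3F)

  -- The unknowns are a coefficient for the triangle X Y Z and one value for every ordered pair of vertices.
  private
    N : ℕ
    N = suc (n * n)

    val : Vector N → V → V → Bool
    val x u v = x (suc (combine u v))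

  -- A 2-chain bounded by a 3-cycle

  module Bounding {X Y Z} (X~Y : X ~ Y) (Y~Z : Y ~ Z) (X~Z : X ~ Z) where

    private
      indicator : V → V → V → V → Bool
      indicator p q u v = (does (u ≟ p) ∧ does (v ≟ q)) xor (does (u ≟ q) ∧ does (v ≟ p))

      indicator-sym : ∀ p q u v → indicator p q u v ≡ indicator p q v u
      indicator-sym p q u v = trans
        (cong₂ _xor_ (𝔹.∧-comm (does (u ≟ p)) (does (v ≟ q))) (𝔹.∧-comm (does (u ≟ q)) (does (v ≟ p))))
        (𝔹.xor-comm (does (v ≟ q) ∧ does (u ≟ p)) (does (v ≟ p) ∧ does (u ≟ q)))

      indicator-nonadjacent : ∀ {p q u v} → p ~ q → a u v ≡ false → indicator p q u v ≡ false
      indicator-nonadjacent {p} {q} {u} {v} p~q u≁v = cong₂ _xor_ (zero-at p~q) (zero-at (~-sym p~q))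
        where
        zero-at : ∀ {p q} → p ~ q → does (u ≟ p) ∧ does (v ≟ q) ≡ false
        zero-at {p} {q} p~q with u ≟ p | v ≟ q
        ... | no _     | _        = refl
        ... | yes _    | no _     = refl
        ... | yes refl | yes refl = ⊥-elim (false≢true (trans (sym u≁v) p~q))

      indicator-off : ∀ {p q u v} → u ≢ p → u ≢ q → indicator p q u v ≡ false
      indicator-off {p} {q} {u} u≢p u≢q
        rewrite dec-false (u ≟ p) u≢p | dec-false (u ≟ q) u≢q = refl

      indicator-sum : ∀ {p q} → p ~ q → ∀ u → ⊕ (indicator p q u) (rot u) ≡ does (u ≟ p) xor does (u ≟ q)
      indicator-sum {p} {q} p~q u = trans
        (⊕-xor (λ v → does (u ≟ p) ∧ does (v ≟ q)) (λ v → does (u ≟ q) ∧ does (v ≟ p)) (rot u))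
        (cong₂ _xor_ (half p~q) (half (~-sym p~q)))
        where
        half : ∀ {p q} → p ~ q → ⊕ (λ v → does (u ≟ p) ∧ does (v ≟ q)) (rot u) ≡ does (u ≟ p)
        half {p} {q} p~q with u ≟ p
        ... | no _     = ⊕-false (rot u) (λ _ _ → refl)
        ... | yes refl = trans
          (⊕-single (rot-unique u) (~⇒∈rot p~q) (λ v _ v≢q → dec-false (v ≟ q) v≢q))
          (dec-true (q ≟ q) refl)

    -- The 3-cycle `X Y Z` as a 1-chain mod 2, written as a symmetric function on ordered pairs.
    onTriangle : V → V → Bool
    onTriangle u v = indicator X Y u v xor (indicator X Z u v xor indicator Y Z u v)

    onTriangle-sym : ∀ u v → onTriangle u v ≡ onTriangle v u
    onTriangle-sym u v =
      cong₂ _xor_ (indicator-sym X Y u v) (cong₂ _xor_ (indicator-sym X Z u v) (indicator-sym Y Z u v))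

    onTriangle-nonadjacent : ∀ {u v} → a u v ≡ false → onTriangle u v ≡ false
    onTriangle-nonadjacent u≁v = cong₂ _xor_ (indicator-nonadjacent X~Y u≁v)
      (cong₂ _xor_ (indicator-nonadjacent X~Z u≁v) (indicator-nonadjacent Y~Z u≁v))

    onTriangle-off : ∀ {u v} → u ≢ X → u ≢ Y → u ≢ Z → onTriangle u v ≡ false
    onTriangle-off {u} {v} u≢X u≢Y u≢Z = cong₂ _xor_ (indicator-off {v = v} u≢X u≢Y)
      (cong₂ _xor_ (indicator-off {v = v} u≢X u≢Z) (indicator-off {v = v} u≢Y u≢Z))

    onTriangle-XY : onTriangle X Y ≡ true
    onTriangle-XY
      rewrite dec-true (X ≟ X) refl | dec-true (Y ≟ Y) refl | dec-false (X ≟ Y) (~⇒≢ X~Y)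
            | dec-false (X ≟ Z) (~⇒≢ X~Z) | dec-false (Y ≟ Z) (~⇒≢ Y~Z) = refl

    -- The 1-chain is a cycle: every vertex lies on zero or two edges of the triangle.
    onTriangle-sum : ∀ u → ⊕ (onTriangle u) (rot u) ≡ false
    onTriangle-sum u = trans
      (⊕-xor (indicator X Y u) (λ v → indicator X Z u v xor indicator Y Z u v) (rot u))
      (trans (cong₂ _xor_ (indicator-sum X~Y u)
                (trans (⊕-xor (indicator X Z u) (indicator Y Z u) (rot u))
                       (cong₂ _xor_ (indicator-sum X~Z u) (indicator-sum Y~Z u))))
             (cancel (does (u ≟ X)) (does (u ≟ Y)) (does (u ≟ Z))))
      where
      cancel : ∀ x y z → (x xor y) xor ((x xor z) xor (y xor z)) ≡ false
      cancel false false false = refl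
      cancel false false true  = refl
      cancel false true  false = refl
      cancel false true  true  = refl
      cancel true  false false = refl
      cancel true  false true  = refl
      cancel true  true  false = refl
      cancel true  true  true  = refl

    private
      -- Of the three equations around a face, the one at its leading dart is redundant.
      dartForms : V × V → List (Vector N → Bool)
      dartForms (u , v) =
        if a u v then (if isLeading (u , v) then [] else ((λ x → val x u v xor val x v (next u v)) ∷ []))
                 else ((λ x → val x u v) ∷ [])

      -- A dart and its reverse carry the values of the two faces at their edge. The equation says
      -- that the boundary of the 2-chain `x` agrees at this edge with `t` times the triangle.
      edgeForm : V × V → Vector N → Bool
      edgeForm (u , v) x = (val x u v xor val x v u) xor (x zero ∧ onTriangle u v)

      -- The first form normalises the value at the dart `X Y`: adding the same constant to all
      -- faces preserves the other equations at the edges.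
      forms : List (Vector N → Bool)
      forms = (λ x → val x X Y) ∷ (concatMap dartForms pairs ++ map edgeForm chords)

      dartForms-linear : ∀ d → All Linear (dartForms d)
      dartForms-linear (u , v) with a u v
      ... | false = coordinate-linear _ ∷ []
      ... | true with isLeading (u , v)
      ...   | true  = []
      ...   | false = xor-linear (coordinate-linear _) (coordinate-linear _) ∷ []

      forms-linear : All Linear forms
      forms-linear = coordinate-linear _ ∷ All.++⁺
        {xs = concatMap dartForms pairs} {ys = map edgeForm chords}
        (All.concat⁺ {xss = map dartForms pairs} (All.map⁺ (All.tabulate λ {d} _ → dartForms-linear d)))
        (All.map⁺ {f = edgeForm} (All.tabulate λ {e} _ → xor-linear (xor-linear (coordinate-linear _) (coordinate-linear _))
                                                       (∧-linear (onTriangle (proj₁ e) (proj₂ e)) (coordinate-linear zero))))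

      length-dartForms : ∀ ds → length (concatMap dartForms ds) + count isLeadingDart ds ≡ length ds
      length-dartForms [] = refl
      length-dartForms ((u , v) ∷ ds) with a u v
      ... | false = cong suc (length-dartForms ds)
      ... | true with isLeading (u , v)
      ...   | true  = trans (ℕ.+-suc _ _) (cong suc (length-dartForms ds))
      ...   | false = cong suc (length-dartForms ds)

      -- The pairs contribute `n * n - f` forms, the chords at most `E - m`, and the normalisation
      -- one. With `f` at least the number of faces, Euler's formula bounds the total by `n * n`,
      -- one less than the number of unknowns.
      few-forms : length forms < N
      few-forms = s≤s (ℕ.+-cancelʳ-≤ (n + f) _ (n * n) (begin
        suc (length (concatMap dartForms pairs ++ map edgeForm chords)) + (n + f)
          ≡⟨ cong (λ k → suc k + (n + f)) (trans (List.length-++ (concatMap dartForms pairs)) (cong (d +_) (List.length-map edgeForm chords))) ⟩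
        suc (d + c) + (n + f)
          ≡⟨ rearrange d c m f ⟩
        (d + f) + (2 + (c + m))
          ≤⟨ ℕ.+-mono-≤ (ℕ.≤-reflexive (trans (length-dartForms pairs) length-pairs))
                        (s≤s (s≤s (ℕ.≤-trans chords+tree≤edges (ℕ.≤-reflexive numEdges≡E)))) ⟩
        n * n + (2 + E)
          ≡⟨ cong (n * n +_) (trans (ℕ.+-comm 2 E) (sym euler)) ⟩
        n * n + (n + (2 * E) / 3)
          ≤⟨ ℕ.+-monoʳ-≤ (n * n) (ℕ.+-monoʳ-≤ n F≤leading) ⟩
        n * n + (n + f) ∎))
        where
        open ℕ.≤-Reasoning
        d = length (concatMap dartForms pairs)
        c = length chords
        f = count isLeadingDart pairs
        rearrange : ∀ d c m f → suc (d + c) + (suc m + f) ≡ (d + f) + (2 + (c + m))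
        rearrange = solve-∀

    record Solution : Set where
      field
        t              : Bool
        x              : V → V → Bool
        vanishes       : ∀ {u v} → a u v ≡ false → x u v ≡ false
        face-constant  : ∀ {u v w} → Face u v w → x u v ≡ x v w
        chord-balanced : ∀ {u v} → ¬ Tree u v → (x u v xor x v u) xor (t ∧ onTriangle u v) ≡ false
        based          : x X Y ≡ false
        nontrivial     : t ≡ false → ∃[ u ] ∃[ v ] x u v ≡ true

    private
      from-zero : ∃[ x ] ((∃[ i ] x i ≡ true) × All (λ L → L x ≡ false) forms) → Solution
      from-zero (x , (i , xi) , zBase ∷ zs) = record
        { t              = x zero
        ; x              = val x
        ; vanishes       = λ {u} {v} → vanishes u v
        ; face-constant  = face-constant
        ; chord-balanced = chord-balanced
        ; based          = zBase
        ; nontrivial     = nontrivial i xi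
        }
        where
        dart-zero : ∀ u v → All (λ L → L x ≡ false) (dartForms (u , v))
        dart-zero u v = All.lookup
          (All.map⁻ (All.concat⁻ {xss = map dartForms pairs} (All.++⁻ˡ (concatMap dartForms pairs) zs)))
          (∈-pairs u v)

        vanishes : ∀ u v → a u v ≡ false → val x u v ≡ false
        vanishes u v u≁v with a u v | u≁v | dart-zero u v
        ... | false | _ | z ∷ [] = z

        non-leading : ∀ {u v w} → Face u v w → isLeading (u , v) ≡ false → val x u v ≡ val x v w
        non-leading {u} {v} f nl with a u v | isLeading (u , v) | Face-~ f | nl | dart-zero u v
        ... | true | false | _ | _ | z ∷ [] =
          xor≡false⇒≡ _ _ (trans (cong (λ w → val x u v xor val x v w) (sym (Face⇒next f))) z)

        face-constant : ∀ {u v w} → Face u v w → val x u v ≡ val x v w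
        face-constant {u} {v} {w} f with isLeading (u , v) in eq
        ... | false = non-leading f eq
        -- A face has only one leading dart, so the equations at its two other darts are present and
        -- together give the missing one.
        ... | true  = sym (trans
            (non-leading (Face-rotate f) (not-leading (Face-rotate f) λ { (_ , lt) → ℕ.<-asym lt (proj₁ u<) }))
            (non-leading (Face-rotate (Face-rotate f))
                         (not-leading (Face-rotate (Face-rotate f)) λ { (lt , _) → ℕ.<-asym lt (proj₂ u<) })))
          where
          u< : toℕ u < toℕ v × toℕ u < toℕ w
          u< = leading⁻ f eq
          not-leading : ∀ {u v w} → Face u v w → ¬ (toℕ u < toℕ v × toℕ u < toℕ w) → isLeading (u , v) ≡ false
          not-leading {u} {v} f ¬lt with isLeading (u , v) in eq′
          ... | false = refl
          ... | true  = ⊥-elim (¬lt (leading⁻ f eq′))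

        chord-zero : ∀ {u v} → toℕ u < toℕ v → u ~ v → ¬ Tree u v → edgeForm (u , v) x ≡ false
        chord-zero {u} {v} lt u~v ¬tree = All.lookup (All.map⁻ (All.++⁻ʳ (concatMap dartForms pairs) zs))
          (∈-select⁺ isChord (∈-pairs u v)
            (∧-true (∧-true (<⇒<ᵇ≡true lt) u~v) (cong not (dec-false (Tree? u v) ¬tree))))

        chord-balanced : ∀ {u v} → ¬ Tree u v → edgeForm (u , v) x ≡ false
        chord-balanced {u} {v} ¬tree with a u v in eq
        ... | false = cong₂ _xor_
          (cong₂ _xor_ (vanishes u v eq) (vanishes v u (trans (proj₁ simple v u) eq)))
          (trans (cong (x zero ∧_) (onTriangle-nonadjacent eq)) (𝔹.∧-zeroʳ (x zero)))
        ... | true with ℕ.<-cmp (toℕ u) (toℕ v)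
        ...   | tri< lt _ _ = chord-zero lt eq ¬tree
        ...   | tri≈ _ e _  = ⊥-elim (~⇒≢ eq (toℕ-injective e))
        ...   | tri> _ _ gt = trans
          (cong₂ _xor_ (𝔹.xor-comm (val x u v) (val x v u)) (cong (x zero ∧_) (onTriangle-sym u v)))
          (chord-zero gt (~-sym eq) (¬tree ∘ λ { (i , e) → i , Sum.swap e }))

        nontrivial : ∀ i → x i ≡ true → x zero ≡ false → ∃[ u ] ∃[ v ] val x u v ≡ true
        nontrivial zero    xi x0 = ⊥-elim (false≢true (trans (sym x0) xi))
        nontrivial (suc k) xi x0 = proj₁ (remQuot {n} n k) , proj₂ (remQuot {n} n k) ,
          trans (cong (x ∘ suc) (combine-remQuot {n} n k)) xi

    abstract
      solution : Solution
      solution = from-zero (nonzero-solution forms forms-linear few-forms)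

    open Solution solution

    private
      -- The boundary of `x` plus `t` times the triangle. It is a cycle (`defect-sum`) and vanishes
      -- off the tree.
      defect : V → V → Bool
      defect u v = (x u v xor x v u) xor (t ∧ onTriangle u v)

      defect-sym : ∀ u v → defect u v ≡ defect v u
      defect-sym u v = cong₂ _xor_ (𝔹.xor-comm (x u v) (x v u)) (cong (t ∧_) (onTriangle-sym u v))

      -- Around u, each value x v u equals x u v′ for the successor v′ of v.
      defect-sum : ∀ u → ⊕ (defect u) (rot u) ≡ false
      defect-sum u = trans (⊕-xor (λ v → x u v xor x v u) (λ v → t ∧ onTriangle u v) (rot u))
        (cong₂ _xor_
          (trans (⊕-xor (x u) (λ v → x v u) (rot u))
                 (trans (cong (⊕ (x u) (rot u) xor_) turn) (𝔹.xor-same (⊕ (x u) (rot u)))))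
          triangle)
        where
        turn : ⊕ (λ v → x v u) (rot u) ≡ ⊕ (x u) (rot u)
        turn = ⊕-cyclic (λ v → x v u) (x u) (rot u)
          (λ v v∈ → let w , f = Face-exists (~-sym (∈rot⇒~ v∈)) in w , proj₁ f)
          (λ v w c → face-constant (CycNext⇒Face c))
        triangle : ⊕ (λ v → t ∧ onTriangle u v) (rot u) ≡ false
        triangle with t
        ... | true  = onTriangle-sum u
        ... | false = ⊕-false (rot u) (λ _ _ → refl)

      D : ℕ
      D = proj₁ (bounded depth)

      -- Induction from the leaves towards the root: once the edges to the children of `suc i` have
      -- defect zero, the vanishing sum around `suc i` reduces to the edge to its parent. The number
      -- `k` is fuel; at `k = 0` the vertex would be deeper than the maximal depth `D`.
      tree-balanced : ∀ k i → D < depth (suc i) + k → defect (suc i) (parent i) ≡ false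
      tree-balanced zero i lt =
        ⊥-elim (ℕ.<⇒≱ lt (ℕ.≤-trans (ℕ.≤-reflexive (ℕ.+-identityʳ _)) (proj₂ (bounded depth) (suc i))))
      tree-balanced (suc k) i lt = trans
        (sym (⊕-single (rot-unique (suc i)) (~⇒∈rot (parent-adjacent i)) others))
        (defect-sum (suc i))
        where
        others : ∀ w → w ∈ rot (suc i) → w ≢ parent i → defect (suc i) w ≡ false
        others w _ w≢ with Tree? (suc i) w
        ... | no ¬tree = chord-balanced ¬tree
        ... | yes (j , inj₁ (refl , refl)) = ⊥-elim (w≢ refl)
        -- `suc j` is a child of `suc i` and hence strictly deeper, so the smaller fuel `k` is
        -- enough for it.
        ... | yes (j , inj₂ (refl , e)) = trans (defect-sym (suc i) (suc j))
          (subst (λ v → defect (suc j) v ≡ false) (sym e)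
            (tree-balanced k j (ℕ.≤-trans lt (ℕ.≤-trans (ℕ.≤-reflexive (ℕ.+-suc _ k))
              (ℕ.+-monoˡ-≤ k (subst (λ v → depth v < depth (suc j)) (sym e) (parent-depth j)))))))

      balanced : ∀ u v → defect u v ≡ false
      balanced u v with Tree? u v
      ... | no ¬tree = chord-balanced ¬tree
      ... | yes (i , inj₁ (refl , refl)) = tree-balanced (suc D) i (ℕ.m≤n+m (suc D) (depth (suc i)))
      ... | yes (i , inj₂ (refl , refl)) = trans (defect-sym u v) (tree-balanced (suc D) i (ℕ.m≤n+m (suc D) (depth (suc i))))

      -- Crossing an edge at `u` does not change the value, and consecutive edges at `u` bound a
      -- common face; so all faces around `u` have the same value.
      locally-constant : ∀ {u v w} → (∀ w → x u w ≡ x w u) → u ~ v → u ~ w → x u v ≡ x u w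
      locally-constant {u} {v} {w} bal u~v u~w with x u v 𝔹.≟ x u w
      ... | yes eq = eq
      ... | no ne with cyclic-change _≟_ (x u) u (rot-unique u) (~⇒∈rot u~v) (~⇒∈rot u~w)
                         (≢-sym (~⇒≢ u~v)) (≢-sym (~⇒≢ u~w)) ne
      ...   | b , c , next-bc , diff , _ = ⊥-elim (absurd diff)
        where
        same : x u b ≡ x u c
        same = trans (bal b) (face-constant (CycNext⇒Face next-bc))
        absurd : ¬ Differ (x u) b c
        absurd (inj₁ (p , q)) = false≢true (trans (sym q) (trans (sym same) p))
        absurd (inj₂ (p , q)) = false≢true (trans (sym p) (trans same q))

      -- With `t = 0` the 2-chain has no boundary. It is then constant around every vertex, hence
      -- everywhere by connectedness, and zero by the normalisation, so that the whole solution
      -- would be zero.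
      t≡true : t ≡ true
      t≡true with t in eq
      ... | true  = refl
      ... | false = ⊥-elim (absurd (nontrivial eq))
        where
        bal : ∀ u w → x u w ≡ x w u
        bal u w = xor≡false⇒≡ _ _ (trans (sym (𝔹.xor-identityʳ _))
          (trans (cong (λ t → (x u w xor x w u) xor (t ∧ onTriangle u w)) (sym eq)) (balanced u w)))
        Zero : V → Set
        Zero u = ∀ {v} → u ~ v → x u v ≡ false
        closed : ∀ {u w} → Zero u → u ~ w → Zero w
        closed {u} {w} zu u~w w~v = trans (locally-constant (bal w) w~v (~-sym u~w)) (trans (bal w u) (zu u~w))
        all-zero : ∀ u → Zero u
        all-zero u = reach-closed Zero closed (connected X u)
                       (λ X~v → trans (locally-constant (bal X) X~v X~Y) based)
        absurd : ∃[ u ] ∃[ v ] x u v ≡ true → ⊥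
        absurd (u , v , xuv) with a u v in adj
        ... | true  = false≢true (trans (sym (all-zero u adj)) xuv)
        ... | false = false≢true (trans (sym (vanishes adj)) xuv)

    jump : x Y X ≡ true
    jump with balanced X Y
    ... | eq rewrite based | t≡true | onTriangle-XY with x Y X
    ...   | true = refl

    balanced-off : ∀ {u} → u ≢ X → u ≢ Y → u ≢ Z → ∀ w → x u w ≡ x w u
    balanced-off {u} u≢X u≢Y u≢Z w = xor≡false⇒≡ _ _ (trans (sym (𝔹.xor-identityʳ _)) (trans
      (cong ((x u w xor x w u) xor_)
        (sym (trans (cong (t ∧_) (onTriangle-off {v = w} u≢X u≢Y u≢Z)) (𝔹.∧-zeroʳ t))))
      (balanced u w)))

    constant-off : ∀ {u v w} → u ≢ X → u ≢ Y → u ≢ Z → u ~ v → u ~ w → x u v ≡ x u w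
    constant-off u≢X u≢Y u≢Z = locally-constant (balanced-off u≢X u≢Y u≢Z)

-- Separations

-- x y z is a 3-cycle, and A is a nonempty union of components of its complement, but not all of it.
record Separation {n} (a : Adj n) (x y z : Fin n) (A : Fin n → Bool) : Set where
  field
    x~y          : a x y ≡ true
    y~z          : a y z ≡ true
    x~z          : a x z ≡ true
    x∉           : A x ≡ false
    y∉           : A y ≡ false
    z∉           : A z ≡ false
    inhabited    : ∃[ v ] A v ≡ true
    coinhabited  : ∃[ v ] (A v ≡ false × v ≢ x × v ≢ y × v ≢ z)
    closed       : ∀ {u v} → A u ≡ true → a u v ≡ true → A v ≡ true ⊎ v ≡ x ⊎ v ≡ y ⊎ v ≡ z

one-of-three? : ∀ {n} (x y z v : Fin n) → (v ≡ x ⊎ v ≡ y ⊎ v ≡ z) ⊎ (v ≢ x × v ≢ y × v ≢ z)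
one-of-three? x y z v with v ≟ x | v ≟ y | v ≟ z
... | yes e | _     | _     = inj₁ (inj₁ e)
... | no _  | yes e | _     = inj₁ (inj₂ (inj₁ e))
... | no _  | no _  | yes e = inj₁ (inj₂ (inj₂ e))
... | no p  | no q  | no r  = inj₂ (p , q , r)

-- The interface between topology and combinatorics: two faces at every edge, links that are cycles,
-- connectedness, and separation by every 3-cycle that is not a face.
record Planar {n} (a : Adj n) : Set₁ where
  infix 4 _~_
  _~_ : Fin n → Fin n → Set
  u ~ v = a u v ≡ true
  field
    Facial         : Fin n → Fin n → Fin n → Set
    ~-sym          : ∀ {u v} → u ~ v → v ~ u
    ~⇒≢            : ∀ {u v} → u ~ v → u ≢ v
    Facial-~       : ∀ {u v w} → Facial u v w → u ~ v
    Facial-swap    : ∀ {u v w} → Facial u v w → Facial v u w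
    Facial-rotate  : ∀ {u v w} → Facial u v w → Facial v w u
    apexes         : ∀ {u v} → u ~ v → ∃[ w ] ∃[ w′ ]
      (w ≢ w′ × Facial u v w × Facial u v w′ × (∀ {g} → Facial u v g → g ≡ w ⊎ g ≡ w′))
    link-connected : ∀ x (Q : Fin n → Bool) y {s t} → x ~ s → x ~ t → s ≢ y → t ≢ y →
      Q s ≡ true → Q t ≡ false →
      ∃[ u ] ∃[ v ] (Facial x u v × Q u ≡ true × Q v ≡ false × u ≢ y × v ≢ y)
    everywhere     : (Q : Fin n → Set) → (∀ {u v} → Q u → u ~ v → Q v) → ∀ {u} → Q u → ∀ v → Q v
    jordan         : ∀ {u v w} → u ~ v → v ~ w → u ~ w → ¬ Facial u v w → ∃[ A ] Separation a u v w A

module PlanarGraph {n} {a : Adj n} (planar : Planar a) where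

  open Planar planar public
  open Separation public

  V : Set
  V = Fin n

  Sep : V → V → V → (V → Bool) → Set
  Sep = Separation a

  _~?_ : ∀ u v → Dec (u ~ v)
  u ~? v = a u v 𝔹.≟ true

  ≁⇒¬~ : ∀ {u v} → a u v ≡ false → ¬ (u ~ v)
  ≁⇒¬~ u≁v u~v = false≢true (trans (sym u≁v) u~v)

  Facial-~₂ : ∀ {u v w} → Facial u v w → v ~ w
  Facial-~₂ f = Facial-~ (Facial-rotate f)

  Facial-~₃ : ∀ {u v w} → Facial u v w → u ~ w
  Facial-~₃ f = ~-sym (Facial-~ (Facial-rotate (Facial-rotate f)))

  Facial-flip : ∀ {u v w} → Facial u v w → Facial u w v
  Facial-flip f = Facial-rotate (Facial-swap f)

  Facial? : ∀ {u v} → u ~ v → ∀ w → Dec (Facial u v w)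
  Facial? u~v w with apexes u~v
  ... | g , h , _ , fg , fh , only with w ≟ g | w ≟ h
  ...   | yes refl | _        = yes fg
  ...   | no _     | yes refl = yes fh
  ...   | no w≢g   | no w≢h   = no λ f → [ w≢g , w≢h ]′ (only f)

  only-apexes : ∀ {u v g h w} → Facial u v g → Facial u v h → g ≢ h → Facial u v w → w ≡ g ⊎ w ≡ h
  only-apexes fg fh g≢h fw with apexes (Facial-~ fg)
  ... | _ , _ , _ , _ , _ , only with only fg | only fh | only fw
  ...   | inj₁ refl | inj₁ e    | _      = ⊥-elim (g≢h (sym e))
  ...   | inj₂ refl | inj₂ e    | _      = ⊥-elim (g≢h (sym e))
  ...   | inj₁ refl | inj₂ refl | result = result
  ...   | inj₂ refl | inj₁ refl | result = Sum.swap result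

  apexes-among : ∀ {u v g h} → u ~ v → (∀ {w} → Facial u v w → w ≡ g ⊎ w ≡ h) →
                 g ≢ h × Facial u v g × Facial u v h
  apexes-among u~v among with apexes u~v
  ... | _ , _ , w≢w′ , f , f′ , _ with among f | among f′
  ...   | inj₁ refl | inj₁ refl = ⊥-elim (w≢w′ refl)
  ...   | inj₂ refl | inj₂ refl = ⊥-elim (w≢w′ refl)
  ...   | inj₁ refl | inj₂ refl = w≢w′ , f , f′
  ...   | inj₂ refl | inj₁ refl = ≢-sym w≢w′ , f′ , f

  Sep-swap : ∀ {x y z A} → Sep x y z A → Sep y x z A
  Sep-swap s = record
    { x~y = ~-sym (x~y s) ; y~z = x~z s ; x~z = y~z s ; x∉ = y∉ s ; y∉ = x∉ s ; z∉ = z∉ s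
    ; inhabited = inhabited s
    ; coinhabited = let v , v∉ , p , q , r = coinhabited s in v , v∉ , q , p , r
    ; closed = λ Au u~v → case closed s Au u~v of λ where
        (inj₁ e)               → inj₁ e
        (inj₂ (inj₁ e))        → inj₂ (inj₂ (inj₁ e))
        (inj₂ (inj₂ (inj₁ e))) → inj₂ (inj₁ e)
        (inj₂ (inj₂ (inj₂ e))) → inj₂ (inj₂ (inj₂ e)) }

  Sep-rotate : ∀ {x y z A} → Sep x y z A → Sep y z x A
  Sep-rotate s = record
    { x~y = y~z s ; y~z = ~-sym (x~z s) ; x~z = ~-sym (x~y s) ; x∉ = y∉ s ; y∉ = z∉ s ; z∉ = x∉ s
    ; inhabited = inhabited s
    ; coinhabited = let v , v∉ , p , q , r = coinhabited s in v , v∉ , q , r , p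
    ; closed = λ Au u~v → case closed s Au u~v of λ where
        (inj₁ e)               → inj₁ e
        (inj₂ (inj₁ e))        → inj₂ (inj₂ (inj₂ e))
        (inj₂ (inj₂ (inj₁ e))) → inj₂ (inj₁ e)
        (inj₂ (inj₂ (inj₂ e))) → inj₂ (inj₂ (inj₁ e)) }

  ≢-by : ∀ {A : V → Bool} {u v} → A u ≡ true → A v ≡ false → u ≢ v
  ≢-by Au Av refl = false≢true (trans (sym Av) Au)

  module _ (x y z : V) (A : V → Bool) where

    private
      Rest : V → Set
      Rest v = A v ≡ false × v ≢ x × v ≢ y × v ≢ z

      Rest? : ∀ v → Dec (Rest v)
      Rest? v = (A v 𝔹.≟ false) ×-dec ¬? (v ≟ x) ×-dec ¬? (v ≟ y) ×-dec ¬? (v ≟ z)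

    coside : V → Bool
    coside v = does (Rest? v)

    coside⁺ : ∀ {v} → A v ≡ false → v ≢ x → v ≢ y → v ≢ z → coside v ≡ true
    coside⁺ {v} p q r s = dec-true (Rest? v) (p , q , r , s)

    coside⁻ : ∀ {v} → coside v ≡ true → A v ≡ false × v ≢ x × v ≢ y × v ≢ z
    coside⁻ {v} = does⇒ (Rest? v)

    coside-false : ∀ {v} → A v ≡ true → coside v ≡ false
    coside-false {v} Av = dec-false (Rest? v) λ { (nAv , _) → false≢true (trans (sym nAv) Av) }

    coside-sep : Sep x y z A → Sep x y z coside
    coside-sep s = record
      { x~y = x~y s ; y~z = y~z s ; x~z = x~z s
      ; x∉ = dec-false (Rest? x) (λ { (_ , p , _) → p refl })
      ; y∉ = dec-false (Rest? y) (λ { (_ , _ , p , _) → p refl })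
      ; z∉ = dec-false (Rest? z) (λ { (_ , _ , _ , p) → p refl })
      ; inhabited = let v , p , q , r , t = coinhabited s in v , coside⁺ p q r t
      ; coinhabited = let v , Av = inhabited s in
          v , coside-false Av , ≢-by Av (x∉ s) , ≢-by Av (y∉ s) , ≢-by Av (z∉ s)
      ; closed = closed′ }
      where
      closed′ : ∀ {u v} → coside u ≡ true → u ~ v → coside v ≡ true ⊎ v ≡ x ⊎ v ≡ y ⊎ v ≡ z
      closed′ {u} {v} cu u~v with coside⁻ cu | one-of-three? x y z v
      ... | _ | inj₁ e = inj₂ e
      ... | nu , ux , uy , uz | inj₂ (p , q , r) with true⊎false (A v)
      ...   | inj₂ Av = inj₁ (coside⁺ Av p q r)
      ...   | inj₁ Av with closed s Av (~-sym u~v)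
      ...     | inj₁ Au               = ⊥-elim (false≢true (trans (sym nu) Au))
      ...     | inj₂ (inj₁ e)         = ⊥-elim (ux e)
      ...     | inj₂ (inj₂ (inj₁ e))  = ⊥-elim (uy e)
      ...     | inj₂ (inj₂ (inj₂ e))  = ⊥-elim (uz e)

  -- If `C` touches neither `y` nor `z`, it is closed under adjacency. If it touches `y`, the link
  -- of `y` without `z` is connected, so all neighbours of `y` other than `z` lie in `C`. Then the
  -- link of `z` keeps its neighbours in `C` together with `y`. In each case connectedness puts `d`
  -- where it is not.
  no-edge-cut : ∀ (C : V → Bool) {y z c d} → y ~ z → C y ≡ false → C z ≡ false → C c ≡ true →
    C d ≡ false → d ≢ y → d ≢ z →
    (∀ {u v} → C u ≡ true → u ~ v → C v ≡ true ⊎ v ≡ y ⊎ v ≡ z) → ⊥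
  no-edge-cut C {y} {z} {c} {d} y~z Cy Cz Cc Cd d≢y d≢z cl =
    false≢true (trans (sym Cd) (everywhere (λ v → C v ≡ true) step′ Cc d))
    where
    C? : ∀ v → Dec (C v ≡ true)
    C? v = C v 𝔹.≟ true

    escape : ∀ {y z} → y ~ z → C y ≡ false → C z ≡ false → d ≢ y → d ≢ z →
      (∀ {u v} → C u ≡ true → u ~ v → C v ≡ true ⊎ v ≡ y ⊎ v ≡ z) → ∀ {u} → C u ≡ true → ¬ (y ~ u)
    escape {y} {z} y~z Cy Cz d≢y d≢z cl {u} Cu y~u
      with any? (λ e → (y ~? e) ×-dec (C e 𝔹.≟ false) ×-dec ¬? (e ≟ z))
    ... | yes (e , y~e , Ce , e≢z) with link-connected y C z y~u y~e (≢-by Cu Cz) e≢z Cu Ce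
    ...   | b , b′ , f , Cb , Cb′ , _ , b′≢z with cl Cb (Facial-~₂ f)
    ...     | inj₁ p        = false≢true (trans (sym Cb′) p)
    ...     | inj₂ (inj₁ p) = ~⇒≢ (Facial-~₃ f) (sym p)
    ...     | inj₂ (inj₂ p) = b′≢z p
    escape {y} {z} y~z Cy Cz d≢y d≢z cl {u} Cu y~u | no none = contra
      where
      C′? : ∀ v → Dec (C v ≡ true ⊎ v ≡ y)
      C′? v = C? v ⊎-dec v ≟ y
      inside : ∀ {v} → y ~ v → C v ≡ true ⊎ v ≡ z
      inside {v} y~v with C v in Cv | v ≟ z
      ... | true  | _       = inj₁ refl
      ... | false | yes p   = inj₂ p
      ... | false | no v≢z  = ⊥-elim (none (v , y~v , Cv , v≢z))
      contra : ⊥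
      contra with any? (λ e → (z ~? e) ×-dec ¬? (C′? e))
      -- Here `C` and `y` play the role that `C` had around `y`; the whole link of `z` is used, with
      -- nothing removed.
      ... | yes (e , z~e , ¬C′e) with link-connected z (λ v → does (C′? v)) z (~-sym y~z) z~e
                (~⇒≢ y~z) (≢-sym (~⇒≢ z~e)) (dec-true (C′? y) (inj₂ refl)) (dec-false (C′? e) ¬C′e)
      ...   | b , b′ , f , C′b , ¬C′b′ , _ with does⇒ (C′? b) C′b
      ...     | inj₁ Cb with cl Cb (Facial-~₂ f)
      ...       | inj₁ p        = ¬does⇒ (C′? b′) ¬C′b′ (inj₁ p)
      ...       | inj₂ (inj₁ p) = ¬does⇒ (C′? b′) ¬C′b′ (inj₂ p)
      ...       | inj₂ (inj₂ p) = ~⇒≢ (Facial-~₃ f) (sym p)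
      contra | yes (e , z~e , ¬C′e) | b , b′ , f , C′b , ¬C′b′ , _ | inj₂ refl with inside (Facial-~₂ f)
      ...       | inj₁ p = ¬does⇒ (C′? b′) ¬C′b′ (inj₁ p)
      ...       | inj₂ p = ~⇒≢ (Facial-~₃ f) (sym p)
      contra | no none′ with everywhere (λ v → C v ≡ true ⊎ v ≡ y ⊎ v ≡ z) step″ (inj₁ Cu) d
        where
        step″ : ∀ {u v} → C u ≡ true ⊎ u ≡ y ⊎ u ≡ z → u ~ v → C v ≡ true ⊎ v ≡ y ⊎ v ≡ z
        step″ (inj₁ Cu) u~v = cl Cu u~v
        step″ (inj₂ (inj₁ refl)) u~v = Sum.map₂ inj₂ (inside u~v)
        step″ {v = v} (inj₂ (inj₂ refl)) u~v with C′? v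
        ... | yes p = Sum.map₂ inj₁ p
        ... | no ¬p = ⊥-elim (none′ (v , u~v , ¬p))
      ... | inj₁ p        = false≢true (trans (sym Cd) p)
      ... | inj₂ (inj₁ p) = d≢y p
      ... | inj₂ (inj₂ p) = d≢z p

    step′ : ∀ {u v} → C u ≡ true → u ~ v → C v ≡ true
    step′ Cu u~v with cl Cu u~v
    ... | inj₁ p = p
    ... | inj₂ (inj₁ refl) = ⊥-elim (escape y~z Cy Cz d≢y d≢z cl Cu (~-sym u~v))
    ... | inj₂ (inj₂ refl) = ⊥-elim (escape (~-sym y~z) Cz Cy d≢z d≢y
                                            (λ Cu u~v → Sum.map₂ Sum.swap (cl Cu u~v)) Cu (~-sym u~v))

  -- Otherwise the two remaining corners, which are adjacent, would cut `A` off from `x`.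
  touches : ∀ {x y z A} → Sep x y z A → ∃[ u ] (A u ≡ true × x ~ u)
  touches {x} {y} {z} {A} s with any? (λ u → (A u 𝔹.≟ true) ×-dec (x ~? u))
  ... | yes p = p
  ... | no none = ⊥-elim (no-edge-cut A (y~z s) (y∉ s) (z∉ s) (proj₂ (inhabited s)) (x∉ s)
                            (~⇒≢ (x~y s)) (~⇒≢ (x~z s)) cl)
    where
    cl : ∀ {u v} → A u ≡ true → u ~ v → A v ≡ true ⊎ v ≡ y ⊎ v ≡ z
    cl Au u~v with closed s Au u~v
    ... | inj₁ p           = inj₁ p
    ... | inj₂ (inj₁ refl) = ⊥-elim (none (_ , Au , ~-sym u~v))
    ... | inj₂ (inj₂ p)    = inj₂ p

  -- In the link of `x` without `z`, a path from a neighbour in `A` to `y` can leave `A` only at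
  -- `y`, and the step by which it does is a face on `x y`.
  apex-inside : ∀ {x y z A} → Sep x y z A → ∃[ u ] (A u ≡ true × Facial x y u)
  apex-inside {x} {y} {z} {A} s with touches s
  ... | u , Au , x~u with link-connected x A z x~u (x~y s) (≢-by Au (z∉ s)) (~⇒≢ (y~z s)) Au (y∉ s)
  ...   | b , b′ , f , Ab , Ab′ , _ , b′≢z with closed s Ab (Facial-~₂ f)
  ...     | inj₁ p                = ⊥-elim (false≢true (trans (sym Ab′) p))
  ...     | inj₂ (inj₁ p)         = ⊥-elim (~⇒≢ (Facial-~₃ f) (sym p))
  ...     | inj₂ (inj₂ (inj₁ refl)) = b , Ab , Facial-flip f
  ...     | inj₂ (inj₂ (inj₂ p))  = ⊥-elim (b′≢z p)

  apex-outside : ∀ {x y z A} → Sep x y z A → ∃[ u ] (coside x y z A u ≡ true × Facial x y u)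
  apex-outside s = apex-inside (coside-sep _ _ _ _ s)

  private
    -- Let `C` be the part of `A′` outside `A`. As `x` is neither in `A′` nor on `u v w`, the
    -- neighbours `y` and `z` of `x` are not in `A′`. The corners `v` and `w` are adjacent to `u` in
    -- `A`, so outside `A` they can only be `y` or `z`. Hence nothing but the edge `y z` bounds `C`,
    -- and `C` is empty.
    nest-core : ∀ {x y z A u v w A′} → Sep x y z A → A u ≡ true → x ≢ v → x ≢ w →
      Sep u v w A′ → A′ x ≡ false → ∀ {g} → A′ g ≡ true → A g ≡ true
    nest-core {x} {y} {z} {A} {u} {v} {w} {A′} s Au x≢v x≢w s′ A′x {g} A′g with A g in Ag
    ... | true  = refl
    ... | false = ⊥-elim (no-edge-cut C (y~z s) (C-off A′y) (C-off A′z) (C-on A′g Ag) (C-off A′x)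
                            (~⇒≢ (x~y s)) (~⇒≢ (x~z s)) cl)
      where
      C : V → Bool
      C t = A′ t ∧ not (A t)
      C-off : ∀ {t} → A′ t ≡ false → C t ≡ false
      C-off e rewrite e = refl
      C-on : ∀ {t} → A′ t ≡ true → A t ≡ false → C t ≡ true
      C-on e e′ rewrite e | e′ = refl
      C⁻ : ∀ t → C t ≡ true → A′ t ≡ true × A t ≡ false
      C⁻ t e with A′ t | A t
      ... | true | false = refl , refl
      away : ∀ {t} → x ~ t → A′ t ≡ false
      away {t} x~t with A′ t in A′t
      ... | false = refl
      ... | true with closed s′ A′t (~-sym x~t)
      ...   | inj₁ p                 = ⊥-elim (false≢true (trans (sym A′x) p))
      ...   | inj₂ (inj₁ refl)       = ⊥-elim (false≢true (trans (sym (x∉ s)) Au))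
      ...   | inj₂ (inj₂ (inj₁ p))   = ⊥-elim (x≢v p)
      ...   | inj₂ (inj₂ (inj₂ p))   = ⊥-elim (x≢w p)
      A′y : A′ y ≡ false
      A′y = away (x~y s)
      A′z : A′ z ≡ false
      A′z = away (x~z s)
      cl : ∀ {b b′} → C b ≡ true → b ~ b′ → C b′ ≡ true ⊎ b′ ≡ y ⊎ b′ ≡ z
      cl {b} {b′} Cb b~b′ with C⁻ b Cb
      ... | A′b , ¬Ab = result (closed s′ A′b b~b′)
        where
        ¬Ab′ : A b′ ≡ false
        ¬Ab′ with A b′ in e
        ... | false = refl
        ... | true with closed s e (~-sym b~b′)
        ...   | inj₁ p                   = ⊥-elim (false≢true (trans (sym ¬Ab) p))
        ...   | inj₂ (inj₁ refl)         = ⊥-elim (false≢true (trans (sym A′x) A′b))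
        ...   | inj₂ (inj₂ (inj₁ refl))  = ⊥-elim (false≢true (trans (sym A′y) A′b))
        ...   | inj₂ (inj₂ (inj₂ refl))  = ⊥-elim (false≢true (trans (sym A′z) A′b))
        corner : u ~ b′ → x ≢ b′ → b′ ≡ y ⊎ b′ ≡ z
        corner u~b′ x≢b′ with closed s Au u~b′
        ... | inj₁ p        = ⊥-elim (false≢true (trans (sym ¬Ab′) p))
        ... | inj₂ (inj₁ p) = ⊥-elim (x≢b′ (sym p))
        ... | inj₂ (inj₂ p) = p
        result : A′ b′ ≡ true ⊎ b′ ≡ u ⊎ b′ ≡ v ⊎ b′ ≡ w → C b′ ≡ true ⊎ b′ ≡ y ⊎ b′ ≡ z
        result (inj₁ p)                  = inj₁ (C-on p ¬Ab′)
        result (inj₂ (inj₁ refl))        = ⊥-elim (false≢true (trans (sym ¬Ab′) Au))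
        result (inj₂ (inj₂ (inj₁ refl))) = inj₂ (corner (x~y s′) x≢v)
        result (inj₂ (inj₂ (inj₂ refl))) = inj₂ (corner (x~z s′) x≢w)

    nest-from : ∀ {x y z A u v w A₀} → Sep x y z A → A u ≡ true → x ≢ v → x ≢ w → Sep u v w A₀ →
      ∃[ A′ ] (Sep u v w A′ × (∀ {g} → A′ g ≡ true → A g ≡ true))
    nest-from {x} {y} {z} {A} {u} {v} {w} {A₀} s Au x≢v x≢w s₀ with A₀ x in e
    ... | false = A₀ , s₀ , nest-core s Au x≢v x≢w s₀ e
    ... | true  = coside u v w A₀ , coside-sep u v w A₀ s₀ ,
                  nest-core s Au x≢v x≢w (coside-sep u v w A₀ s₀) (coside-false u v w A₀ e)

  -- Since `u` lies in `A`, only `v` and `w` can be corners of `x y z`, so some corner is off the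
  -- inner triangle. The side of `u v w` that avoids this corner is the nested one.
  nest : ∀ {x y z A u v w A₀} → Sep x y z A → A u ≡ true → Sep u v w A₀ →
    ∃[ A′ ] (Sep u v w A′ × (∀ {g} → A′ g ≡ true → A g ≡ true))
  nest {x} {y} {z} {A} {u} {v} {w} s Au s₀ with x ≟ v | x ≟ w | y ≟ v | y ≟ w
  ... | no p     | no q     | _        | _        = nest-from s Au p q s₀
  ... | _        | _        | no p     | no q     = nest-from (Sep-swap s) Au p q s₀
  ... | yes refl | _        | yes refl | _        = ⊥-elim (~⇒≢ (x~y s) refl)
  ... | _        | yes refl | _        | yes refl = ⊥-elim (~⇒≢ (x~y s) refl)
  ... | yes refl | _        | _        | yes refl =
    nest-from (Sep-rotate (Sep-rotate s)) Au (≢-sym (~⇒≢ (x~z s))) (≢-sym (~⇒≢ (y~z s))) s₀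
  ... | _        | yes refl | yes refl | _        =
    nest-from (Sep-rotate (Sep-rotate s)) Au (≢-sym (~⇒≢ (y~z s))) (≢-sym (~⇒≢ (x~z s))) s₀

  size : (V → Bool) → ℕ
  size A = count A (allFin n)

  size-< : ∀ {A A′ : V → Bool} {u} → (∀ {g} → A′ g ≡ true → A g ≡ true) → A u ≡ true → A′ u ≡ false →
           size A′ < size A
  size-< {A} {A′} {u} sub Au A′u = subst₂ _<_ (length-select A′ (allFin n)) (length-select A (allFin n))
    (unique⊆⇒length≤ (All.tabulate (λ g∈ → ≢-sym (≢-by (proj₂ (∈-select⁻ A′ (allFin n) g∈)) A′u))
                       ∷ select-unique A′ (Unique.allFin⁺ n)) incl)
    where
    incl : ∀ {g} → g ∈ u ∷ select A′ (allFin n) → g ∈ select A (allFin n)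
    incl (here refl) = ∈-select⁺ A (∈-allFin u) Au
    incl (there g∈)  = ∈-select⁺ A (∈-allFin _) (sub (proj₂ (∈-select⁻ A′ (allFin n) g∈)))

  NonFacial : V → V → V → Set
  NonFacial u v w = u ~ v × v ~ w × u ~ w × ¬ Facial u v w

  NonFacial? : ∀ u v w → Dec (NonFacial u v w)
  NonFacial? u v w with u ~? v
  ... | no ¬p   = no (¬p ∘ proj₁)
  ... | yes u~v with v ~? w | u ~? w | Facial? u~v w
  ...   | yes p | yes q | no r  = yes (u~v , p , q , r)
  ...   | no ¬p | _     | _     = no λ { (_ , p , _) → ¬p p }
  ...   | yes _ | no ¬q | _     = no λ { (_ , _ , q , _) → ¬q q }
  ...   | yes _ | yes _ | yes r = no λ { (_ , _ , _ , ¬r) → ¬r r }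

  -- For an edge u v, this says that it is not contractible in the triangulation.
  Bad : V → V → Set
  Bad u v = ∃[ w ] NonFacial u v w

  Bad? : ∀ u v → Dec (Bad u v)
  Bad? u v = any? (NonFacial? u v)

  NonFacial-sep : ∀ {u v w} → NonFacial u v w → ∃[ A ] Sep u v w A
  NonFacial-sep (p , q , r , f) = jordan p q r f

  Bad-sym : ∀ {u v} → Bad u v → Bad v u
  Bad-sym (w , p , q , r , f) = w , ~-sym p , r , q , f ∘ Facial-swap

  -- A bad edge at a vertex `u` of the side lies on a separating triangle through `u`, and the
  -- nested side of this triangle has lost `u`. The size therefore drops until no bad edge is left.
  innermost : ∀ {x y z A} → Sep x y z A → ∃[ x′ ] ∃[ y′ ] ∃[ z′ ] ∃[ A′ ]
    (Sep x′ y′ z′ A′ × (∀ {g} → A′ g ≡ true → A g ≡ true) × (∀ {u v} → A′ u ≡ true → ¬ Bad u v))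
  innermost {A = A} s = go s (<-wellFounded (size A))
    where
    go : ∀ {x y z A} → Sep x y z A → Acc _<_ (size A) → ∃[ x′ ] ∃[ y′ ] ∃[ z′ ] ∃[ A′ ]
      (Sep x′ y′ z′ A′ × (∀ {g} → A′ g ≡ true → A g ≡ true) × (∀ {u v} → A′ u ≡ true → ¬ Bad u v))
    go {x} {y} {z} {A} s (acc smaller)
      with any? (λ u → (A u 𝔹.≟ true) ×-dec any? (λ v → Bad? u v))
    ... | no none = x , y , z , A , s , (λ p → p) , λ Au bad → none (_ , Au , _ , bad)
    ... | yes (u , Au , v , w , nf) with nest s Au (proj₂ (NonFacial-sep nf))
    ...   | A′ , s′ , sub with go s′ (smaller (size-< sub Au (x∉ s′)))
    ...     | x″ , y″ , z″ , A″ , s″ , sub″ , good = x″ , y″ , z″ , A″ , s″ , sub ∘ sub″ , good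

  -- The same descent, but along triangles through the fixed vertex `x`: if `x u` is bad, a triangle
  -- witnessing this again has `x` as a corner.
  contractible-inside : ∀ {x y z A} → Sep x y z A → ∃[ u ] (A u ≡ true × x ~ u × ¬ Bad x u)
  contractible-inside {A = A} s = go s (<-wellFounded (size A))
    where
    go : ∀ {x y z A} → Sep x y z A → Acc _<_ (size A) → ∃[ u ] (A u ≡ true × x ~ u × ¬ Bad x u)
    go {x} {A = A} s (acc smaller) with touches s
    ... | u , Au , x~u with Bad? x u
    ...   | no ¬bad = u , Au , x~u , ¬bad
    ...   | yes bad with Bad-sym bad
    ...     | w , nf with nest s Au (proj₂ (NonFacial-sep nf))
    ...       | A′ , s′ , sub with go (Sep-swap s′) (smaller (size-< sub Au (x∉ s′)))
    ...         | g , A′g , x~g , ¬bad = g , sub A′g , x~g , ¬bad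

  contractible-somewhere : ∀ {x u} → x ~ u → ∃[ v ] (x ~ v × ¬ Bad x v)
  contractible-somewhere {x} {u} x~u with Bad? x u
  ... | no ¬bad = u , x~u , ¬bad
  ... | yes (w , nf) with contractible-inside (proj₂ (NonFacial-sep nf))
  ...   | v , _ , x~v , ¬bad = v , x~v , ¬bad

  has-neighbour : ∀ {u v} → u ≢ v → ∃[ w ] u ~ w
  has-neighbour {u} {v} u≢v with any? (u ~?_)
  ... | yes p = p
  ... | no none = ⊥-elim (u≢v (sym (everywhere (_≡ u) (λ { refl r → ⊥-elim (none (_ , r)) }) refl v)))

-- Vertices of degree 3 and braces

pattern 1st e = inj₁ e
pattern 2nd e = inj₂ (inj₁ e)
pattern 3rd e = inj₂ (inj₂ (inj₁ e))
-- `3rd!` is the last summand of three, while `3rd` is the third of four.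
pattern 3rd! e = inj₂ (inj₂ e)
pattern 4th e = inj₂ (inj₂ (inj₂ e))

module Degree3 {n} {a : Adj n} (planar : Planar a) where

  open PlanarGraph planar

  -- Only an upper bound on the neighbourhood. Once a second vertex exists, the two faces at an edge
  -- force all three adjacencies; see `Deg3-adjacent`.
  Deg3 : V → V → V → V → Set
  Deg3 v x y z = ∀ g → v ~ g → g ≡ x ⊎ g ≡ y ⊎ g ≡ z

  HasDeg3 : V → Set
  HasDeg3 v = ∃[ x ] ∃[ y ] ∃[ z ] Deg3 v x y z

  HasDeg3? : ∀ v → Dec (HasDeg3 v)
  HasDeg3? v = any? λ x → any? λ y → any? λ z → all? λ g →
    (v ~? g) →-dec ((g ≟ x) ⊎-dec (g ≟ y) ⊎-dec (g ≟ z))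

  Deg3-rotate : ∀ {v x y z} → Deg3 v x y z → Deg3 v y z x
  Deg3-rotate d g v~g = case d g v~g of λ where
    (1st e)  → 3rd! e
    (2nd e)  → 1st e
    (3rd! e) → 2nd e

  Deg3-swap : ∀ {v x y z} → Deg3 v x y z → Deg3 v y x z
  Deg3-swap d g v~g = case d g v~g of λ where
    (1st e)  → 2nd e
    (2nd e)  → 1st e
    (3rd! e) → 3rd! e

  private
    facial-from : ∀ {v x y z} → Deg3 v x y z → v ~ x → y ≢ z × Facial v x y × Facial v x z
    facial-from d v~x = apexes-among v~x λ f → case d _ (Facial-~₃ f) of λ where
      (inj₁ refl) → ⊥-elim (~⇒≢ (Facial-~₂ f) refl)
      (inj₂ e)    → e

    Deg3-adjacent-from : ∀ {v x y z} → Deg3 v x y z → v ~ x → v ~ x × v ~ y × v ~ z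
    Deg3-adjacent-from d v~x = let _ , f , g = facial-from d v~x in v~x , Facial-~₃ f , Facial-~₃ g

  module _ {v x y z u} (d : Deg3 v x y z) (v≢u : v ≢ u) where

    Deg3-adjacent : v ~ x × v ~ y × v ~ z
    Deg3-adjacent with has-neighbour v≢u
    ... | w , v~w with d w v~w
    ...   | 1st refl  = Deg3-adjacent-from d v~w
    ...   | 2nd refl  = let p , q , r = Deg3-adjacent-from (Deg3-rotate d) v~w in r , p , q
    ...   | 3rd! refl = let p , q , r = Deg3-adjacent-from (Deg3-rotate (Deg3-rotate d)) v~w in q , r , p

    Deg3-facial : Facial v x y × Facial v x z × Facial v y z
    Deg3-facial =
      let v~x , v~y , v~z = Deg3-adjacent
          _ , f , g = facial-from d v~x
          _ , h , _ = facial-from (Deg3-rotate d) v~y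
      in f , g , h

    Deg3-good : ∀ {g} → v ~ g → ¬ Bad v g
    Deg3-good v~g (w , p , q , r , ¬f) with Deg3-facial | d _ p | d w r
    ... | f , g , h | 1st refl  | 1st refl  = ~⇒≢ q refl
    ... | f , g , h | 1st refl  | 2nd refl  = ¬f f
    ... | f , g , h | 1st refl  | 3rd! refl = ¬f g
    ... | f , g , h | 2nd refl  | 1st refl  = ¬f (Facial-flip f)
    ... | f , g , h | 2nd refl  | 2nd refl  = ~⇒≢ q refl
    ... | f , g , h | 2nd refl  | 3rd! refl = ¬f h
    ... | f , g , h | 3rd! refl | 1st refl  = ¬f (Facial-flip g)
    ... | f , g , h | 3rd! refl | 2nd refl  = ¬f (Facial-flip h)
    ... | f , g , h | 3rd! refl | 3rd! refl = ~⇒≢ q refl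

  -- `v` is the apex of both edges of `x y z` that meet at `x`.
  Corner : V → V → V → V → Set
  Corner v x y z = Facial v x y × Facial v x z

  private
    swap₂₃ : ∀ {v c d e f : V} → v ≡ c ⊎ v ≡ d ⊎ v ≡ e ⊎ v ≡ f → v ≡ c ⊎ v ≡ e ⊎ v ≡ d ⊎ v ≡ f
    swap₂₃ (1st i) = 1st i
    swap₂₃ (2nd i) = 3rd i
    swap₂₃ (3rd i) = 2nd i
    swap₂₃ (4th i) = 4th i

    rotate₁₂₃ : ∀ {v c d e f : V} → v ≡ c ⊎ v ≡ d ⊎ v ≡ e ⊎ v ≡ f → v ≡ d ⊎ v ≡ e ⊎ v ≡ c ⊎ v ≡ f
    rotate₁₂₃ (1st i) = 3rd i
    rotate₁₂₃ (2nd i) = 1st i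
    rotate₁₂₃ (3rd i) = 2nd i
    rotate₁₂₃ (4th i) = 4th i

    corner-at : ∀ {v c w w′ t} → Facial v c w → Facial v c w′ → w ≢ w′ → t ≢ w → t ≢ w′ →
      (∀ g → v ~ g → g ≡ w ⊎ g ≡ w′ ⊎ g ≡ t ⊎ g ≡ c) → ¬ HasDeg3 v → Corner v t w w′
    corner-at {v} {c} {w} {w′} {t} f f′ w≢w′ t≢w t≢w′ only ¬deg3 with v ~? t
    ... | no v≁t = ⊥-elim (¬deg3 (w , w′ , c , λ g v~g → case only g v~g of λ where
            (1st e)    → 1st e
            (2nd e)    → 2nd e
            (3rd refl) → ⊥-elim (v≁t v~g)
            (4th e)    → 3rd! e))
    ... | yes v~t = proj₂ (apexes-among v~t λ h → case only _ (Facial-~₃ h) of λ where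
            (1st e)    → inj₁ e
            (2nd e)    → inj₂ e
            (3rd refl) → ⊥-elim (~⇒≢ (Facial-~₂ h) refl)
            (4th refl) → ⊥-elim ([ t≢w , t≢w′ ]′ (only-apexes f f′ w≢w′ (Facial-flip h))))

  -- The link of a vertex of degree four on x y z c is a 4-cycle in which some corner is opposite to c.
  corner : ∀ {v x y z c} → x ≢ y → y ≢ z → x ≢ z → c ≢ x → c ≢ y → c ≢ z →
    (∀ g → v ~ g → g ≡ x ⊎ g ≡ y ⊎ g ≡ z ⊎ g ≡ c) → ¬ HasDeg3 v →
    Corner v x y z ⊎ Corner v y x z ⊎ Corner v z x y
  corner {v} {x} {y} {z} {c} x≢y y≢z x≢z c≢x c≢y c≢z only ¬deg3 with v ~? c
  ... | no v≁c = ⊥-elim (¬deg3 (x , y , z , λ g v~g → case only g v~g of λ where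
          (1st e)    → 1st e
          (2nd e)    → 2nd e
          (3rd e)    → 3rd! e
          (4th refl) → ⊥-elim (v≁c v~g)))
  ... | yes v~c with apexes v~c
  ...   | w , w′ , w≢w′ , f , f′ , _ with only w (Facial-~₃ f) | only w′ (Facial-~₃ f′)
  ...     | 4th refl | _        = ⊥-elim (~⇒≢ (Facial-~₂ f) refl)
  ...     | _        | 4th refl = ⊥-elim (~⇒≢ (Facial-~₂ f′) refl)
  ...     | 1st refl | 1st refl = ⊥-elim (w≢w′ refl)
  ...     | 2nd refl | 2nd refl = ⊥-elim (w≢w′ refl)
  ...     | 3rd refl | 3rd refl = ⊥-elim (w≢w′ refl)
  ...     | 1st refl | 2nd refl = 3rd! (corner-at f f′ w≢w′ (≢-sym x≢z) (≢-sym y≢z) only ¬deg3)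
  ...     | 2nd refl | 1st refl = 3rd! (corner-at f′ f x≢y (≢-sym x≢z) (≢-sym y≢z) only ¬deg3)
  ...     | 1st refl | 3rd refl = 2nd (corner-at f f′ w≢w′ (≢-sym x≢y) y≢z (λ g → swap₂₃ ∘ only g) ¬deg3)
  ...     | 3rd refl | 1st refl = 2nd (corner-at f′ f x≢z (≢-sym x≢y) y≢z (λ g → swap₂₃ ∘ only g) ¬deg3)
  ...     | 2nd refl | 3rd refl = 1st (corner-at f f′ w≢w′ x≢y x≢z (λ g → rotate₁₂₃ ∘ only g) ¬deg3)
  ...     | 3rd refl | 2nd refl = 1st (corner-at f′ f y≢z x≢y x≢z (λ g → rotate₁₂₃ ∘ only g) ¬deg3)

  -- The edge `x y` has just two apexes, and one of them lies on the other side.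
  one-apex-inside : ∀ {x y z A u v} → Sep x y z A → A u ≡ true → A v ≡ true → u ≢ v →
    Facial x y u → Facial x y v → ⊥
  one-apex-inside {x} {y} {z} {A} s Au Av u≢v f g with apex-outside s
  ... | w , Bw , h = [ ≢-by Au ¬Aw ∘ sym , ≢-by Av ¬Aw ∘ sym ]′ (only-apexes f g u≢v h)
    where
    ¬Aw : A w ≡ false
    ¬Aw = proj₁ (coside⁻ x y z A Bw)

  -- Each corner covers two of the three edges of x y z, so some edge has both u and v as apexes in A.
  two-corners : ∀ {x y z A u v} → Sep x y z A → A u ≡ true → A v ≡ true → u ≢ v →
    Corner u x y z ⊎ Corner u y x z ⊎ Corner u z x y →
    Corner v x y z ⊎ Corner v y x z ⊎ Corner v z x y → ⊥
  two-corners {x} {y} {z} {A} {u} {v} s Au Av u≢v = go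
    where
    xy : Facial u x y → Facial v x y → ⊥
    xy f g = one-apex-inside s Au Av u≢v (Facial-rotate f) (Facial-rotate g)
    yz : Facial u y z → Facial v y z → ⊥
    yz f g = one-apex-inside (Sep-rotate s) Au Av u≢v (Facial-rotate f) (Facial-rotate g)
    xz : Facial u x z → Facial v x z → ⊥
    xz f g = one-apex-inside (Sep-rotate (Sep-rotate s)) Au Av u≢v
               (Facial-rotate (Facial-flip f)) (Facial-rotate (Facial-flip g))
    go : Corner u x y z ⊎ Corner u y x z ⊎ Corner u z x y →
         Corner v x y z ⊎ Corner v y x z ⊎ Corner v z x y → ⊥
    go (1st (f , _))  (1st (g , _))  = xy f g
    go (1st (f , _))  (2nd (g , _))  = xy f (Facial-flip g)
    go (1st (_ , f))  (3rd! (g , _)) = xz f (Facial-flip g)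
    go (2nd (f , _))  (1st (g , _))  = xy (Facial-flip f) g
    go (2nd (f , _))  (2nd (g , _))  = xy (Facial-flip f) (Facial-flip g)
    go (2nd (_ , f))  (3rd! (_ , g)) = yz f (Facial-flip g)
    go (3rd! (f , _)) (1st (_ , g))  = xz (Facial-flip f) g
    go (3rd! (_ , f)) (2nd (_ , g))  = yz (Facial-flip f) g
    go (3rd! (f , _)) (3rd! (g , _)) = xz (Facial-flip f) (Facial-flip g)

  module _ {x y z A} (s : Sep x y z A) (¬deg3 : ∀ {v} → A v ≡ true → ¬ HasDeg3 v) where

    private
      corner-inside : ∀ {v c} → A v ≡ true → A c ≡ true → (∀ {g} → v ~ g → A g ≡ true → g ≡ c) →
        Corner v x y z ⊎ Corner v y x z ⊎ Corner v z x y
      corner-inside Av Ac only = corner (~⇒≢ (x~y s)) (~⇒≢ (y~z s)) (~⇒≢ (x~z s))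
        (≢-by Ac (x∉ s)) (≢-by Ac (y∉ s)) (≢-by Ac (z∉ s))
        (λ g v~g → case closed s Av v~g of λ where
          (inj₁ Ag) → 4th (only v~g Ag)
          (2nd e)   → 1st e
          (3rd e)   → 2nd e
          (4th e)   → 3rd e)
        (¬deg3 Av)

    inner-neighbour : ∀ {v} → A v ≡ true → ∃[ g ] (A g ≡ true × v ~ g)
    inner-neighbour {v} Av with any? (λ g → (A g 𝔹.≟ true) ×-dec (v ~? g))
    ... | yes p = p
    ... | no none = ⊥-elim (¬deg3 Av (x , y , z , λ g v~g → case closed s Av v~g of λ where
            (inj₁ Ag) → ⊥-elim (none (g , Ag , v~g))
            (inj₂ e)  → e))

    private
      -- If `t` is outside `A` as well, `p` and `r` have no inner neighbours except each other. If
      -- `t` is inside, `r` and `t` both have `p` as their only inner neighbour. Either way two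
      -- vertices have degree four at most, and `two-corners` applies to them.
      four-outside : ∀ p q r t → (∀ {g} → A g ≡ true → g ≡ p ⊎ g ≡ q ⊎ g ≡ r ⊎ g ≡ t) →
        ¬ (p ~ q) → ¬ (r ~ t) → r ≢ t → A p ≡ true → A r ≡ true → p ~ r → A q ≡ false → ⊥
      four-outside p q r t among p≁q r≁t r≢t Ap Ar p~r ¬Aq with true⊎false (A t)
      ... | inj₂ ¬At = two-corners s Ap Ar (~⇒≢ p~r)
        (corner-inside Ap Ar λ {g} p~g Ag → case among Ag of λ where
          (1st refl) → ⊥-elim (~⇒≢ p~g refl)
          (2nd refl) → ⊥-elim (p≁q p~g)
          (3rd e)    → e
          (4th refl) → ⊥-elim (false≢true (trans (sym ¬At) Ag)))
        (corner-inside Ar Ap λ {g} r~g Ag → case among Ag of λ where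
          (1st e)    → e
          (2nd refl) → ⊥-elim (false≢true (trans (sym ¬Aq) Ag))
          (3rd refl) → ⊥-elim (~⇒≢ r~g refl)
          (4th refl) → ⊥-elim (false≢true (trans (sym ¬At) Ag)))
      ... | inj₁ At = two-corners s Ar At r≢t
        (corner-inside Ar Ap λ {g} r~g Ag → case among Ag of λ where
          (1st e)    → e
          (2nd refl) → ⊥-elim (false≢true (trans (sym ¬Aq) Ag))
          (3rd refl) → ⊥-elim (~⇒≢ r~g refl)
          (4th refl) → ⊥-elim (r≁t r~g))
        (corner-inside At Ap λ {g} t~g Ag → case among Ag of λ where
          (1st e)    → e
          (2nd refl) → ⊥-elim (false≢true (trans (sym ¬Aq) Ag))
          (3rd refl) → ⊥-elim (r≁t (~-sym t~g))
          (4th refl) → ⊥-elim (~⇒≢ t~g refl))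

    four-inside-absurd : ∀ p q r t → (∀ {g} → A g ≡ true → g ≡ p ⊎ g ≡ q ⊎ g ≡ r ⊎ g ≡ t) →
      ¬ (p ~ q) → ¬ (r ~ t) → p ≢ q → r ≢ t → A p ≡ true → A r ≡ true → p ~ r →
      A q ≡ false ⊎ A t ≡ false → ⊥
    four-inside-absurd p q r t among p≁q r≁t p≢q r≢t Ap Ar p~r (inj₁ ¬Aq) =
      four-outside p q r t among p≁q r≁t r≢t Ap Ar p~r ¬Aq
    four-inside-absurd p q r t among p≁q r≁t p≢q r≢t Ap Ar p~r (inj₂ ¬At) =
      four-outside r t p q (λ Ag → case among Ag of λ where
          (1st e) → 3rd e
          (2nd e) → 4th e
          (3rd e) → 1st e
          (4th e) → 2nd e)
        r≁t p≁q p≢q Ar Ap (~-sym p~r) ¬At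

-- Consequences of irreducibility

module Braced {n} {a : Adj n} (planar : Planar a) (b : Adj n) where

  open PlanarGraph planar
  open Degree3 planar

  data Brace (p q r s : V) : V → V → Set where
    pq : Brace p q r s p q
    qp : Brace p q r s q p
    rs : Brace p q r s r s
    sr : Brace p q r s s r

  record Blocked (p q r s u v : V) : Set where
    constructor blocked
    field
      {apex} : V
      left   : u ~ apex ⊎ Brace p q r s u apex
      right  : v ~ apex ⊎ Brace p q r s v apex
      brace  : Brace p q r s u apex ⊎ Brace p q r s v apex

  -- Two braces pq and rs; when they have a common end, it is q = s.
  record Braces (p q r s : V) : Set where
    field
      p≢q : p ≢ q
      r≢s : r ≢ s
      p≢r : p ≢ r
      p≢s : p ≢ s
      q≢r : q ≢ r
      p≁q : ¬ (p ~ q)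
      r≁s : ¬ (r ~ s)
      joined⇒brace : ∀ {u v} → b u v ≡ true → Brace p q r s u v
      brace⇒joined : ∀ {u v} → Brace p q r s u v → b u v ≡ true
      irreducible  : ∀ {u v} → u ~ v → ¬ Bad u v → Blocked p q r s u v

  map-Blocked : ∀ {p q r s p′ q′ r′ s′ u v} → (∀ {u v} → Brace p q r s u v → Brace p′ q′ r′ s′ u v) →
    Blocked p q r s u v → Blocked p′ q′ r′ s′ u v
  map-Blocked f (blocked l r b) = blocked (Sum.map₂ f l) (Sum.map₂ f r) (Sum.map f f b)

  exchange : ∀ {p q r s} → Braces p q r s → Braces r s p q
  exchange {p} {q} {r} {s} braces = record
    { p≢q = r≢s ; r≢s = p≢q ; p≢r = ≢-sym p≢r ; p≢s = ≢-sym q≢r ; q≢r = ≢-sym p≢s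
    ; p≁q = r≁s ; r≁s = p≁q
    ; joined⇒brace = λ e → to (joined⇒brace e)
    ; brace⇒joined = λ e → brace⇒joined (from e)
    ; irreducible = λ u~v good → map-Blocked to (irreducible u~v good) }
    where
    open Braces braces
    to : ∀ {u v} → Brace p q r s u v → Brace r s p q u v
    to pq = rs
    to qp = sr
    to rs = pq
    to sr = qp
    from : ∀ {u v} → Brace r s p q u v → Brace p q r s u v
    from rs = pq
    from sr = qp
    from pq = rs
    from qp = sr

  reverse : ∀ {p q r s} → q ≢ s → Braces p q r s → Braces q p r s
  reverse {p} {q} {r} {s} q≢s braces = record
    { p≢q = ≢-sym p≢q ; r≢s = r≢s ; p≢r = q≢r ; p≢s = q≢s ; q≢r = p≢r
    ; p≁q = p≁q ∘ ~-sym ; r≁s = r≁s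
    ; joined⇒brace = λ e → to (joined⇒brace e)
    ; brace⇒joined = λ e → brace⇒joined (from e)
    ; irreducible = λ u~v good → map-Blocked to (irreducible u~v good) }
    where
    open Braces braces
    to : ∀ {u v} → Brace p q r s u v → Brace q p r s u v
    to pq = qp
    to qp = pq
    to rs = rs
    to sr = sr
    from : ∀ {u v} → Brace q p r s u v → Brace p q r s u v
    from qp = pq
    from pq = qp
    from rs = rs
    from sr = sr

  module WithBraces {p q r s} (braces : Braces p q r s) where

    open Braces braces public

    Br : V → V → Set
    Br = Brace p q r s

    End : V → Set
    End v = v ≡ p ⊎ v ≡ q ⊎ v ≡ r ⊎ v ≡ s

    End? : ∀ v → Dec (End v)
    End? v = (v ≟ p) ⊎-dec (v ≟ q) ⊎-dec (v ≟ r) ⊎-dec (v ≟ s)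

    Br-sym : ∀ {u v} → Br u v → Br v u
    Br-sym pq = qp
    Br-sym qp = pq
    Br-sym rs = sr
    Br-sym sr = rs

    Br-cases : ∀ {u v} → Br u v →
      (u ≡ p × v ≡ q) ⊎ (u ≡ q × v ≡ p) ⊎ (u ≡ r × v ≡ s) ⊎ (u ≡ s × v ≡ r)
    Br-cases pq = 1st (refl , refl)
    Br-cases qp = 2nd (refl , refl)
    Br-cases rs = 3rd (refl , refl)
    Br-cases sr = 4th (refl , refl)

    Br⇒End : ∀ {u v} → Br u v → End u
    Br⇒End pq = 1st refl
    Br⇒End qp = 2nd refl
    Br⇒End rs = 3rd refl
    Br⇒End sr = 4th refl

    Br⇒≁ : ∀ {u v} → Br u v → ¬ (u ~ v)
    Br⇒≁ pq = p≁q
    Br⇒≁ qp = p≁q ∘ ~-sym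
    Br⇒≁ rs = r≁s
    Br⇒≁ sr = r≁s ∘ ~-sym

    Br⇒≢ : ∀ {u v} → Br u v → u ≢ v
    Br⇒≢ pq = p≢q
    Br⇒≢ qp = ≢-sym p≢q
    Br⇒≢ rs = r≢s
    Br⇒≢ sr = ≢-sym r≢s

    SeesBrace : V → Set
    SeesBrace u = (u ~ p × u ~ q) ⊎ (u ~ r × u ~ s)

    Br⇒SeesBrace : ∀ {u v w} → Br v w → u ~ v → u ~ w → SeesBrace u
    Br⇒SeesBrace pq a b = inj₁ (a , b)
    Br⇒SeesBrace qp a b = inj₁ (b , a)
    Br⇒SeesBrace rs a b = inj₂ (a , b)
    Br⇒SeesBrace sr a b = inj₂ (b , a)

    -- In a 3-cycle that blocks `u v`, the brace cannot meet `u`, so it starts at `v`, and the third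
    -- side is an ordinary edge.
    good-edge : ∀ {u v} → ¬ End u → u ~ v → ¬ Bad u v → ∃[ g ] (Br v g × u ~ g)
    good-edge ¬end u~v good with irreducible u~v good
    ... | blocked {g} (inj₁ u~g) _ (inj₂ b) = g , b , u~g
    ... | blocked (inj₂ b) _ _ = ⊥-elim (¬end (Br⇒End b))
    ... | blocked _ _ (inj₁ b) = ⊥-elim (¬end (Br⇒End b))

    good-neighbour-end : ∀ {u v} → ¬ End u → u ~ v → ¬ Bad u v → End v
    good-neighbour-end ¬end u~v good = Br⇒End (proj₁ (proj₂ (good-edge ¬end u~v good)))

    sees-brace : ∀ {u} → ¬ End u → SeesBrace u
    sees-brace {u} ¬end with has-neighbour {u} {p} (¬end ∘ 1st)
    ... | w , u~w with contractible-somewhere u~w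
    ...   | v , u~v , good with good-edge ¬end u~v good
    ...     | g , b , u~g = Br⇒SeesBrace b u~v u~g

    -- In an innermost side take an edge from the corner `x` to an inner vertex `u`; it is good. If
    -- `u` is no end, a brace joins `x` to a neighbour `g` of `u`, and `g` lies inside because `x`
    -- is adjacent to the other two corners.
    end-inside : ∀ {x y z A} → Sep x y z A → ∃[ e ] (End e × A e ≡ true)
    end-inside s with innermost s
    ... | x , y , z , A , s′ , sub , good with touches s′
    ...   | u , Au , x~u with End? u
    ...     | yes e = u , e , sub Au
    ...     | no ¬e with good-edge ¬e (~-sym x~u) (good Au)
    ...       | g , b , u~g with closed s′ Au u~g
    ...         | inj₁ Ag    = g , Br⇒End (Br-sym b) , sub Ag
    ...         | 2nd refl   = ⊥-elim (Br⇒≢ b refl)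
    ...         | 3rd refl   = ⊥-elim (Br⇒≁ b (x~y s′))
    ...         | 4th refl   = ⊥-elim (Br⇒≁ b (x~z s′))

    private
      both-ends : ∀ {w c d e f} → w ~ c → ¬ (c ~ d) → (∀ {v} → w ~ v → v ≡ c ⊎ v ≡ d ⊎ v ≡ e ⊎ v ≡ f) →
                  w ~ e × w ~ f
      both-ends w~c c≁d among with apexes-among w~c (λ f → case among (Facial-~₃ f) of λ where
        (1st refl) → ⊥-elim (~⇒≢ (Facial-~₂ f) refl)
        (2nd refl) → ⊥-elim (c≁d (Facial-~₂ f))
        (inj₂ (inj₂ i)) → i)
      ... | _ , f , g = Facial-~₃ f , Facial-~₃ g

    -- All neighbours of `w` are ends, and `w` sees both ends of one brace. These are not adjacent,
    -- so the two faces at the edge from `w` to one of them must have the ends of the other brace as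
    -- apexes.
    all-ends : ∀ {w} → ¬ End w → (∀ {v} → w ~ v → ¬ Bad w v) → ∀ {e} → End e → w ~ e
    all-ends {w} ¬end good = λ where
        (1st refl) → proj₁ (proj₁ all)
        (2nd refl) → proj₂ (proj₁ all)
        (3rd refl) → proj₁ (proj₂ all)
        (4th refl) → proj₂ (proj₂ all)
      where
      among : ∀ {v} → w ~ v → End v
      among w~v = good-neighbour-end ¬end w~v (good w~v)
      all : (w ~ p × w ~ q) × (w ~ r × w ~ s)
      all with sees-brace ¬end
      ... | inj₁ (i , j) = (i , j) , both-ends i p≁q among
      ... | inj₂ (i , j) = both-ends i r≁s (λ w~v → case among w~v of λ where
              (1st e) → 3rd e
              (2nd e) → 4th e
              (3rd e) → 1st e
              (4th e) → 2nd e) , (i , j)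

    -- Suppose that an innermost side has no end of degree 3. All its vertices are ends, and some
    -- end lies on the other side. A vertex of the side has an inner neighbour, which belongs to the
    -- other brace, and `four-inside-absurd` applies to this edge.
    deg3-inside : ∀ {x y z A} → Sep x y z A → ∃[ e ] (End e × A e ≡ true × HasDeg3 e)
    deg3-inside s₀ with innermost s₀
    ... | x , y , z , A , σ , sub , good with any? (λ e → End? e ×-dec (A e 𝔹.≟ true) ×-dec HasDeg3? e)
    ...   | yes (e , E , Ae , d) = e , E , sub Ae , d
    ...   | no none = ⊥-elim absurd
      where
      ends : ∀ {w} → A w ≡ true → End w
      ends {w} Aw with End? w
      ... | yes e = e
      ... | no ¬e with end-inside (coside-sep x y z A σ)
      ...   | e , E , Be with coside⁻ x y z A Be
      -- An inner vertex that is no end would be adjacent to every end, in particular to one beyond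
      -- the 3-cycle.
      ...     | ¬Ae , e≢x , e≢y , e≢z with closed σ Aw (all-ends ¬e (λ _ → good Aw) E)
      ...       | inj₁ Ae = ⊥-elim (false≢true (trans (sym ¬Ae) Ae))
      ...       | 2nd i   = ⊥-elim (e≢x i)
      ...       | 3rd i   = ⊥-elim (e≢y i)
      ...       | 4th i   = ⊥-elim (e≢z i)

      ¬deg3 : ∀ {v} → A v ≡ true → ¬ HasDeg3 v
      ¬deg3 Av d = none (_ , ends Av , Av , d)

      missing : ∃[ e ] (End e × A e ≡ false)
      missing with end-inside (coside-sep x y z A σ)
      ... | e , E , Be = e , E , proj₁ (coside⁻ x y z A Be)

      swapˡ : ∀ {c d e f g : V} → g ≡ c ⊎ g ≡ d ⊎ g ≡ e ⊎ g ≡ f → g ≡ d ⊎ g ≡ c ⊎ g ≡ e ⊎ g ≡ f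
      swapˡ (1st i)  = 2nd i
      swapˡ (2nd i)  = 1st i
      swapˡ (3rd! i) = 3rd! i

      swapʳ : ∀ {c d e f g : V} → g ≡ c ⊎ g ≡ d ⊎ g ≡ e ⊎ g ≡ f → g ≡ c ⊎ g ≡ d ⊎ g ≡ f ⊎ g ≡ e
      swapʳ (1st i) = 1st i
      swapʳ (2nd i) = 2nd i
      swapʳ (3rd i) = 4th i
      swapʳ (4th i) = 3rd i

      lost : ∀ {g c d e f} → A g ≡ false → g ≡ c ⊎ g ≡ d ⊎ g ≡ e ⊎ g ≡ f → A c ≡ true → A e ≡ true →
             A d ≡ false ⊎ A f ≡ false
      lost ¬Ag (1st refl) Ac Ae = ⊥-elim (false≢true (trans (sym ¬Ag) Ac))
      lost ¬Ag (2nd refl) Ac Ae = inj₁ ¬Ag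
      lost ¬Ag (3rd refl) Ac Ae = ⊥-elim (false≢true (trans (sym ¬Ag) Ae))
      lost ¬Ag (4th refl) Ac Ae = inj₂ ¬Ag

      four : ∀ c d e f → (∀ {g} → End g → g ≡ c ⊎ g ≡ d ⊎ g ≡ e ⊎ g ≡ f) → ¬ (c ~ d) → ¬ (e ~ f) →
        c ≢ d → e ≢ f → A c ≡ true → A e ≡ true → c ~ e → ⊥
      four c d e f among c≁d e≁f c≢d e≢f Ac Ae c~e with missing
      ... | g , E , ¬Ag = four-inside-absurd σ ¬deg3 c d e f (among ∘ ends) c≁d e≁f c≢d e≢f Ac Ae c~e
                            (lost ¬Ag (among E) Ac Ae)

      across : ∀ {c e} → c ≡ p ⊎ c ≡ q → e ≡ r ⊎ e ≡ s → A c ≡ true → A e ≡ true → c ~ e → ⊥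
      across (inj₁ refl) (inj₁ refl) = four p q r s (λ E → E) p≁q r≁s p≢q r≢s
      across (inj₁ refl) (inj₂ refl) = four p q s r swapʳ p≁q (r≁s ∘ ~-sym) p≢q (≢-sym r≢s)
      across (inj₂ refl) (inj₁ refl) = four q p r s swapˡ (p≁q ∘ ~-sym) r≁s (≢-sym p≢q) r≢s
      across (inj₂ refl) (inj₂ refl) =
        four q p s r (swapˡ ∘ swapʳ) (p≁q ∘ ~-sym) (r≁s ∘ ~-sym) (≢-sym p≢q) (≢-sym r≢s)

      absurd : ⊥
      absurd with inhabited σ
      ... | c , Ac with inner-neighbour σ ¬deg3 Ac
      ...   | e , Ae , c~e with ends Ac | ends Ae
      ...     | 1st i    | 1st j    = ~⇒≢ c~e (trans i (sym j))
      ...     | 2nd i    | 2nd j    = ~⇒≢ c~e (trans i (sym j))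
      ...     | 1st refl | 2nd refl = p≁q c~e
      ...     | 2nd refl | 1st refl = p≁q (~-sym c~e)
      ...     | 3rd i    | 3rd j    = ~⇒≢ c~e (trans i (sym j))
      ...     | 4th i    | 4th j    = ~⇒≢ c~e (trans i (sym j))
      ...     | 3rd refl | 4th refl = r≁s c~e
      ...     | 4th refl | 3rd refl = r≁s (~-sym c~e)
      ...     | 1st i    | 3rd! j   = across (inj₁ i) j Ac Ae c~e
      ...     | 2nd i    | 3rd! j   = across (inj₂ i) j Ac Ae c~e
      ...     | 3rd! i   | 1st j    = across (inj₁ j) i Ae Ac (~-sym c~e)
      ...     | 3rd! i   | 2nd j    = across (inj₂ j) i Ae Ac (~-sym c~e)

-- Labelled graphs and the octahedron

record Labelled {n} (a b : Adj n) (m : ℕ) (P′ B′ : Adj m) : Set where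
  field
    label     : Fin m → Fin n
    injective : ∀ {i j} → label i ≡ label j → i ≡ j
    covers    : ∀ v → ∃[ i ] v ≡ label i
    edges     : ∀ i j → a (label i) (label j) ≡ P′ i j
    braces    : ∀ i j → b (label i) (label j) ≡ B′ i j

upper : ∀ m → List (Fin m × Fin m)
upper m = select (λ { (i , j) → toℕ i <ᵇ toℕ j }) (orderedPairs m)

module _ {m} (P′ : Adj m) where

  Symmetric Irreflexive : Set
  Symmetric   = ∀ i j → P′ i j ≡ P′ j i
  Irreflexive = ∀ i → P′ i i ≡ false

  symmetric? : Dec Symmetric
  symmetric? = all? λ i → all? λ j → P′ i j 𝔹.≟ P′ j i

  irreflexive? : Dec Irreflexive
  irreflexive? = all? λ i → P′ i i 𝔹.≟ false

  -- Distinct vertices of `P′` with equal rows occur only in `D`.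
  Twins : List (Fin m × Fin m) → Set
  Twins D = ∀ i j → i ≡ j ⊎ (∃[ k ] P′ i k ≢ P′ j k) ⊎ (i , j) ∈ D ⊎ (j , i) ∈ D

  twins? : ∀ D → Dec (Twins D)
  twins? D = all? λ i → all? λ j →
    (i ≟ j) ⊎-dec any? (λ k → ¬? (P′ i k 𝔹.≟ P′ j k)) ⊎-dec ((i , j) ∈? D) ⊎-dec ((j , i) ∈? D)
    where open DecMembership (≡-dec (_≟_ {m}) (_≟_ {m})) using (_∈?_)

braceTable : ∀ {m} (ip iq ir is : Fin m) → Adj m
braceTable ip iq ir is i j = does (((i ≟ ip) ×-dec (j ≟ iq)) ⊎-dec ((i ≟ iq) ×-dec (j ≟ ip)) ⊎-dec
                                   ((i ≟ ir) ×-dec (j ≟ is)) ⊎-dec ((i ≟ is) ×-dec (j ≟ ir)))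

IsBraceTable : ∀ {m} (ip iq ir is : Fin m) → Adj m → Set
IsBraceTable ip iq ir is B′ = ∀ i j → braceTable ip iq ir is i j ≡ B′ i j

isBraceTable? : ∀ {m} (ip iq ir is : Fin m) (B′ : Adj m) → Dec (IsBraceTable ip iq ir is B′)
isBraceTable? ip iq ir is B′ = all? λ i → all? λ j → braceTable ip iq ir is i j 𝔹.≟ B′ i j

module Classification {n} {a : Adj n} (planar : Planar a) (b : Adj n) where

  open PlanarGraph planar
  open Degree3 planar
  open Braced planar b

  Outcome : Set
  Outcome = Labelled a b 6 P-I B-I ⊎ Labelled a b 6 P-II B-II ⊎ Labelled a b 6 P-II B-III ⊎
            Labelled a b 7 P-IV B-IV ⊎ Labelled a b 7 P-V B-V

  ¬~⇒≁ : ∀ {u v} → ¬ (u ~ v) → a u v ≡ false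
  ¬~⇒≁ {u} {v} ¬p = [ ⊥-elim ∘ ¬p , (λ e → e) ]′ (true⊎false (a u v))

  private
    a-sym : ∀ u v → a u v ≡ a v u
    a-sym u v with u ~? v
    ... | yes p = trans p (sym (~-sym p))
    ... | no ¬p = trans (¬~⇒≁ ¬p) (sym (¬~⇒≁ (¬p ∘ ~-sym)))

  Table : ∀ {m} → Adj m → Vec V m → Set
  Table {m} P′ vs = All (λ { (i , j) → a (lookup vs i) (lookup vs j) ≡ P′ i j }) (upper m)

  -- Equal labels have equal rows in the adjacency table, so injectivity follows from the table
  -- except for the twins in `D`. The octahedron has its three antipodal pairs as twins; the other
  -- graphs have none.
  label-by : ∀ {m p q r s} {P′ B′ : Adj m} → Braces p q r s → (vs : Vec V m) (ip iq ir is : Fin m) →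
    lookup vs ip ≡ p → lookup vs iq ≡ q → lookup vs ir ≡ r → lookup vs is ≡ s →
    Symmetric P′ → Irreflexive P′ → IsBraceTable ip iq ir is B′ →
    (D : List (Fin m × Fin m)) → Twins P′ D → All (λ { (i , j) → lookup vs i ≢ lookup vs j }) D →
    (∀ v → ∃[ i ] v ≡ lookup vs i) → Table P′ vs → Labelled a b m P′ B′
  label-by {m} {P′ = P′} {B′} braces vs ip iq ir is refl refl refl refl symm irr bt D twins distinct cov table = record
    { label = f ; injective = inj ; covers = cov ; edges = edges ; braces = λ i j → trans (brs i j) (bt i j) }
    where
    open WithBraces braces
    f : Fin m → V
    f = lookup vs
    upper-edge : ∀ i j → toℕ i < toℕ j → a (f i) (f j) ≡ P′ i j
    upper-edge i j lt = All.lookup table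
      (∈-select⁺ (λ { (i , j) → toℕ i <ᵇ toℕ j }) (∈-orderedPairs i j) (<⇒<ᵇ≡true lt))
    edges : ∀ i j → a (f i) (f j) ≡ P′ i j
    edges i j with ℕ.<-cmp (toℕ i) (toℕ j)
    ... | tri< lt _ _ = upper-edge i j lt
    ... | tri> _ _ gt = trans (a-sym (f i) (f j)) (trans (upper-edge j i gt) (symm j i))
    ... | tri≈ _ e _ with toℕ-injective e
    ...   | refl = trans (¬~⇒≁ (λ p → ~⇒≢ p refl)) (sym (irr i))
    inj : ∀ {i j} → f i ≡ f j → i ≡ j
    inj {i} {j} fi≡fj with twins i j
    ... | 1st e = e
    ... | 2nd (k , ne) = ⊥-elim (ne (trans (sym (edges i k)) (trans (cong (λ v → a v (f k)) fi≡fj) (edges j k))))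
    ... | 3rd d = ⊥-elim (All.lookup distinct d fi≡fj)
    ... | 4th d = ⊥-elim (All.lookup distinct d (sym fi≡fj))
    brs : ∀ i j → b (f i) (f j) ≡ braceTable ip iq ir is i j
    brs i j with true⊎false (b (f i) (f j))
    ... | inj₁ e with Br-cases (joined⇒brace e)
    ...   | 1st (k , l) rewrite inj k | inj l = trans e (sym (dec-true
      (((ip ≟ ip) ×-dec (iq ≟ iq)) ⊎-dec ((ip ≟ iq) ×-dec (iq ≟ ip)) ⊎-dec
       ((ip ≟ ir) ×-dec (iq ≟ is)) ⊎-dec ((ip ≟ is) ×-dec (iq ≟ ir))) (1st (refl , refl))))
    ...   | 2nd (k , l) rewrite inj k | inj l = trans e (sym (dec-true
      (((iq ≟ ip) ×-dec (ip ≟ iq)) ⊎-dec ((iq ≟ iq) ×-dec (ip ≟ ip)) ⊎-dec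
       ((iq ≟ ir) ×-dec (ip ≟ is)) ⊎-dec ((iq ≟ is) ×-dec (ip ≟ ir))) (2nd (refl , refl))))
    ...   | 3rd (k , l) rewrite inj k | inj l = trans e (sym (dec-true
      (((ir ≟ ip) ×-dec (is ≟ iq)) ⊎-dec ((ir ≟ iq) ×-dec (is ≟ ip)) ⊎-dec
       ((ir ≟ ir) ×-dec (is ≟ is)) ⊎-dec ((ir ≟ is) ×-dec (is ≟ ir))) (3rd (refl , refl))))
    ...   | 4th (k , l) rewrite inj k | inj l = trans e (sym (dec-true
      (((is ≟ ip) ×-dec (ir ≟ iq)) ⊎-dec ((is ≟ iq) ×-dec (ir ≟ ip)) ⊎-dec
       ((is ≟ ir) ×-dec (ir ≟ is)) ⊎-dec ((is ≟ is) ×-dec (ir ≟ ir))) (4th (refl , refl))))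
    brs i j | inj₂ e = trans e (sym (dec-false
      (((i ≟ ip) ×-dec (j ≟ iq)) ⊎-dec ((i ≟ iq) ×-dec (j ≟ ip)) ⊎-dec
       ((i ≟ ir) ×-dec (j ≟ is)) ⊎-dec ((i ≟ is) ×-dec (j ≟ ir)))
      λ { (1st (refl , refl)) → false≢true (trans (sym e) (brace⇒joined pq))
        ; (2nd (refl , refl)) → false≢true (trans (sym e) (brace⇒joined qp))
        ; (3rd (refl , refl)) → false≢true (trans (sym e) (brace⇒joined rs))
        ; (4th (refl , refl)) → false≢true (trans (sym e) (brace⇒joined sr)) }))

  module NoNonFacial {p q r s} (braces : Braces p q r s) (good : ∀ {u v} → ¬ Bad u v) where

    open WithBraces braces

    private
      outer-neighbour-end : ∀ {u v} → ¬ End u → u ~ v → End v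
      outer-neighbour-end ¬e u~v = good-neighbour-end ¬e u~v good

      ends-adjacent : ∀ {w} → ¬ End w → ∀ {e} → End e → w ~ e
      ends-adjacent ¬e = all-ends ¬e (λ _ → good)

    private
      -- If a neighbour `t` of `p` is an end, it belongs to the brace `r s`. The third vertex of a
      -- face on `p t` is then adjacent to an end of each brace and so cannot be an end itself.
      outer-vertex : ∃[ w ] ¬ End w
      outer-vertex with has-neighbour {p} {q} p≢q
      ... | t , p~t with End? t
      ...   | no ¬e = t , ¬e
      ...   | yes e with apexes p~t
      ...     | u , _ , _ , f , _ = u , λ where
        (1st refl) → ~⇒≢ (Facial-~₃ f) refl
        (2nd refl) → p≁q (Facial-~₃ f)
        (3rd refl) → case e of λ where
          (1st refl) → ~⇒≢ p~t refl
          (2nd refl) → p≁q p~t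
          (3rd refl) → ~⇒≢ (Facial-~₂ f) refl
          (4th refl) → r≁s (~-sym (Facial-~₂ f))
        (4th refl) → case e of λ where
          (1st refl) → ~⇒≢ p~t refl
          (2nd refl) → p≁q p~t
          (3rd refl) → r≁s (Facial-~₂ f)
          (4th refl) → ~⇒≢ (Facial-~₂ f) refl

      link : ∀ {w} → ¬ End w → (Facial w p r × Facial w p s) × (Facial w q r × Facial w q s)
      link ¬e = proj₂ (apexes-among (ends-adjacent ¬e (1st refl)) among-p) ,
                proj₂ (apexes-among (ends-adjacent ¬e (2nd refl)) among-q)
        where
        among-p : ∀ {g} → Facial _ p g → g ≡ r ⊎ g ≡ s
        among-p f with outer-neighbour-end ¬e (Facial-~₃ f)
        ... | 1st refl = ⊥-elim (~⇒≢ (Facial-~₂ f) refl)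
        ... | 2nd refl = ⊥-elim (p≁q (Facial-~₂ f))
        ... | inj₂ (inj₂ e) = e
        among-q : ∀ {g} → Facial _ q g → g ≡ r ⊎ g ≡ s
        among-q f with outer-neighbour-end ¬e (Facial-~₃ f)
        ... | 1st refl = ⊥-elim (p≁q (~-sym (Facial-~₂ f)))
        ... | 2nd refl = ⊥-elim (~⇒≢ (Facial-~₂ f) refl)
        ... | inj₂ (inj₂ e) = e

    octahedron : Labelled a b 6 P-I B-I
    octahedron with outer-vertex
    ... | w , ¬e with link ¬e
    ...   | (pr , ps) , (qr , qs) with apexes (Facial-~₂ pr)
    ...     | t , t′ , t≢t′ , ft , ft′ , _ = build (other (t ≟ w))
      where
      other : Dec (t ≡ w) → ∃[ v ] (v ≢ w × Facial p r v)
      other (yes refl) = t′ , ≢-sym t≢t′ , ft′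
      other (no t≢w)   = t , t≢w , ft
      build : ∃[ v ] (v ≢ w × Facial p r v) → Labelled a b 6 P-I B-I
      build (v , v≢w , fv) = label-by braces (p ∷ r ∷ w ∷ q ∷ s ∷ v ∷ []) 0F 3F 1F 4F refl refl refl refl
        (from-yes (symmetric? P-I)) (from-yes (irreflexive? P-I)) (from-yes (isBraceTable? 0F 3F 1F 4F B-I))
        ((0F , 3F) ∷ (1F , 4F) ∷ (2F , 5F) ∷ []) (from-yes (twins? P-I ((0F , 3F) ∷ (1F , 4F) ∷ (2F , 5F) ∷ [])))
        (p≢q ∷ r≢s ∷ ≢-sym v≢w ∷ [])
        cover
        (Facial-~₂ pr ∷ ~-sym (to-w (1st refl)) ∷ ¬~⇒≁ p≁q ∷ Facial-~₂ ps ∷ ~-sym (to-v (1st refl)) ∷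
         ~-sym (to-w (3rd refl)) ∷ ~-sym (Facial-~₂ qr) ∷ ¬~⇒≁ r≁s ∷ ~-sym (to-v (3rd refl)) ∷
         to-w (2nd refl) ∷ to-w (4th refl) ∷ ¬~⇒≁ (¬ev ∘ outer-neighbour-end ¬e) ∷
         Facial-~₂ qs ∷ ~-sym (to-v (2nd refl)) ∷ ~-sym (to-v (4th refl)) ∷ [])
        where
        ¬ev : ¬ End v
        ¬ev (1st refl) = ~⇒≢ (Facial-~₃ fv) refl
        ¬ev (2nd refl) = p≁q (Facial-~₃ fv)
        ¬ev (3rd refl) = ~⇒≢ (Facial-~₂ fv) refl
        ¬ev (4th refl) = r≁s (Facial-~₂ fv)
        to-w : ∀ {e} → End e → w ~ e
        to-w = ends-adjacent ¬e
        to-v : ∀ {e} → End e → v ~ e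
        to-v = ends-adjacent ¬ev
        cover : ∀ u → ∃[ i ] u ≡ lookup (p ∷ r ∷ w ∷ q ∷ s ∷ v ∷ []) i
        cover u with End? u
        ... | yes (1st e) = 0F , e
        ... | yes (2nd e) = 3F , e
        ... | yes (3rd e) = 1F , e
        ... | yes (4th e) = 4F , e
        -- Every vertex that is no end is an apex of the edge `p r`, so there are only the two
        -- apexes `w` and `v`.
        ... | no ¬eu with only-apexes (Facial-rotate pr) fv (≢-sym v≢w) (Facial-rotate (proj₁ (proj₁ (link ¬eu))))
        ...   | inj₁ e = 2F , e
        ...   | inj₂ e = 5F , e

-- Separating 3-cycles with braces

module Cases {n} {a : Adj n} (planar : Planar a) (b : Adj n) where

  open PlanarGraph planar
  open Degree3 planar
  open Braced planar b
  open Classification planar b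

  other-apex : ∀ {u v g} → Facial u v g → ∃[ h ] (h ≢ g × Facial u v h)
  other-apex {g = g} f with apexes (Facial-~ f)
  ... | w , w′ , w≢w′ , fw , fw′ , _ with w ≟ g
  ...   | yes refl = w′ , ≢-sym w≢w′ , fw′
  ...   | no w≢g   = w , w≢g , fw

  private
    leave : ∀ (v : V) {u g} {In : V → Set} → (In? : ∀ w → Dec (In w)) → v ~ u → v ~ g → In u → ¬ In g →
            ∃[ c ] ∃[ d ] (Facial v c d × In c × ¬ In d)
    leave v In? v~u v~g Iu ¬Ig with link-connected v (λ w → does (In? w)) v v~u v~g
      (≢-sym (~⇒≢ v~u)) (≢-sym (~⇒≢ v~g)) (dec-true (In? _) Iu) (dec-false (In? _) ¬Ig)
    ... | c , d , f , Ic , ¬Id , _ = c , d , f , does⇒ (In? c) Ic , ¬does⇒ (In? d) ¬Id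

  -- Each of `c`, `d`, `e` already has both its neighbours in the link of `v`, and the link is
  -- connected.
  link-triangle : ∀ {v c d e} → c ≢ d → d ≢ e → c ≢ e →
    Facial v c d → Facial v d e → Facial v e c → Deg3 v c d e
  link-triangle {v} {c} {d} {e} c≢d d≢e c≢e cd de ec g v~g with In? g
    where
    In? : ∀ g → Dec (g ≡ c ⊎ g ≡ d ⊎ g ≡ e)
    In? g = (g ≟ c) ⊎-dec (g ≟ d) ⊎-dec (g ≟ e)
  ... | yes i = i
  ... | no ¬i with leave v (λ g → (g ≟ c) ⊎-dec (g ≟ d) ⊎-dec (g ≟ e)) (Facial-~ cd) v~g (1st refl) ¬i
  ...   | _ , h , f , 1st refl , ¬h = ⊥-elim (¬h ([ 2nd , 3rd! ]′ (only-apexes cd (Facial-flip ec) d≢e f)))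
  ...   | _ , h , f , 2nd refl , ¬h = ⊥-elim (¬h ([ 1st , 3rd! ]′ (only-apexes (Facial-flip cd) de c≢e f)))
  ...   | _ , h , f , 3rd! refl , ¬h = ⊥-elim (¬h ([ 1st , 2nd ]′ (only-apexes ec (Facial-flip de) c≢d f)))

  link-square : ∀ {v c d e g} → c ≢ e → d ≢ g →
    Facial v c d → Facial v d e → Facial v e g → Facial v g c →
    ∀ {h} → v ~ h → h ≡ c ⊎ h ≡ d ⊎ h ≡ e ⊎ h ≡ g
  link-square {v} {c} {d} {e} {g} c≢e d≢g cd de eg gc {h} v~h with In? h
    where
    In? : ∀ h → Dec (h ≡ c ⊎ h ≡ d ⊎ h ≡ e ⊎ h ≡ g)
    In? h = (h ≟ c) ⊎-dec (h ≟ d) ⊎-dec (h ≟ e) ⊎-dec (h ≟ g)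
  ... | yes i = i
  ... | no ¬i with leave v (λ h → (h ≟ c) ⊎-dec (h ≟ d) ⊎-dec (h ≟ e) ⊎-dec (h ≟ g)) (Facial-~ cd) v~h (1st refl) ¬i
  ...   | _ , _ , f , 1st refl , ¬k = ⊥-elim (¬k ([ 2nd , 4th ]′ (only-apexes cd (Facial-flip gc) d≢g f)))
  ...   | _ , _ , f , 2nd refl , ¬k = ⊥-elim (¬k ([ 1st , 3rd ]′ (only-apexes (Facial-flip cd) de c≢e f)))
  ...   | _ , _ , f , 3rd refl , ¬k = ⊥-elim (¬k ([ 2nd , 4th ]′ (only-apexes (Facial-flip de) eg d≢g f)))
  ...   | _ , _ , f , 4th refl , ¬k = ⊥-elim (¬k ([ 3rd , 1st ]′ (only-apexes (Facial-flip eg) gc (≢-sym c≢e) f)))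

  at-most-three : ∀ {v c d e xs} → Deg3 v c d e → Unique xs → All (v ~_) xs → length xs ≤ 3
  at-most-three {v} {c} {d} {e} deg3 u adj =
    unique⊆⇒length≤ {ys = c ∷ d ∷ e ∷ []} u λ x∈ → case deg3 _ (All.lookup adj x∈) of λ where
      (1st i)  → here i
      (2nd i)  → there (here i)
      (3rd! i) → there (there (here i))

  module Deg3Facts {v x y z u} (d : Deg3 v x y z) (v≢u : v ≢ u) where

    v~x : v ~ x
    v~x = proj₁ (Deg3-adjacent d v≢u)
    v~y : v ~ y
    v~y = proj₁ (proj₂ (Deg3-adjacent d v≢u))
    v~z : v ~ z
    v~z = proj₂ (proj₂ (Deg3-adjacent d v≢u))
    vxy : Facial v x y
    vxy = proj₁ (Deg3-facial d v≢u)
    vxz : Facial v x z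
    vxz = proj₁ (proj₂ (Deg3-facial d v≢u))
    vyz : Facial v y z
    vyz = proj₂ (proj₂ (Deg3-facial d v≢u))

    clique : ∀ {g h} → v ~ g → v ~ h → g ≢ h → g ~ h
    clique v~g v~h g≢h with d _ v~g | d _ v~h
    ... | 1st i     | 1st j     = ⊥-elim (g≢h (trans i (sym j)))
    ... | 2nd i     | 2nd j     = ⊥-elim (g≢h (trans i (sym j)))
    ... | 3rd! i    | 3rd! j    = ⊥-elim (g≢h (trans i (sym j)))
    ... | 1st refl  | 2nd refl  = Facial-~₂ vxy
    ... | 2nd refl  | 1st refl  = ~-sym (Facial-~₂ vxy)
    ... | 1st refl  | 3rd! refl = Facial-~₂ vxz
    ... | 3rd! refl | 1st refl  = ~-sym (Facial-~₂ vxz)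
    ... | 2nd refl  | 3rd! refl = Facial-~₂ vyz
    ... | 3rd! refl | 2nd refl  = ~-sym (Facial-~₂ vyz)

    Deg3-transfer : ∀ {w} → HasDeg3 w → w ~ x → w ~ y → w ~ z → Deg3 w x y z
    Deg3-transfer {w} (_ , _ , _ , d′) w~x w~y w~z g w~g with g ≟ x | g ≟ y | g ≟ z
    ... | yes i | _     | _     = 1st i
    ... | no _  | yes i | _     = 2nd i
    ... | no _  | no _  | yes i = 3rd! i
    ... | no g≢x | no g≢y | no g≢z with at-most-three d′
      ((g≢x ∷ g≢y ∷ g≢z ∷ []) ∷ (~⇒≢ (Facial-~₂ vxy) ∷ ~⇒≢ (Facial-~₂ vxz) ∷ []) ∷ (~⇒≢ (Facial-~₂ vyz) ∷ []) ∷ [] ∷ [])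
      (w~g ∷ w~x ∷ w~y ∷ w~z ∷ [])
    ...   | s≤s (s≤s (s≤s ()))

  -- The faces at `p` and `q` close up the link of each of `x`, `y`, `z` to a 4-cycle through `p`
  -- and `q`. The five vertices are thus closed under adjacency.
  bipyramid : ∀ {p q x y z} → p ≢ q → Deg3 p x y z → Deg3 q x y z →
    ∀ v → v ≡ p ⊎ v ≡ q ⊎ p ~ v
  bipyramid {p} {q} {x} {y} {z} p≢q dp dq = everywhere (λ v → v ≡ p ⊎ v ≡ q ⊎ p ~ v) closed′ (1st refl)
    where
    module p = Deg3Facts dp p≢q
    module q = Deg3Facts dq (≢-sym p≢q)
    back : ∀ {v} → v ≡ x ⊎ v ≡ y ⊎ v ≡ z → v ≡ p ⊎ v ≡ q ⊎ p ~ v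
    back (1st refl)  = 3rd! p.v~x
    back (2nd refl)  = 3rd! p.v~y
    back (3rd! refl) = 3rd! p.v~z
    from : ∀ {c d v} → p ~ c → p ~ d → v ≡ p ⊎ v ≡ c ⊎ v ≡ q ⊎ v ≡ d → v ≡ p ⊎ v ≡ q ⊎ p ~ v
    from _   _   (1st i)    = 1st i
    from p~c _   (2nd refl) = 3rd! p~c
    from _   _   (3rd i)    = 2nd i
    from _   p~d (4th refl) = 3rd! p~d
    closed′ : ∀ {u v} → u ≡ p ⊎ u ≡ q ⊎ p ~ u → u ~ v → v ≡ p ⊎ v ≡ q ⊎ p ~ v
    closed′ (1st refl) u~v = 3rd! u~v
    closed′ (2nd refl) u~v = back (dq _ u~v)
    closed′ (3rd! p~u) u~v with dp _ p~u
    ... | 1st refl = from p.v~y p.v~z (link-square p≢q (~⇒≢ (Facial-~₂ p.vyz))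
      (Facial-swap p.vxy) (Facial-rotate q.vxy) (Facial-swap q.vxz) (Facial-rotate p.vxz) u~v)
    ... | 2nd refl = from p.v~x p.v~z (link-square p≢q (~⇒≢ (Facial-~₂ p.vxz))
      (Facial-rotate (Facial-rotate p.vxy)) (Facial-flip (Facial-rotate (Facial-rotate q.vxy))) (Facial-swap q.vyz) (Facial-rotate p.vyz) u~v)
    ... | 3rd! refl = from p.v~x p.v~y (link-square p≢q (~⇒≢ (Facial-~₂ p.vxy))
      (Facial-rotate (Facial-rotate p.vxz)) (Facial-flip (Facial-rotate (Facial-rotate q.vxz)))
      (Facial-rotate (Facial-rotate q.vyz)) (Facial-flip (Facial-rotate (Facial-rotate p.vyz))) u~v)

  module _ {p q r s} (braces : Braces p q r s) where

    open WithBraces braces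

    -- The edge `p g` is good. A blocking brace at `p` is `p q` and makes `g` adjacent to `q`; a
    -- blocking brace at `g` would be `r s` with both ends adjacent to `p`, although the neighbours
    -- of `p` form a clique. The excluded case is a 3-cycle containing both braces.
    partner-sees : ∀ {x y z} → Deg3 p x y z → ¬ (p ~ r × q ≡ s) → ∀ {g} → p ~ g → q ~ g
    partner-sees d ¬shared {g} p~g with irreducible p~g (Deg3-good d p≢q p~g)
    ... | blocked left right (inj₁ ph) with Br-cases ph
    ...   | 2nd (i , _) = ⊥-elim (p≢q i)
    ...   | 3rd (i , _) = ⊥-elim (p≢r i)
    ...   | 4th (i , _) = ⊥-elim (p≢s i)
    ...   | 1st (_ , refl) with right
    ...     | inj₁ g~q = ~-sym g~q
    ...     | inj₂ gq with Br-cases gq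
    ...       | 1st (i , _)    = ⊥-elim (~⇒≢ p~g (sym i))
    ...       | 2nd (_ , i)    = ⊥-elim (p≢q (sym i))
    ...       | 3rd (refl , i) = ⊥-elim (¬shared (p~g , i))
    ...       | 4th (_ , i)    = ⊥-elim (q≢r i)
    partner-sees d ¬shared {g} p~g | blocked left right (inj₂ gh) with Br-cases gh
    ...   | 1st (i , _)    = ⊥-elim (~⇒≢ p~g (sym i))
    ...   | 2nd (refl , _) = ⊥-elim (p≁q p~g)
    ...   | 3rd (refl , refl) with left
    ...     | inj₁ p~s = ⊥-elim (r≁s (Deg3Facts.clique d p≢q p~g p~s r≢s))
    ...     | inj₂ ps with Br-cases ps
    ...       | 1st (_ , i) = ⊥-elim (¬shared (p~g , sym i))
    ...       | 2nd (i , _) = ⊥-elim (p≢q i)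
    ...       | 3rd (i , _) = ⊥-elim (p≢r i)
    ...       | 4th (i , _) = ⊥-elim (p≢s i)
    partner-sees d ¬shared {g} p~g | blocked left right (inj₂ gh) | 4th (refl , refl) with left
    ...     | inj₁ p~r = ⊥-elim (r≁s (~-sym (Deg3Facts.clique d p≢q p~g p~r (≢-sym r≢s))))
    ...     | inj₂ pr with Br-cases pr
    ...       | 1st (_ , i) = ⊥-elim (q≢r (sym i))
    ...       | 2nd (i , _) = ⊥-elim (p≢q i)
    ...       | 3rd (i , _) = ⊥-elim (p≢r i)
    ...       | 4th (i , _) = ⊥-elim (p≢s i)

    -- Then `q` has the neighbours of `p`, and the graph is a bipyramid. Hence `r` and `s` are
    -- neighbours of `p`, and these form a clique.
    both-deg3-absurd : q ≢ s → HasDeg3 p → HasDeg3 q → ⊥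
    both-deg3-absurd q≢s (x , y , z , d) hq = r≁s (clique (sees r (≢-sym p≢r) (≢-sym q≢r)) (sees s (≢-sym p≢s) (≢-sym q≢s)) r≢s)
      where
      open Deg3Facts d p≢q
      q~ : ∀ {g} → p ~ g → q ~ g
      q~ = partner-sees d (q≢s ∘ proj₂)
      sees : ∀ v → v ≢ p → v ≢ q → p ~ v
      sees v v≢p v≢q with bipyramid p≢q d (Deg3-transfer hq (q~ v~x) (q~ v~y) (q~ v~z)) v
      ... | 1st i    = ⊥-elim (v≢p i)
      ... | 2nd i    = ⊥-elim (v≢q i)
      ... | 3rd! p~v = p~v

  module CommonEndDeg3 {p q r} (braces : Braces p q r q) (hp : HasDeg3 p) where

    open WithBraces braces

    private
      q≁r : ¬ (q ~ r)
      q≁r = r≁s ∘ ~-sym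

      -- Both braces end at `q`, so whichever brace an outer vertex sees, it is adjacent to `q`.
      -- With `q` of degree 3 this leaves at most six vertices.
      place : ∀ v → v ≡ p ⊎ v ≡ q ⊎ v ≡ r ⊎ q ~ v
      place v with End? v
      ... | yes (1st i) = 1st i
      ... | yes (2nd i) = 2nd i
      ... | yes (3rd i) = 3rd i
      ... | yes (4th i) = 2nd i
      ... | no ¬e with sees-brace ¬e
      ...   | inj₁ (_ , v~q) = 4th (~-sym v~q)
      ...   | inj₂ (_ , v~q) = 4th (~-sym v~q)

      core : ∀ {x y z} → Deg3 q x y z → ¬ (p ~ z) → Labelled a b 6 P-II B-III
      core {x} {y} {z} dq p≁z = label-by braces (z ∷ q ∷ x ∷ r ∷ y ∷ p ∷ []) 5F 1F 3F 1F refl refl refl refl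
        (from-yes (symmetric? P-II)) (from-yes (irreflexive? P-II)) (from-yes (isBraceTable? 5F 1F 3F 1F B-III))
        [] (from-yes (twins? P-II [])) [] cover
        (~-sym q.v~z ∷ ~-sym (Facial-~₂ q.vxz) ∷ ~-sym r~z ∷ ~-sym (Facial-~₂ q.vyz) ∷ ¬~⇒≁ (p≁z ∘ ~-sym) ∷
         q.v~x ∷ ¬~⇒≁ q≁r ∷ q.v~y ∷ ¬~⇒≁ (p≁q ∘ ~-sym) ∷
         ~-sym (Facial-~₂ p.vxy) ∷ Facial-~₂ q.vxy ∷ ~-sym p.v~y ∷
         Facial-~₂ p.vxz ∷ ~-sym p.v~x ∷ ~-sym p.v~z ∷ [])
        where
        module q = Deg3Facts dq (≢-sym p≢q)
        dp : Deg3 p r x y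
        dp g p~g with place g
        ... | 1st refl = ⊥-elim (~⇒≢ p~g refl)
        ... | 2nd refl = ⊥-elim (p≁q p~g)
        ... | 3rd i    = 1st i
        ... | 4th q~g with dq g q~g
        ...   | 1st i     = 2nd i
        ...   | 2nd i     = 3rd! i
        ...   | 3rd! refl = ⊥-elim (p≁z p~g)
        module p = Deg3Facts dp p≢q
        r~z : r ~ z
        -- The face on `x z` opposite to `q` must have `r` as its apex. The apex `p` is excluded by
        -- `p≁z`; the apex `y` would put a third face on the edge `x y`, which has faces with `q`
        -- and `p`.
        r~z with other-apex (Facial-rotate q.vxz)
        ... | g , g≢q , f with place g
        ...   | 1st refl = ⊥-elim (p≁z (~-sym (Facial-~₂ f)))
        ...   | 2nd i    = ⊥-elim (g≢q i)
        ...   | 3rd refl = ~-sym (Facial-~₂ f)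
        ...   | 4th q~g with dq g q~g
        ...     | 1st refl  = ⊥-elim (~⇒≢ (Facial-~₃ f) refl)
        ...     | 3rd! refl = ⊥-elim (~⇒≢ (Facial-~₂ f) refl)
        ...     | 2nd refl with only-apexes (Facial-rotate q.vxy) (Facial-rotate p.vyz) (≢-sym p≢q) (Facial-flip f)
        ...       | inj₁ refl = ⊥-elim (~⇒≢ q.v~z refl)
        ...       | inj₂ refl = ⊥-elim (p≁q (~-sym q.v~z))
        cover : ∀ v → ∃[ i ] v ≡ lookup (z ∷ q ∷ x ∷ r ∷ y ∷ p ∷ []) i
        cover v with place v
        ... | 1st i = 5F , i
        ... | 2nd i = 1F , i
        ... | 3rd i = 3F , i
        ... | 4th q~v with dq v q~v
        ...   | 1st i  = 2F , i
        ...   | 2nd i  = 4F , i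
        ...   | 3rd! i = 0F , i

    labelled : HasDeg3 q → Labelled a b 6 P-II B-III
    labelled (x , y , z , dq) with p ~? x | p ~? y | p ~? z
    ... | _ | _ | no p≁z = core dq p≁z
    ... | no p≁x | _ | _ = core (Deg3-rotate dq) p≁x
    ... | _ | no p≁y | _ = core (Deg3-rotate (Deg3-rotate dq)) p≁y
    ... | yes p~x | yes p~y | yes p~z = ⊥-elim (absurd (bipyramid (≢-sym p≢q) dq dp r))
      where
      dp : Deg3 p x y z
      dp = Deg3Facts.Deg3-transfer dq (≢-sym p≢q) hp p~x p~y p~z
      absurd : ¬ (r ≡ q ⊎ r ≡ p ⊎ q ~ r)
      absurd (1st i)  = q≢r (sym i)
      absurd (2nd i)  = p≢r (sym i)
      absurd (3rd! i) = q≁r i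

  -- Of the three triangles on q and two neighbours of p, only q x y is not facial.
  record Cap (p q x y z : V) : Set where
    field
      deg3      : Deg3 p x y z
      px       : p ~ x
      py       : p ~ y
      pz       : p ~ z
      qx       : q ~ x
      qy       : q ~ y
      qz       : q ~ z
      xy       : x ~ y
      xz       : x ~ z
      yz       : y ~ z
      nonfacial : ¬ Facial q x y
      around    : ∀ {g} → z ~ g → g ≡ p ⊎ g ≡ q ⊎ g ≡ x ⊎ g ≡ y

  Cap-swap : ∀ {p q x y z} → Cap p q x y z → Cap p q y x z
  Cap-swap c = record
    { deg3 = Deg3-swap deg3 ; px = py ; py = px ; pz = pz ; qx = qy ; qy = qx ; qz = qz
    ; xy = ~-sym xy ; xz = yz ; yz = xz ; nonfacial = nonfacial ∘ Facial-flip
    ; around = λ e → case around e of λ where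
        (1st i) → 1st i
        (2nd i) → 2nd i
        (3rd i) → 4th i
        (4th i) → 3rd i }
    where open Cap c

  -- Two non-adjacent ends of degree 3

  module Main {p q r s} (braces : Braces p q r s) (p≁r : ¬ (p ~ r))
              (¬deg3-q : ¬ HasDeg3 q) (¬deg3-s : ¬ HasDeg3 s) where

    open WithBraces braces

    private
      p-or-r : ∀ {x y z A} → Sep x y z A → A p ≡ true ⊎ A r ≡ true
      p-or-r s with deg3-inside s
      ... | _ , 1st refl , Ae , _ = inj₁ Ae
      ... | _ , 3rd refl , Ae , _ = inj₂ Ae
      ... | _ , 2nd refl , _  , d = ⊥-elim (¬deg3-q d)
      ... | _ , 4th refl , _  , d = ⊥-elim (¬deg3-s d)

    -- Each side contains `p` or `r`, so every separating 3-cycle has them on opposite sides. The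
    -- side returned is the one of `r`.
    far-side : ∀ {x y z A} → Sep x y z A →
      ∃[ A′ ] (Sep x y z A′ × A′ r ≡ true × A′ p ≡ false × p ≢ x × p ≢ y × p ≢ z)
    far-side {x} {y} {z} {A} σ with p-or-r σ | p-or-r (coside-sep x y z A σ)
    ... | inj₁ Ap | inj₂ Br = coside x y z A , coside-sep x y z A σ , Br , coside-false x y z A Ap ,
                              ≢-by Ap (x∉ σ) , ≢-by Ap (y∉ σ) , ≢-by Ap (z∉ σ)
    ... | inj₂ Ar | inj₁ Bp = A , σ , Ar , coside⁻ x y z A Bp
    ... | inj₁ Ap | inj₁ Bp = ⊥-elim (false≢true (trans (sym (proj₁ (coside⁻ x y z A Bp))) Ap))
    ... | inj₂ Ar | inj₂ Br = ⊥-elim (false≢true (trans (sym (proj₁ (coside⁻ x y z A Br))) Ar))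

    avoids : ∀ {x y z w A} → Sep x y z A → A p ≡ false → p ≢ x → p ≢ y → p ≢ z → p ~ w → A w ≡ false
    avoids {w = w} {A} σ ¬Ap p≢x p≢y p≢z p~w with true⊎false (A w)
    ... | inj₂ ¬Aw = ¬Aw
    ... | inj₁ Aw with closed σ Aw (~-sym p~w)
    ...   | 1st Ap = ⊥-elim (false≢true (trans (sym ¬Ap) Ap))
    ...   | 2nd i  = ⊥-elim (p≢x i)
    ...   | 3rd i  = ⊥-elim (p≢y i)
    ...   | 4th i  = ⊥-elim (p≢z i)

    private
      -- Both triangles separate `p` from `r`. As neighbours of `p`, neither `y` nor `x` lies on the
      -- side of `r` of the triangle that does not contain it. So only the edge `q z` bounds the
      -- intersection of the two sides of `r`, contrary to `no-edge-cut`.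
      two-nonfacial-absurd : ∀ {x y z} → p ~ x → p ~ y → x ~ y → x ~ z → y ~ z → q ~ x → q ~ y → q ~ z →
        ¬ Facial q x z → ¬ Facial q y z → ⊥
      two-nonfacial-absurd {x} {y} {z} p~x p~y x~y x~z y~z q~x q~y q~z ¬f ¬g
        with far-side (proj₂ (jordan q~x x~z q~z ¬f)) | far-side (proj₂ (jordan q~y y~z q~z ¬g))
      ... | A , σ , Ar , ¬Ap , p≢q , p≢x , p≢z | A′ , σ′ , A′r , ¬A′p , _ , p≢y , _ =
        no-edge-cut C q~z (C-off (x∉ σ)) (C-off (z∉ σ)) (C-on Ar A′r) (C-off ¬Ap) p≢q p≢z cl
        where
        C : V → Bool
        C v = A v ∧ A′ v
        C-off : ∀ {v} → A v ≡ false → C v ≡ false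
        C-off e rewrite e = refl
        C-on : ∀ {v} → A v ≡ true → A′ v ≡ true → C v ≡ true
        C-on e e′ rewrite e | e′ = refl
        C⁻ : ∀ v → C v ≡ true → A v ≡ true × A′ v ≡ true
        C⁻ v e with A v | A′ v
        ... | true | true = refl , refl
        ¬Ay : A y ≡ false
        ¬Ay = avoids σ ¬Ap p≢q p≢x p≢z p~y
        ¬A′x : A′ x ≡ false
        ¬A′x = avoids σ′ ¬A′p p≢q p≢y p≢z p~x
        cl : ∀ {u v} → C u ≡ true → u ~ v → C v ≡ true ⊎ v ≡ q ⊎ v ≡ z
        cl {u} Cu u~v with closed σ (proj₁ (C⁻ u Cu)) u~v | closed σ′ (proj₂ (C⁻ u Cu)) u~v
        ... | 2nd i    | _        = 2nd i
        ... | 4th i    | _        = 3rd! i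
        ... | _        | 2nd i    = 2nd i
        ... | _        | 4th i    = 3rd! i
        ... | 1st Av   | 1st A′v  = 1st (C-on Av A′v)
        ... | 1st Av   | 3rd refl = ⊥-elim (false≢true (trans (sym ¬Ay) Av))
        ... | 3rd refl | 1st A′v  = ⊥-elim (false≢true (trans (sym ¬A′x) A′v))
        ... | 3rd refl | 3rd refl = ⊥-elim (~⇒≢ x~y refl)

      cap-from : ∀ {x y z} → Deg3 p x y z → ¬ Facial q x y → Facial q x z → Facial q y z → Cap p q x y z
      cap-from d ¬f xz yz = record
        { deg3 = d ; px = v~x ; py = v~y ; pz = v~z
        ; qx = Facial-~ xz ; qy = Facial-~ yz ; qz = Facial-~₃ xz
        ; xy = Facial-~₂ vxy ; xz = Facial-~₂ vxz ; yz = Facial-~₂ vyz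
        ; nonfacial = ¬f
        ; around = λ e → case link-square p≢q (~⇒≢ (Facial-~₂ vxy))
            (Facial-rotate (Facial-rotate vxz)) (Facial-flip (Facial-rotate (Facial-rotate xz)))
            (Facial-rotate (Facial-rotate yz)) (Facial-flip (Facial-rotate (Facial-rotate vyz))) e of λ where
              (1st i) → 1st i
              (2nd i) → 3rd i
              (3rd i) → 2nd i
              (4th i) → 4th i }
        where open Deg3Facts d p≢q

    -- Two non-facial triangles are impossible by `two-nonfacial-absurd`; with none, the link of `q`
    -- would be `x y z` and `q` would have degree 3.
    cap : HasDeg3 p → ∃[ x ] ∃[ y ] ∃[ z ] Cap p q x y z
    cap (x , y , z , d) = go (Facial? qx y) (Facial? qx z) (Facial? qy z)
      where
      open Deg3Facts d p≢q
      q~ : ∀ {g} → p ~ g → q ~ g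
      q~ = partner-sees braces d (p≁r ∘ proj₁)
      qx : q ~ x
      qx = q~ v~x
      qy : q ~ y
      qy = q~ v~y
      qz : q ~ z
      qz = q~ v~z
      xy : x ~ y
      xy = Facial-~₂ vxy
      xz : x ~ z
      xz = Facial-~₂ vxz
      yz : y ~ z
      yz = Facial-~₂ vyz
      go : Dec (Facial q x y) → Dec (Facial q x z) → Dec (Facial q y z) → ∃[ x ] ∃[ y ] ∃[ z ] Cap p q x y z
      go (no f) (yes g) (yes h) = x , y , z , cap-from d f g h
      go (yes f) (no g) (yes h) = x , z , y ,
        cap-from (Deg3-rotate (Deg3-swap d)) g f (Facial-flip h)
      go (yes f) (yes g) (no h) = y , z , x , cap-from (Deg3-rotate d) h (Facial-flip f) (Facial-flip g)
      go (yes f) (yes g) (yes h) = ⊥-elim (¬deg3-q (x , y , z ,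
        link-triangle (~⇒≢ xy) (~⇒≢ yz) (~⇒≢ xz) f h (Facial-flip g)))
      go _ (no g) (no h) = ⊥-elim (two-nonfacial-absurd v~x v~y xy xz yz qx qy qz g h)
      go (no f) (no g) _ = ⊥-elim (two-nonfacial-absurd v~y v~z yz (~-sym xy) (~-sym xz) qy qz qx
                                     (f ∘ Facial-flip) (g ∘ Facial-flip))
      go (no f) _ (no h) = ⊥-elim (two-nonfacial-absurd v~x v~z xz xy (~-sym yz) qx qz qy
                                     f (h ∘ Facial-flip))

    -- The triangle `q x y` separates, and `x` has a good edge into the side of `r`. If `x` is no
    -- end, that edge needs a blocking brace at its inner end; `p` and `q` are not on that side, so
    -- the brace is `r s`, and `x` is a neighbour of `r`.
    shared-corner : ∀ {x y z x′ y′ z′} → Cap p q x y z → Cap r s x′ y′ z′ → x ≡ x′ ⊎ x ≡ y′ ⊎ x ≡ s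
    shared-corner {x} {y} {z} {x′} {y′} {z′} c c′ with End? x
    ... | yes (1st refl) = ⊥-elim (~⇒≢ (Cap.px c) refl)
    ... | yes (2nd refl) = ⊥-elim (~⇒≢ (Cap.qx c) refl)
    ... | yes (3rd refl) = ⊥-elim (p≁r (Cap.px c))
    ... | yes (4th i)    = 3rd! i
    ... | no ¬e with far-side (proj₂ (jordan (Cap.qx c) (Cap.xy c) (Cap.qy c) (Cap.nonfacial c)))
    ...   | A , σ , Ar , ¬Ap , _ with contractible-inside (Sep-swap σ)
    ...     | u , Au , x~u , good with good-edge ¬e x~u good
    ...       | g , br , x~g = near (x~r (Br-cases br))
      where
      x~r : (u ≡ p × g ≡ q) ⊎ (u ≡ q × g ≡ p) ⊎ (u ≡ r × g ≡ s) ⊎ (u ≡ s × g ≡ r) → x ~ r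
      x~r (1st (refl , _)) = ⊥-elim (false≢true (trans (sym ¬Ap) Au))
      x~r (2nd (refl , _)) = ⊥-elim (false≢true (trans (sym (x∉ σ)) Au))
      x~r (3rd (refl , _)) = x~u
      x~r (4th (_ , refl)) = x~g
      near : x ~ r → x ≡ x′ ⊎ x ≡ y′ ⊎ x ≡ s
      near e with Cap.deg3 c′ x (~-sym e)
      ... | 1st i = 1st i
      ... | 2nd i = 2nd i
      -- All neighbours of `z′` are among `r`, `s`, `x′`, `y′`, and `p` is none of these.
      ... | 3rd! refl with Cap.around c′ (~-sym (Cap.px c))
      ...   | 1st i    = ⊥-elim (p≢r i)
      ...   | 2nd i    = ⊥-elim (p≢s i)
      ...   | 3rd refl = ⊥-elim (p≁r (~-sym (Cap.px c′)))
      ...   | 4th refl = ⊥-elim (p≁r (~-sym (Cap.py c′)))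

    place : ∀ {x y z x′ y′ z′} → Cap p q x y z → Cap r s x′ y′ z′ → ∀ v →
      End v ⊎ (v ≡ x ⊎ v ≡ y ⊎ v ≡ z) ⊎ (v ≡ x′ ⊎ v ≡ y′ ⊎ v ≡ z′)
    place c c′ v with End? v
    ... | yes e = inj₁ e
    ... | no ¬e with sees-brace ¬e
    ...   | inj₁ (v~p , _) = inj₂ (inj₁ (Cap.deg3 c v (~-sym v~p)))
    ...   | inj₂ (v~r , _) = inj₂ (inj₂ (Cap.deg3 c′ v (~-sym v~r)))

-- The possible overlaps of the two neighbourhoods

module Final {n} {a : Adj n} (planar : Planar a) (b : Adj n) where

  open PlanarGraph planar
  open Degree3 planar
  open Braced planar b
  open Classification planar b
  open Cases planar b

  cap-end-≁ : ∀ {p q r x y z} → q ≢ r → p ≢ r → ¬ (p ~ r) → Cap p q x y z → ¬ (z ~ r)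
  cap-end-≁ q≢r p≢r p≁r c z~r with Cap.around c z~r
  ... | 1st i    = p≢r (sym i)
  ... | 2nd i    = q≢r (sym i)
  ... | 3rd refl = p≁r (Cap.px c)
  ... | 4th refl = p≁r (Cap.py c)

  module _ {p q r s} (braces : Braces p q r s) (p≁r : ¬ (p ~ r))
           (¬deg3-q : ¬ HasDeg3 q) (¬deg3-s : ¬ HasDeg3 s) where

    open WithBraces braces
    private
      module M = Main braces p≁r ¬deg3-q ¬deg3-s

    labelled-V : ∀ {y z z′} → Cap p q s y z → Cap r s q y z′ → Labelled a b 7 P-V B-V
    labelled-V {y} {z} {z′} c c′ = label-by braces (y ∷ z ∷ s ∷ r ∷ q ∷ p ∷ z′ ∷ []) 5F 4F 3F 2F refl refl refl refl
      (from-yes (symmetric? P-V)) (from-yes (irreflexive? P-V)) (from-yes (isBraceTable? 5F 4F 3F 2F B-V))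
      [] (from-yes (twins? P-V [])) [] cover
      (c.yz ∷ ~-sym c.xy ∷ ~-sym c′.py ∷ ~-sym c.qy ∷ ~-sym c.py ∷ c′.yz ∷
       ~-sym c.xz ∷ ¬~⇒≁ (cap-end-≁ q≢r p≢r p≁r c) ∷ ~-sym c.qz ∷ ~-sym c.pz ∷ ¬~⇒≁ z≁z′ ∷
       ¬~⇒≁ (r≁s ∘ ~-sym) ∷ ~-sym c.qx ∷ ~-sym c.px ∷ c′.qz ∷
       c′.px ∷ ¬~⇒≁ (p≁r ∘ ~-sym) ∷ c′.pz ∷
       ¬~⇒≁ (p≁q ∘ ~-sym) ∷ c′.xz ∷
       ¬~⇒≁ (cap-end-≁ (≢-sym p≢s) (≢-sym p≢r) (p≁r ∘ ~-sym) c′ ∘ ~-sym) ∷ [])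
      where
      module c = Cap c
      module c′ = Cap c′
      z≁z′ : ¬ (z ~ z′)
      z≁z′ e with c.around e
      ... | 1st refl = p≁r (~-sym c′.pz)
      ... | 2nd i    = ~⇒≢ c′.xz (sym i)
      ... | 3rd i    = ~⇒≢ c′.qz (sym i)
      ... | 4th i    = ~⇒≢ c′.yz (sym i)
      cover : ∀ v → ∃[ i ] v ≡ lookup (y ∷ z ∷ s ∷ r ∷ q ∷ p ∷ z′ ∷ []) i
      cover v with M.place c c′ v
      ... | inj₁ (1st i) = 5F , i
      ... | inj₁ (2nd i) = 4F , i
      ... | inj₁ (3rd i) = 3F , i
      ... | inj₁ (4th i) = 2F , i
      ... | inj₂ (inj₁ (1st i))  = 2F , i
      ... | inj₂ (inj₁ (2nd i))  = 0F , i
      ... | inj₂ (inj₁ (3rd! i)) = 1F , i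
      ... | inj₂ (inj₂ (1st i))  = 4F , i
      ... | inj₂ (inj₂ (2nd i))  = 0F , i
      ... | inj₂ (inj₂ (3rd! i)) = 6F , i

    labelled-II : ∀ {x y} → Cap p q x y s → Cap r s x y q → Labelled a b 6 P-II B-II
    labelled-II {x} {y} c c′ = label-by braces (s ∷ p ∷ x ∷ q ∷ y ∷ r ∷ []) 1F 3F 5F 0F refl refl refl refl
      (from-yes (symmetric? P-II)) (from-yes (irreflexive? P-II)) (from-yes (isBraceTable? 1F 3F 5F 0F B-II))
      [] (from-yes (twins? P-II [])) [] cover
      (~-sym c.pz ∷ ~-sym c.xz ∷ ~-sym c.qz ∷ ~-sym c.yz ∷ ¬~⇒≁ (r≁s ∘ ~-sym) ∷
       c.px ∷ ¬~⇒≁ p≁q ∷ c.py ∷ ¬~⇒≁ p≁r ∷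
       ~-sym c.qx ∷ c.xy ∷ ~-sym c′.px ∷
       c.qy ∷ ~-sym c′.pz ∷
       ~-sym c′.py ∷ [])
      where
      module c = Cap c
      module c′ = Cap c′
      cover : ∀ v → ∃[ i ] v ≡ lookup (s ∷ p ∷ x ∷ q ∷ y ∷ r ∷ []) i
      cover v with M.place c c′ v
      ... | inj₁ (1st i) = 1F , i
      ... | inj₁ (2nd i) = 3F , i
      ... | inj₁ (3rd i) = 5F , i
      ... | inj₁ (4th i) = 0F , i
      ... | inj₂ (inj₁ (1st i))  = 2F , i
      ... | inj₂ (inj₁ (2nd i))  = 4F , i
      ... | inj₂ (inj₁ (3rd! i)) = 0F , i
      ... | inj₂ (inj₂ (1st i))  = 2F , i
      ... | inj₂ (inj₂ (2nd i))  = 4F , i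
      ... | inj₂ (inj₂ (3rd! i)) = 3F , i

    -- The edge q s would be contractible.
    same-corners : ∀ {x y z z′} → q ≢ s → Cap p q x y z → Cap r s x y z′ → z ≡ s
    same-corners {x} {y} {z} {z′} q≢s c c′ with z ≟ s
    ... | yes e = e
    ... | no z≢s with M.far-side (proj₂ (jordan (Cap.qx c) (Cap.xy c) (Cap.qy c) (Cap.nonfacial c)))
    ...   | A , σ , Ar , ¬Ap , p≢q , p≢x , p≢y with apex-inside σ
    -- `g` is the apex of the edge `q x` on the side of `r`. Side conditions and non-adjacencies to
    -- `q` exclude every vertex but `s`, and `s` is excluded because the edge `q s` would be
    -- contractible.
    ...     | g , Ag , f = ⊥-elim (absurd (M.place c c′ g))
      where
      module c = Cap c
      module c′ = Cap c′
      q≁z′ : ¬ (q ~ z′)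
      q≁z′ e with c′.around (~-sym e)
      ... | 1st i = q≢r i
      ... | 2nd i = q≢s i
      ... | 3rd i = ~⇒≢ c.qx i
      ... | 4th i = ~⇒≢ c.qy i
      q≁r : ¬ (q ~ r)
      q≁r e with c′.deg3 q (~-sym e)
      ... | 1st i = ~⇒≢ c.qx i
      ... | 2nd i = ~⇒≢ c.qy i
      ... | 3rd! refl with c′.around c.qz
      ...   | 1st refl = p≁r c.pz
      ...   | 2nd i    = z≢s i
      ...   | 3rd i    = ~⇒≢ c.xz (sym i)
      ...   | 4th i    = ~⇒≢ c.yz (sym i)
      s≁p : ¬ (s ~ p)
      s≁p e with c.deg3 s (~-sym e)
      ... | 1st i  = ~⇒≢ c′.qx i
      ... | 2nd i  = ~⇒≢ c′.qy i
      ... | 3rd! i = z≢s (sym i)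
      s≁z : ¬ (s ~ z)
      s≁z e with c.around (~-sym e)
      ... | 1st i = p≢s (sym i)
      ... | 2nd i = q≢s (sym i)
      ... | 3rd i = ~⇒≢ c′.qx i
      ... | 4th i = ~⇒≢ c′.qy i
      common : ∀ {v} → q ~ v → s ~ v → v ≡ x ⊎ v ≡ y
      common {v} q~v s~v with M.place c c′ v
      ... | inj₁ (1st refl) = ⊥-elim (s≁p s~v)
      ... | inj₁ (2nd refl) = ⊥-elim (~⇒≢ q~v refl)
      ... | inj₁ (3rd refl) = ⊥-elim (q≁r q~v)
      ... | inj₁ (4th refl) = ⊥-elim (~⇒≢ s~v refl)
      ... | inj₂ (inj₁ (1st i))     = inj₁ i
      ... | inj₂ (inj₁ (2nd i))     = inj₂ i
      ... | inj₂ (inj₁ (3rd! refl)) = ⊥-elim (s≁z s~v)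
      ... | inj₂ (inj₂ (1st i))     = inj₁ i
      ... | inj₂ (inj₂ (2nd i))     = inj₂ i
      ... | inj₂ (inj₂ (3rd! refl)) = ⊥-elim (q≁z′ q~v)
      q≁s : ¬ (q ~ s)
      q≁s q~s = not-blocked (irreducible q~s good)
        where
        good : ¬ Bad q s
        -- The only common neighbours of `q` and `s` are `x` and `y`, so these must be the two
        -- apexes of the edge, and both 3-cycles on it are faces.
        good (w , _ , s~w , q~w , ¬f) with apexes-among q~s (λ f → common (Facial-~₃ f) (Facial-~₂ f))
        ... | _ , fx , fy with common q~w s~w
        ...   | inj₁ refl = ¬f fx
        ...   | inj₂ refl = ¬f fy
        not-blocked : ¬ Blocked p q r s q s
        not-blocked (blocked left right (inj₁ br)) with Br-cases br
        ... | 1st (i , _) = p≢q (sym i)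
        ... | 3rd (i , _) = q≢r i
        ... | 4th (i , _) = q≢s i
        ... | 2nd (_ , refl) with right
        ...   | inj₁ e = s≁p e
        ...   | inj₂ br′ with Br-cases br′
        ...     | 1st (i , _) = p≢s (sym i)
        ...     | 2nd (i , _) = q≢s (sym i)
        ...     | 3rd (i , _) = r≢s (sym i)
        ...     | 4th (_ , i) = p≢r i
        not-blocked (blocked left right (inj₂ br)) with Br-cases br
        ... | 1st (i , _) = p≢s (sym i)
        ... | 2nd (i , _) = q≢s (sym i)
        ... | 3rd (i , _) = r≢s (sym i)
        ... | 4th (_ , refl) with left
        ...   | inj₁ e = q≁r e
        ...   | inj₂ br′ with Br-cases br′
        ...     | 1st (i , _) = p≢q (sym i)
        ...     | 2nd (_ , i) = p≢r (sym i)
        ...     | 3rd (i , _) = q≢r i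
        ...     | 4th (i , _) = q≢s i
      ¬Az : A z ≡ false
      ¬Az = M.avoids σ ¬Ap p≢q p≢x p≢y c.pz
      absurd : ¬ (End g ⊎ (g ≡ x ⊎ g ≡ y ⊎ g ≡ z) ⊎ (g ≡ x ⊎ g ≡ y ⊎ g ≡ z′))
      absurd (inj₁ (1st refl)) = false≢true (trans (sym ¬Ap) Ag)
      absurd (inj₁ (2nd i))    = ~⇒≢ (Facial-~₃ f) (sym i)
      absurd (inj₁ (3rd refl)) = q≁r (Facial-~₃ f)
      absurd (inj₁ (4th refl)) = q≁s (Facial-~₃ f)
      absurd (inj₂ (inj₁ (1st refl)))  = false≢true (trans (sym (y∉ σ)) Ag)
      absurd (inj₂ (inj₁ (2nd refl)))  = false≢true (trans (sym (z∉ σ)) Ag)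
      absurd (inj₂ (inj₁ (3rd! refl))) = false≢true (trans (sym ¬Az) Ag)
      absurd (inj₂ (inj₂ (1st refl)))  = false≢true (trans (sym (y∉ σ)) Ag)
      absurd (inj₂ (inj₂ (2nd refl)))  = false≢true (trans (sym (z∉ σ)) Ag)
      absurd (inj₂ (inj₂ (3rd! refl))) = q≁z′ (Facial-~₃ f)

  labelled-IV : ∀ {p q r x y z z′} → Braces p q r q → ¬ (p ~ r) → ¬ HasDeg3 q →
    Cap p q x y z → Cap r q x y z′ → Labelled a b 7 P-IV B-IV
  labelled-IV {p} {q} {r} {x} {y} {z} {z′} braces p≁r ¬deg3-q c c′ =
    label-by braces (x ∷ z ∷ y ∷ z′ ∷ q ∷ p ∷ r ∷ []) 5F 4F 6F 4F refl refl refl refl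
      (from-yes (symmetric? P-IV)) (from-yes (irreflexive? P-IV)) (from-yes (isBraceTable? 5F 4F 6F 4F B-IV))
      [] (from-yes (twins? P-IV [])) [] cover
      (c.xz ∷ c.xy ∷ c′.xz ∷ ~-sym c.qx ∷ ~-sym c.px ∷ ~-sym c′.px ∷
       ~-sym c.yz ∷ ¬~⇒≁ z≁z′ ∷ ~-sym c.qz ∷ ~-sym c.pz ∷ ¬~⇒≁ (cap-end-≁ q≢r p≢r p≁r c) ∷
       c′.yz ∷ ~-sym c.qy ∷ ~-sym c.py ∷ ~-sym c′.py ∷
       ~-sym c′.qz ∷ ¬~⇒≁ (cap-end-≁ (≢-sym p≢q) (≢-sym p≢r) (p≁r ∘ ~-sym) c′) ∷ ~-sym c′.pz ∷
       ¬~⇒≁ (p≁q ∘ ~-sym) ∷ ¬~⇒≁ (r≁s ∘ ~-sym) ∷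
       ¬~⇒≁ p≁r ∷ [])
    where
    open WithBraces braces
    module c = Cap c
    module c′ = Cap c′
    z≁z′ : ¬ (z ~ z′)
    z≁z′ e with c.around e
    ... | 1st refl = p≁r (~-sym c′.pz)
    ... | 2nd i    = ~⇒≢ c′.qz (sym i)
    ... | 3rd i    = ~⇒≢ c′.xz (sym i)
    ... | 4th i    = ~⇒≢ c′.yz (sym i)
    cover : ∀ v → ∃[ i ] v ≡ lookup (x ∷ z ∷ y ∷ z′ ∷ q ∷ p ∷ r ∷ []) i
    cover v with Main.place braces p≁r ¬deg3-q ¬deg3-q c c′ v
    ... | inj₁ (1st i) = 5F , i
    ... | inj₁ (2nd i) = 4F , i
    ... | inj₁ (3rd i) = 6F , i
    ... | inj₁ (4th i) = 4F , i
    ... | inj₂ (inj₁ (1st i))  = 0F , i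
    ... | inj₂ (inj₁ (2nd i))  = 2F , i
    ... | inj₂ (inj₁ (3rd! i)) = 1F , i
    ... | inj₂ (inj₂ (1st i))  = 0F , i
    ... | inj₂ (inj₂ (2nd i))  = 2F , i
    ... | inj₂ (inj₂ (3rd! i)) = 3F , i

  private
    -- For `q ≠ s` the third neighbour of `p` is `s`. All neighbours of `s` are then known, and the
    -- only one that `z′` can be is `q`.
    same : ∀ {p q r s x y z z′} → Braces p q r s → ¬ (p ~ r) → ¬ HasDeg3 q → ¬ HasDeg3 s →
      Cap p q x y z → Cap r s x y z′ → Outcome
    same {p} {q} {r} {s} braces p≁r ¬dq ¬ds c c′ with q ≟ s
    ... | yes refl = 4th (inj₁ (labelled-IV braces p≁r ¬dq c c′))
    ... | no q≢s with same-corners braces p≁r ¬dq ¬ds q≢s c c′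
    ...   | refl with Cap.around c (Cap.qz c′)
    ...     | 1st refl = ⊥-elim (p≁r (~-sym (Cap.pz c′)))
    ...     | 2nd refl = 2nd (labelled-II braces p≁r ¬dq ¬ds c c′)
    ...     | 3rd i    = ⊥-elim (~⇒≢ (Cap.xz c′) (sym i))
    ...     | 4th i    = ⊥-elim (~⇒≢ (Cap.yz c′) (sym i))

    -- The roles of the two caps are exchanged: `x′` must be `s`, `y` or `q`, and it is adjacent to
    -- the first two.
    through-s : ∀ {p q r s y z x′ z′} → Braces p q r s → ¬ (p ~ r) → ¬ HasDeg3 q → ¬ HasDeg3 s →
      Cap p q s y z → Cap r s x′ y z′ → Outcome
    through-s {y = y} braces p≁r ¬dq ¬ds c c′
      with Main.shared-corner (exchange braces) (p≁r ∘ ~-sym) ¬ds ¬dq c′ c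
    ... | 1st i     = ⊥-elim (~⇒≢ (Cap.qx c′) (sym i))
    ... | 2nd i     = ⊥-elim (~⇒≢ (Cap.xy c′) i)
    ... | 3rd! refl = 4th (inj₂ (labelled-V braces p≁r ¬dq ¬ds c c′))

    opposite-ends : ∀ {p q r s} → Braces p q r s → ¬ (p ~ r) → ¬ HasDeg3 q → ¬ HasDeg3 s →
      HasDeg3 p → HasDeg3 r → Outcome
    opposite-ends braces p≁r ¬dq ¬ds hp hr
      with Main.cap braces p≁r ¬dq ¬ds hp | Main.cap (exchange braces) (p≁r ∘ ~-sym) ¬ds ¬dq hr
    ... | x , y , z , c | x′ , y′ , z′ , c′
      with Main.shared-corner braces p≁r ¬dq ¬ds c c′ | Main.shared-corner braces p≁r ¬dq ¬ds (Cap-swap c) c′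
    ... | 1st refl  | 1st i     = ⊥-elim (~⇒≢ (Cap.xy c) (sym i))
    ... | 1st refl  | 2nd refl  = same braces p≁r ¬dq ¬ds c c′
    ... | 2nd refl  | 1st refl  = same braces p≁r ¬dq ¬ds c (Cap-swap c′)
    ... | 2nd refl  | 2nd i     = ⊥-elim (~⇒≢ (Cap.xy c) (sym i))
    ... | 3rd! refl | 1st refl  = through-s braces p≁r ¬dq ¬ds c (Cap-swap c′)
    ... | 3rd! refl | 2nd refl  = through-s braces p≁r ¬dq ¬ds c c′
    ... | 3rd! refl | 3rd! i    = ⊥-elim (~⇒≢ (Cap.xy c) (sym i))
    ... | 1st refl  | 3rd! refl = through-s braces p≁r ¬dq ¬ds (Cap-swap c) (Cap-swap c′)
    ... | 2nd refl  | 3rd! refl = through-s braces p≁r ¬dq ¬ds (Cap-swap c) c′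

    -- If `q` has degree 3, at least one of `e` and `f` is a different end, which `exchange` turns
    -- into `p`. Otherwise `e` and `f` are `p` and `r`.
    common-end : ∀ {p q r e f} → Braces p q r q → e ≢ f → ¬ (e ~ f) → HasDeg3 e → HasDeg3 f →
      e ≡ p ⊎ e ≡ q ⊎ e ≡ r → f ≡ p ⊎ f ≡ q ⊎ f ≡ r → Outcome
    common-end {p} {q} {r} {e} {f} braces e≢f e≁f he hf ie jf with HasDeg3? q
    ... | yes hq = 3rd (case ie of λ where
          (1st refl)  → CommonEndDeg3.labelled braces he hq
          (3rd! refl) → CommonEndDeg3.labelled (exchange braces) he hq
          (2nd refl)  → case jf of λ where
            (1st refl)  → CommonEndDeg3.labelled braces hf hq
            (3rd! refl) → CommonEndDeg3.labelled (exchange braces) hf hq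
            (2nd i)     → ⊥-elim (e≢f (sym i)))
    ... | no ¬hq with ie | jf
    ...   | 2nd refl  | _         = ⊥-elim (¬hq he)
    ...   | _         | 2nd refl  = ⊥-elim (¬hq hf)
    ...   | 1st i     | 1st j     = ⊥-elim (e≢f (trans i (sym j)))
    ...   | 3rd! i    | 3rd! j    = ⊥-elim (e≢f (trans i (sym j)))
    ...   | 1st refl  | 3rd! refl = opposite-ends braces e≁f ¬hq ¬hq he hf
    ...   | 3rd! refl | 1st refl  = opposite-ends braces (e≁f ∘ ~-sym) ¬hq ¬hq hf he

    reverse₂ : ∀ {p q r s} → q ≢ s → p ≢ s → Braces p q r s → Braces p q s r
    reverse₂ q≢s p≢s = exchange ∘ reverse (≢-sym q≢s) ∘ exchange

    disjoint-ends : ∀ {p q r s} → q ≢ s → Braces p q r s → ¬ (p ~ r) → HasDeg3 p → HasDeg3 r → Outcome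
    disjoint-ends q≢s braces p≁r hp hr = opposite-ends braces p≁r
      (both-deg3-absurd braces q≢s hp) (both-deg3-absurd (exchange braces) (≢-sym q≢s) hr) hp hr

    across : ∀ {p q r s e f} → q ≢ s → Braces p q r s → ¬ (e ~ f) → HasDeg3 e → HasDeg3 f →
      e ≡ p ⊎ e ≡ q → f ≡ r ⊎ f ≡ s → Outcome
    across q≢s br e≁f he hf (inj₁ refl) (inj₁ refl) = disjoint-ends q≢s br e≁f he hf
    across q≢s br e≁f he hf (inj₁ refl) (inj₂ refl) =
      disjoint-ends (Braces.q≢r br) (reverse₂ q≢s (Braces.p≢s br) br) e≁f he hf
    across q≢s br e≁f he hf (inj₂ refl) (inj₁ refl) = disjoint-ends (Braces.p≢s br) (reverse q≢s br) e≁f he hf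
    across q≢s br e≁f he hf (inj₂ refl) (inj₂ refl) =
      disjoint-ends (Braces.p≢r br) (reverse₂ (Braces.p≢s br) q≢s (reverse q≢s br)) e≁f he hf

    disjoint : ∀ {p q r s e f} → q ≢ s → Braces p q r s → e ≢ f → ¬ (e ~ f) → HasDeg3 e → HasDeg3 f →
      e ≡ p ⊎ e ≡ q ⊎ e ≡ r ⊎ e ≡ s → f ≡ p ⊎ f ≡ q ⊎ f ≡ r ⊎ f ≡ s → Outcome
    disjoint q≢s br e≢f e≁f he hf (1st i) (1st j) = ⊥-elim (e≢f (trans i (sym j)))
    disjoint q≢s br e≢f e≁f he hf (2nd i) (2nd j) = ⊥-elim (e≢f (trans i (sym j)))
    disjoint q≢s br e≢f e≁f he hf (3rd i) (3rd j) = ⊥-elim (e≢f (trans i (sym j)))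
    disjoint q≢s br e≢f e≁f he hf (4th i) (4th j) = ⊥-elim (e≢f (trans i (sym j)))
    disjoint q≢s br e≢f e≁f he hf (1st refl) (2nd refl) = ⊥-elim (both-deg3-absurd br q≢s he hf)
    disjoint q≢s br e≢f e≁f he hf (2nd refl) (1st refl) = ⊥-elim (both-deg3-absurd br q≢s hf he)
    disjoint q≢s br e≢f e≁f he hf (3rd refl) (4th refl) = ⊥-elim (both-deg3-absurd (exchange br) (≢-sym q≢s) he hf)
    disjoint q≢s br e≢f e≁f he hf (4th refl) (3rd refl) = ⊥-elim (both-deg3-absurd (exchange br) (≢-sym q≢s) hf he)
    disjoint q≢s br e≢f e≁f he hf (1st i) (inj₂ (inj₂ j)) = across q≢s br e≁f he hf (inj₁ i) j
    disjoint q≢s br e≢f e≁f he hf (2nd i) (inj₂ (inj₂ j)) = across q≢s br e≁f he hf (inj₂ i) j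
    disjoint q≢s br e≢f e≁f he hf (inj₂ (inj₂ i)) (1st j) = across q≢s br (e≁f ∘ ~-sym) hf he (inj₁ j) i
    disjoint q≢s br e≢f e≁f he hf (inj₂ (inj₂ i)) (2nd j) = across q≢s br (e≁f ∘ ~-sym) hf he (inj₂ j) i

    three : ∀ {p q r : V} {v} → v ≡ p ⊎ v ≡ q ⊎ v ≡ r ⊎ v ≡ q → v ≡ p ⊎ v ≡ q ⊎ v ≡ r
    three (1st i) = 1st i
    three (2nd i) = 2nd i
    three (3rd i) = 3rd! i
    three (4th i) = 2nd i

  classify : ∀ {p q r s} → Braces p q r s → Outcome
  classify {p} {q} {r} {s} braces with any? (λ u → any? λ v → Bad? u v)
  ... | no none = 1st (NoNonFacial.octahedron braces λ bad → none (_ , _ , bad))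
  ... | yes (u , v , w , nf) with NonFacial-sep nf
  ...   | A , σ with WithBraces.deg3-inside braces σ | WithBraces.deg3-inside braces (coside-sep u v w A σ)
  ...     | e , ie , Ae , he | f , jf , Bf , hf with coside⁻ u v w A Bf
  ...       | ¬Af , f≢u , f≢v , f≢w = finish (q ≟ s)
    where
    e≁f : ¬ (e ~ f)
    e≁f e~f with closed σ Ae e~f
    ... | 1st Af = false≢true (trans (sym ¬Af) Af)
    ... | 2nd i  = f≢u i
    ... | 3rd i  = f≢v i
    ... | 4th i  = f≢w i
    finish : Dec (q ≡ s) → Outcome
    finish (yes refl) = common-end braces (≢-by Ae ¬Af) e≁f he hf (three ie) (three jf)
    finish (no q≢s)   = disjoint q≢s braces (≢-by Ae ¬Af) e≁f he hf ie jf

-- Irreducible braced triangulations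

module SphereIsPlanar {m} (a : Adj (suc m)) (simple : IsSimple a) (connected : Connected a)
         (R : RotationSystem a) (triangular : AllFacesTriangles R)
         (E : ℕ) (numEdges≡E : numEdges a ≡ E) (euler : suc m + (2 * E) / 3 ≡ E + 2)
         {p q} (p≢q : p ≢ q) (p≁q : a p q ≡ false) where

  open Surface a simple connected R triangular
  open SphereHomology a simple connected R triangular E numEdges≡E euler

  private
    V = Fin (suc m)

  -- The two faces at the edge X Y have different values, and the value of a vertex off the triangle
  -- is that of any face around it.
  separation : ∀ {X Y Z} → X ~ Y → Y ~ Z → X ~ Z → ¬ Facial X Y Z → ∃[ A ] Separation a X Y Z A
  separation {X} {Y} {Z} X~Y Y~Z X~Z ¬f = A , record
    { x~y = X~Y ; y~z = Y~Z ; x~z = X~Z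
    ; x∉ = dec-false (In? X) (λ { (p , _) → p refl })
    ; y∉ = dec-false (In? Y) (λ { (_ , p , _) → p refl })
    ; z∉ = dec-false (In? Z) (λ { (_ , _ , p , _) → p refl })
    ; inhabited = inhabited
    ; coinhabited = coinhabited
    ; closed = closed }
    where
    open Bounding X~Y Y~Z X~Z
    open Solution solution
    In : V → Set
    In v = v ≢ X × v ≢ Y × v ≢ Z × ∃[ w ] x v w ≡ true
    In? : ∀ v → Dec (In v)
    In? v = ¬? (v ≟ X) ×-dec ¬? (v ≟ Y) ×-dec ¬? (v ≟ Z) ×-dec any? (λ w → x v w 𝔹.≟ true)
    A : V → Bool
    A v = does (In? v)
    support : ∀ {v w} → x v w ≡ true → v ~ w
    support {v} {w} e with true⊎false (a v w)
    ... | inj₁ p = p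
    ... | inj₂ p = ⊥-elim (false≢true (trans (sym (vanishes p)) e))
    closed : ∀ {u v} → A u ≡ true → u ~ v → A v ≡ true ⊎ v ≡ X ⊎ v ≡ Y ⊎ v ≡ Z
    closed {u} {v} Au u~v with does⇒ (In? u) Au | one-of-three? X Y Z v
    ... | _ | inj₁ c = inj₂ c
    ... | i , j , k , w , e | inj₂ (i′ , j′ , k′) = inj₁ (dec-true (In? v) (i′ , j′ , k′ , u ,
      trans (sym (balanced-off i j k v)) (trans (constant-off i j k u~v (support e)) e)))
    apex-off : ∀ {w} → Facial X Y w → w ≢ X × w ≢ Y × w ≢ Z
    apex-off f = ~⇒≢ (Facial-~ (Facial-rotate (Facial-rotate f))) , ≢-sym (~⇒≢ (Facial-~ (Facial-rotate f))) ,
                 λ { refl → ¬f f }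
    inhabited : ∃[ v ] A v ≡ true
    inhabited with Face-exists (~-sym X~Y)
    ... | w , f with apex-off (inj₂ f)
    -- The face on the dart `Y X` has the value of `jump`, so its third vertex belongs to `A`.
    ...   | i , j , k = w , dec-true (In? w) (i , j , k , Y ,
      trans (sym (trans (face-constant f) (face-constant (Face-rotate f)))) jump)
    coinhabited : ∃[ v ] (A v ≡ false × v ≢ X × v ≢ Y × v ≢ Z)
    coinhabited with Face-exists X~Y
    ... | w , f with apex-off (inj₁ f)
    -- The face on the dart `X Y` has the normalised value zero, and so have all faces around its
    -- third vertex.
    ...   | i , j , k = w , dec-false (In? w) (λ { (_ , _ , _ , g , e) → false≢true (trans
      (sym (trans (sym (trans (face-constant f) (face-constant (Face-rotate f)))) based))
      (trans (constant-off i j k (Face-~ (Face-rotate (Face-rotate f))) (support e)) e)) }) , i , j , k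

  planar : Planar a
  planar = record
    { Facial = Facial ; ~-sym = ~-sym ; ~⇒≢ = ~⇒≢ ; Facial-~ = Facial-~ ; Facial-swap = Facial-swap
    ; Facial-rotate = Facial-rotate ; apexes = apexes p≢q p≁q ; link-connected = link-connected
    ; everywhere = λ Q closed {u} Qu v → reach-closed Q closed (connected u v) Qu
    ; jordan = separation }

T-∨⁻ : ∀ x {y} → T (x ∨ y) → x ≡ true ⊎ y ≡ true
T-∨⁻ x t = ∨-true⁻ x (T⇒≡ t)

module _ {n} (Γ : BracedTriangulation n) (irr : Irreducible Γ) (planar : Planar (P Γ)) where

  open PlanarGraph planar
  open Braced planar (B Γ)

  private
    Obstructs : V → V → V → Set
    Obstructs u v g = T (G Γ u g) × T (G Γ v g) × T (B Γ u g ∨ B Γ v g)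

    Obstructs? : ∀ u v g → Dec (Obstructs u v g)
    Obstructs? u v g = 𝔹.T? _ ×-dec 𝔹.T? _ ×-dec 𝔹.T? _

  -- All 3-cycles through a good edge are faces, and there are two faces at the edge. It is thus
  -- contractible in the triangulation, and irreducibility has to supply a brace; deciding
  -- `Obstructs` turns the double negation into a witness.
  obstruction : ∀ {u v} → u ~ v → ¬ Bad u v → ∃[ g ]
    ((u ~ g ⊎ B Γ u g ≡ true) × (v ~ g ⊎ B Γ v g ≡ true) × (B Γ u g ≡ true ⊎ B Γ v g ≡ true))
  obstruction {u} {v} u~v good with any? (Obstructs? u v)
  ... | yes (g , i , j , k) = g , T-∨⁻ (P Γ u g) i , T-∨⁻ (P Γ v g) j , T-∨⁻ (B Γ u g) k
  ... | no none = ⊥-elim (irr u v (≡⇒T u~v) ((≡⇒T u~v , two) , λ g o → none (g , o)))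
    where
    two : num3CyclesThrough (P Γ) u v ≡ 2
    two with apexes u~v
    ... | w , w′ , w≢w′ , f , f′ , only =
      count≡2⁺ (λ g → P Γ u g ∧ P Γ v g) w w′ (Unique.allFin⁺ n) (∈-allFin w) (∈-allFin w′) w≢w′
        (∧-true (Facial-~₃ f) (Facial-~₂ f)) (∧-true (Facial-~₃ f′) (Facial-~₂ f′)) among
      where
      among : ∀ g → P Γ u g ∧ P Γ v g ≡ true → g ≡ w ⊎ g ≡ w′
      among g e with ∧-true⁻ (P Γ u g) e
      ... | u~g , v~g with Facial? u~v g
      ...   | yes h = only h
      ...   | no ¬h = ⊥-elim (good (g , u~v , v~g , u~g , ¬h))

  module _ {p q r s : V} (covers : ∀ {u v} → B Γ u v ≡ true → Brace p q r s u v)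
           (joined : ∀ {u v} → Brace p q r s u v → B Γ u v ≡ true) where

    two-braces : p ≢ r → p ≢ s → q ≢ r → Braces p q r s
    two-braces p≢r p≢s q≢r = record
      { p≢q = joined⇒≢ (joined pq) ; r≢s = joined⇒≢ (joined rs)
      ; p≢r = p≢r ; p≢s = p≢s ; q≢r = q≢r
      ; p≁q = ≁⇒¬~ (B-nonP Γ p q (≡⇒T (joined pq))) ; r≁s = ≁⇒¬~ (B-nonP Γ r s (≡⇒T (joined rs)))
      ; joined⇒brace = covers ; brace⇒joined = joined
      ; irreducible = λ u~v good → let _ , l , r , br = obstruction u~v good in
          blocked (Sum.map₂ covers l) (Sum.map₂ covers r) (Sum.map covers covers br) }
      where
      joined⇒≢ : ∀ {u v} → B Γ u v ≡ true → u ≢ v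
      joined⇒≢ e refl = false≢true (trans (sym (proj₂ (B-simple Γ) _)) e)

  private
    B-sym : ∀ {u v} → B Γ u v ≡ true → B Γ v u ≡ true
    B-sym {u} {v} e = trans (proj₁ (B-simple Γ) v u) e

    Ordered : V → V → Set
    Ordered u v = toℕ u < toℕ v × B Γ u v ≡ true

    module Ends {u v u′ v′} (o : Ordered u v) (o′ : Ordered u′ v′) (differ : ¬ (u ≡ u′ × v ≡ v′))
             (only : ∀ {c d} → Ordered c d → (c ≡ u × d ≡ v) ⊎ (c ≡ u′ × d ≡ v′)) where

      covers : ∀ {c d} → B Γ c d ≡ true → Brace u v u′ v′ c d
      covers {c} {d} e with ℕ.<-cmp (toℕ c) (toℕ d)
      ... | tri< lt _ _ with only (lt , e)
      ...   | inj₁ (refl , refl) = pq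
      ...   | inj₂ (refl , refl) = rs
      covers {c} {d} e | tri> _ _ gt with only (gt , B-sym e)
      ...   | inj₁ (refl , refl) = qp
      ...   | inj₂ (refl , refl) = sr
      covers {c} {d} e | tri≈ _ i _ with toℕ-injective i
      ...   | refl = ⊥-elim (false≢true (trans (sym (proj₂ (B-simple Γ) c)) e))

      joined : ∀ {c d} → Brace u v u′ v′ c d → B Γ c d ≡ true
      joined pq = proj₂ o
      joined qp = B-sym (proj₂ o)
      joined rs = proj₂ o′
      joined sr = B-sym (proj₂ o′)

      u≢v : u ≢ v
      u≢v refl = ℕ.<-irrefl refl (proj₁ o)
      u′≢v′ : u′ ≢ v′
      u′≢v′ refl = ℕ.<-irrefl refl (proj₁ o′)

      -- Distinct braces share at most one end; each of the first cases turns the pairs so that this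
      -- end takes the places `q` and `s`.
      braces : ∃[ p ] ∃[ q ] ∃[ r ] ∃[ s ] Braces p q r s
      braces with u ≟ u′ | v ≟ v′ | u ≟ v′ | v ≟ u′
      ... | yes i | yes j | _ | _ = ⊥-elim (differ (i , j))
      ... | yes refl | no v≢v′ | _ | _ = v , u , v′ , u , two-braces
        (λ e → case covers e of λ { pq → qp ; qp → pq ; rs → sr ; sr → rs })
        (λ { pq → joined qp ; qp → joined pq ; rs → joined sr ; sr → joined rs })
        v≢v′ (≢-sym u≢v) u′≢v′
      ... | no u≢u′ | yes refl | _ | _ = u , v , u′ , v , two-braces covers joined u≢u′ u≢v (≢-sym u′≢v′)
      ... | no u≢u′ | no v≢v′ | yes refl | _ = v , u , u′ , u , two-braces
        (λ e → case covers e of λ { pq → qp ; qp → pq ; rs → rs ; sr → sr })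
        (λ { pq → joined qp ; qp → joined pq ; rs → joined rs ; sr → joined sr })
        -- Two coincidences would make the braces the same pair in opposite orders, although both
        -- are sorted.
        (λ { refl → ℕ.<-asym (proj₁ o) (proj₁ o′) }) (≢-sym u≢v) u≢u′
      ... | no u≢u′ | no v≢v′ | no u≢v′ | yes refl = u , v , v′ , v , two-braces
        (λ e → case covers e of λ { pq → pq ; qp → qp ; rs → sr ; sr → rs })
        (λ { pq → joined pq ; qp → joined qp ; rs → joined sr ; sr → joined rs })
        u≢v′ u≢v v≢v′
      ... | no u≢u′ | no v≢v′ | no u≢v′ | no v≢u′ = u , v , u′ , v′ , two-braces covers joined u≢u′ u≢v′ v≢u′

  braces-exist : numBraces Γ ≡ 2 → ∃[ p ] ∃[ q ] ∃[ r ] ∃[ s ] Braces p q r s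
  braces-exist two with count≡2⁻ (isEdge (B Γ)) (orderedPairs-unique n) two
  ... | (u , v) , (u′ , v′) , ne , e , e′ , only =
    Ends.braces (ordered e) (ordered e′) (λ { (refl , refl) → ne refl }) λ {c} {d} o →
      case only (c , d) (∈-orderedPairs c d) (∧-true (<⇒<ᵇ≡true (proj₁ o)) (proj₂ o)) of λ where
        (inj₁ refl) → inj₁ (refl , refl)
        (inj₂ refl) → inj₂ (refl , refl)
    where
    ordered : ∀ {u v} → isEdge (B Γ) (u , v) ≡ true → Ordered u v
    ordered {u} {v} e = let i , j = ∧-true⁻ (toℕ u <ᵇ toℕ v) e in <ᵇ≡true⇒< i , j

Labelled⇒IsoTo : ∀ {n m} (Γ : BracedTriangulation n) {P′ B′ : Adj m} → Labelled (P Γ) (B Γ) m P′ B′ → IsoTo Γ m P′ B′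
Labelled⇒IsoTo Γ {P′} {B′} l = mk↔ₛ′ index label (λ i → injective (sym (label-index (label i)))) (λ v → sym (label-index v)) ,
  λ u v → trans (cong₂ (P Γ) (label-index u) (label-index v)) (edges (index u) (index v)) ,
          trans (cong₂ (B Γ) (label-index u) (label-index v)) (braces (index u) (index v))
  where
  open Labelled l
  index = λ v → proj₁ (covers v)
  label-index : ∀ v → v ≡ label (index v)
  label-index v = proj₂ (covers v)

nonadjacent-pair : ∀ {n} (Γ : BracedTriangulation n) → numBraces Γ ≡ 2 → ∃[ p ] ∃[ q ] (p ≢ q × P Γ p q ≡ false)
nonadjacent-pair {n} Γ two with count≡2⁻ (isEdge (B Γ)) (orderedPairs-unique n) two
... | (u , v) , _ , _ , e , _ with ∧-true⁻ (toℕ u <ᵇ toℕ v) e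
...   | u<v , br = u , v , (λ i → ℕ.<-irrefl (cong toℕ i) (<ᵇ≡true⇒< {toℕ u} {toℕ v} u<v)) , B-nonP Γ u v (≡⇒T br)

theorem4p1 : ∀ {n : ℕ} (Γ : BracedTriangulation n) →
    Irreducible Γ → numBraces Γ ≡ 2 →
    IsoTo Γ 6 P-I B-I ⊎ IsoTo Γ 6 P-II B-II ⊎ IsoTo Γ 6 P-II B-III ⊎
    IsoTo Γ 7 P-IV B-IV ⊎ IsoTo Γ 7 P-V B-V
theorem4p1 {zero} Γ irr two with proj₁ (P-tri Γ)
... | ()
theorem4p1 {suc m} Γ irr two =
  let _ , simple , connected , R , triangular , euler = P-tri Γ
      _ , _ , p≢q , p≁q = nonadjacent-pair Γ two
      planar = SphereIsPlanar.planar (P Γ) simple connected R triangular (numEdges (P Γ)) refl euler p≢q p≁q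
      _ , _ , _ , _ , braces = braces-exist Γ irr planar two
  in Sum.map (Labelled⇒IsoTo Γ) (Sum.map (Labelled⇒IsoTo Γ) (Sum.map (Labelled⇒IsoTo Γ)
       (Sum.map (Labelled⇒IsoTo Γ) (Labelled⇒IsoTo Γ)))) (Final.classify planar (B Γ) braces)
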